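{- Let $d\ge 2$ be an integer and let $p\in(0,1)$ be constant. Starting from the unit mass $\delta_o$ at the origin $o$ of the lattice $\mathbb{Z}^d$, the minimum number of toppling moves needed to transport mass $p$ to distance at least $n$ from the origin satisfies $$N_p(\mathbb{Z}^d,B_n,\delta_o)=\Theta(n^{d+2}),$$ i.e. there exist constants $0<c\le C<\infty$ and $n_0$, depending only on $d$ and $p$, such that $c\,n^{d+2}\le N_p(\mathbb{Z}^d,B_n,\delta_o)\le C\,n^{d+2}$ for all integers $n\ge n_0$.
   Context: $\mathbb{Z}^d$ is the nearest-neighbour graph on the integer lattice (vertices $x,y$ adjacent iff $\|x-y\|_1=1$). Toppling: let $G=(V,E)$ be a connected, locally finite graph, and write $y\sim v$ when $y,v$ are adjacent and $\mathcal{N}_v=\{y:y\sim v\}$. A mass distribution is a function $\mu:V\to[0,\infty)$. For a vertex $v$ with $\mu(v)>0$ and $0<m\le\mu(v)$, the toppling move $T_v^m$ topples mass $m$ at $v$ equally to its neighbours: $T_v^m\mu=\mu-m\delta_v+\frac{m}{|\mathcal{N}_v|}\sum_{y\sim v}\delta_y$. For $A\subset V$, $p>0$ and an initial mass distribution $\mu_0$, $N_p(G,A,\mu_0)$ is the minimum number of successive toppling moves needed to obtain from $\mu_0$ a mass distribution $\mu$ with $\sum_{v\notin A}\mu(v)\ge p$ (and $\infty$ if this is impossible). $B_n=\{u\in V: d_G(u,o)<n\}$ is the open ball of radius $n$ around $o$ in the graph distance $d_G$. -}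

module Defs where

open import Algebra.Bundles using (CommutativeRing)
import Algebra.Properties.Ring as RingProperties
import Algebra.Properties.Semiring.Mult as Mult
open import Axiom.ExcludedMiddle using (ExcludedMiddle)
open import Data.Bool.Base using (if_then_else_)
open import Data.Integer.Base as ℤ using (ℤ; +_; -[1+_]; 0ℤ; 1ℤ; -1ℤ; ∣_∣)
import Data.Integer.Properties as ℤ
open import Data.List.Base using (List; []; _∷_; map; foldr; length)
open import Data.List.Membership.Propositional using (_∈_)
open import Data.List.Membership.Propositional.Properties using (∈-map⁺; ∈-map⁻)
open import Data.List.Relation.Unary.All as All using (All; []; _∷_)
import Data.List.Relation.Unary.All.Properties as All
open import Data.List.Relation.Unary.AllPairs using ([]; _∷_)
open import Data.List.Relation.Unary.Any using (here; there)
open import Data.List.Relation.Unary.Unique.Propositional using (Unique)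
import Data.List.Relation.Unary.Unique.Propositional.Properties as Unique
import Data.Maybe.Base as Maybe
open import Data.Nat.Base as ℕ using (ℕ; zero; suc; z≤n; s≤s)
import Data.Nat.Properties as ℕ
open import Data.Product.Base using (∃; _×_; _,_; proj₁; proj₂)
open import Data.Sum.Base using (inj₁; inj₂)
open import Data.Vec.Base using (Vec; []; _∷_; replicate; zipWith; sum)
open import Data.Vec.Properties using (∷-injective; ∷-injectiveˡ; ∷-injectiveʳ)
open import Function.Base using (_∘_)
open import Level using (0ℓ)
open import Relation.Binary.Core using (Rel)
open import Relation.Binary.Construct.Closure.ReflexiveTransitive using (Star; ε; _◅_; _◅◅_; fold; gmap; reverse)
open import Relation.Binary.PropositionalEquality.Core using (_≡_; _≢_; refl; sym; trans; cong; cong₂; subst)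
import Relation.Binary.Construct.Add.Supremum.NonStrict as AddSupremum
import Relation.Binary.Construct.NonStrictToStrict as Strict
open import Relation.Binary.Structures using (IsTotalOrder)
open import Relation.Nullary.Construct.Add.Supremum using (_⁺; [_]; ⊤⁺)
open import Relation.Nullary.Decidable.Core using (does; yes; no)
open import Relation.Nullary.Negation.Core using (¬_; contradiction)
open import Relation.Unary using (Pred; ∁)

------------------------------------------------------------------------
-- Real numbers

-- Classically ℝ is, up to a unique isomorphism, the only model.  The value
-- 0# ⁻¹ is left unspecified.
record CompleteOrderedField : Set₁ where
  infix  8 _⁻¹
  infix  4 _≤_
  field
    commutativeRing : CommutativeRing 0ℓ 0ℓ
  open CommutativeRing commutativeRing public hiding (refl; sym; trans; zero)
  field
    _⁻¹          : Carrier → Carrier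
    *-inverseʳ   : ∀ x → ¬ (x ≈ 0#) → x * x ⁻¹ ≈ 1#
    0≉1          : ¬ (0# ≈ 1#)
    _≤_          : Rel Carrier 0ℓ
    isTotalOrder : IsTotalOrder _≈_ _≤_
    +-monoʳ-≤    : ∀ z {x y} → x ≤ y → z + x ≤ z + y
    *-nonneg     : ∀ {x y} → 0# ≤ x → 0# ≤ y → 0# ≤ x * y

  UpperBound : Pred Carrier 0ℓ → Pred Carrier 0ℓ
  UpperBound S b = ∀ {x} → S x → x ≤ b

  field
    complete : (S : Pred Carrier 0ℓ) → ∃ S → ∃ (UpperBound S) →
               ∃ λ s → UpperBound S s × (∀ {b} → UpperBound S b → s ≤ b)

  open Strict _≈_ _≤_ public using (_<_)
  open AddSupremum _≤_ public using (_≤⁺_)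

  fromℕ : ℕ → Carrier
  fromℕ n = Mult._×_ semiring n 1#

  fromℕ⁺ : ℕ ⁺ → Carrier ⁺
  fromℕ⁺ = Maybe.map fromℕ

  ∑ : {A : Set} → List A → (A → Carrier) → Carrier
  ∑ l f = foldr _+_ 0# (map f l)

  0≤1 : 0# ≤ 1#
  0≤1 with IsTotalOrder.total isTotalOrder 0# 1#
  ... | inj₁ 0≤1 = 0≤1
  ... | inj₂ 1≤0 = ≤-respʳ-≈ square (*-nonneg 0≤-1 0≤-1)
    where
    open IsTotalOrder isTotalOrder using (≤-respʳ-≈; ≤-respˡ-≈)
    module ≈ = CommutativeRing commutativeRing
    open RingProperties ring using (-1*x≈-x; -‿involutive)
    0≤-1 : 0# ≤ - 1#
    0≤-1 = ≤-respˡ-≈ (-‿inverseˡ 1#) (≤-respʳ-≈ (+-identityʳ (- 1#)) (+-monoʳ-≤ (- 1#) 1≤0))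
    square : - 1# * - 1# ≈ 1#
    square = ≈.trans (-1*x≈-x (- 1#)) (-‿involutive 1#)

------------------------------------------------------------------------
-- Graphs

steps : {A : Set} {R : Rel A 0ℓ} {x y : A} → Star R x y → ℕ
steps = fold (λ _ _ → ℕ) (λ _ n → suc n) 0

-- Connected, locally finite, simple graphs.
record Graph : Set₁ where
  infix 4 _~_
  field
    V         : Set
    _~_       : Rel V 0ℓ
    ~-sym     : ∀ {u v} → u ~ v → v ~ u
    ~-irrefl  : ∀ {v} → ¬ (v ~ v)
    𝒩         : V → List V
    𝒩-unique  : ∀ v → Unique (𝒩 v)
    𝒩-sound   : ∀ {v y} → y ∈ 𝒩 v → y ~ v
    𝒩-complete : ∀ {v y} → y ~ v → y ∈ 𝒩 v
    connected : ∀ u v → Star _~_ u v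

------------------------------------------------------------------------
-- The integer lattice

‖_-_‖₁ : ∀ {d} → Vec ℤ d → Vec ℤ d → ℕ
‖ x - y ‖₁ = sum (zipWith (λ a b → ∣ a ℤ.- b ∣) x y)

private
  ‖-‖₁-sym : ∀ {d} (x y : Vec ℤ d) → ‖ x - y ‖₁ ≡ ‖ y - x ‖₁
  ‖-‖₁-sym []      []      = refl
  ‖-‖₁-sym (a ∷ x) (b ∷ y) = cong₂ ℕ._+_ (ℤ.∣i-j∣≡∣j-i∣ a b) (‖-‖₁-sym x y)

  ∣a-a∣≡0 : ∀ a → ∣ a ℤ.- a ∣ ≡ 0
  ∣a-a∣≡0 a = cong ∣_∣ (ℤ.+-inverseʳ a)

  ‖-‖₁-refl : ∀ {d} (x : Vec ℤ d) → ‖ x - x ‖₁ ≡ 0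
  ‖-‖₁-refl []      = refl
  ‖-‖₁-refl (a ∷ x) = cong₂ ℕ._+_ (∣a-a∣≡0 a) (‖-‖₁-refl x)

  ‖-‖₁≡0⇒≡ : ∀ {d} (x y : Vec ℤ d) → ‖ x - y ‖₁ ≡ 0 → x ≡ y
  ‖-‖₁≡0⇒≡ []      []      _ = refl
  ‖-‖₁≡0⇒≡ (a ∷ x) (b ∷ y) e = cong₂ _∷_
    (ℤ.i-j≡0⇒i≡j a b (ℤ.∣i∣≡0⇒i≡0 (ℕ.m+n≡0⇒m≡0 _ e)))
    (‖-‖₁≡0⇒≡ x y (ℕ.m+n≡0⇒n≡0 ∣ a ℤ.- b ∣ e))

  c+a-a≡c : ∀ c a → (c ℤ.+ a) ℤ.- a ≡ c
  c+a-a≡c c a = trans (ℤ.+-assoc c a (ℤ.- a))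
    (trans (cong (λ z → c ℤ.+ z) (ℤ.+-inverseʳ a)) (ℤ.+-identityʳ c))

  a-b+b≡a : ∀ a b → (a ℤ.- b) ℤ.+ b ≡ a
  a-b+b≡a a b = trans (ℤ.+-assoc a (ℤ.- b) b)
    (trans (cong (λ z → a ℤ.+ z) (ℤ.+-inverseˡ b)) (ℤ.+-identityʳ a))

ℤ-neighbours : ∀ {d} → Vec ℤ d → List (Vec ℤ d)
ℤ-neighbours []      = []
ℤ-neighbours (a ∷ x) = (1ℤ ℤ.+ a ∷ x) ∷ (-1ℤ ℤ.+ a ∷ x) ∷ map (a ∷_) (ℤ-neighbours x)

private
  nbrs-sound : ∀ {d} {x y : Vec ℤ d} → y ∈ ℤ-neighbours x → ‖ y - x ‖₁ ≡ 1
  nbrs-sound {x = a ∷ x} (here refl) =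
    cong₂ ℕ._+_ (cong ∣_∣ (c+a-a≡c 1ℤ a)) (‖-‖₁-refl x)
  nbrs-sound {x = a ∷ x} (there (here refl)) =
    cong₂ ℕ._+_ (cong ∣_∣ (c+a-a≡c -1ℤ a)) (‖-‖₁-refl x)
  nbrs-sound {x = a ∷ x} (there (there p)) with ∈-map⁻ (a ∷_) p
  ... | z , z∈ , refl = cong₂ ℕ._+_ (∣a-a∣≡0 a) (nbrs-sound z∈)

  nbrs-complete : ∀ {d} {x y : Vec ℤ d} → ‖ y - x ‖₁ ≡ 1 → y ∈ ℤ-neighbours x
  nbrs-complete {x = []}    {[]}    ()
  nbrs-complete {x = a ∷ x} {b ∷ y} e = go (b ℤ.- a) refl e
    where
    at : ∀ c → b ℤ.- a ≡ c → b ≡ c ℤ.+ a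
    at c q = trans (sym (a-b+b≡a b a)) (cong (ℤ._+ a) q)
    go : ∀ c → b ℤ.- a ≡ c → ∣ c ∣ ℕ.+ ‖ y - x ‖₁ ≡ 1 → (b ∷ y) ∈ ℤ-neighbours (a ∷ x)
    go (+ 0) q e with refl ← ℤ.i-j≡0⇒i≡j b a q = there (there (∈-map⁺ (a ∷_) (nbrs-complete e)))
    go (+ 1) q e = here (cong₂ _∷_ (at 1ℤ q) (‖-‖₁≡0⇒≡ y x (ℕ.suc-injective e)))
    go -[1+ 0 ] q e = there (here (cong₂ _∷_ (at -1ℤ q) (‖-‖₁≡0⇒≡ y x (ℕ.suc-injective e))))
    go (+ suc (suc _)) q ()
    go -[1+ suc _ ] q ()

  nbrs-unique : ∀ {d} (x : Vec ℤ d) → Unique (ℤ-neighbours x)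
  nbrs-unique []      = []
  nbrs-unique (a ∷ x) =
    (±-distinct ∷ All.map⁺ (All.tabulate λ _ → c+a≢a 1ℤ (λ ()) ∘ ∷-injectiveˡ)) ∷
    All.map⁺ (All.tabulate λ _ → c+a≢a -1ℤ (λ ()) ∘ ∷-injectiveˡ) ∷
    Unique.map⁺ ∷-injectiveʳ (nbrs-unique x)
    where
    c+a≢a : ∀ c → c ≢ 0ℤ → c ℤ.+ a ≢ a
    c+a≢a c c≢0 e = c≢0 (trans (sym (c+a-a≡c c a)) (ℤ.i≡j⇒i-j≡0 e))
    ±-distinct : (1ℤ ℤ.+ a ∷ x) ≢ (-1ℤ ℤ.+ a ∷ x)
    ±-distinct e
      with trans (sym (c+a-a≡c 1ℤ a)) (trans (cong (ℤ._- a) (∷-injectiveˡ e)) (c+a-a≡c -1ℤ a))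
    ... | ()

  Adjacent : ∀ {d} → Rel (Vec ℤ d) 0ℓ
  Adjacent x y = ‖ x - y ‖₁ ≡ 1

  Adjacent-sym : ∀ {d} {x y : Vec ℤ d} → Adjacent x y → Adjacent y x
  Adjacent-sym {x = x} {y} = trans (‖-‖₁-sym y x)

  to-0 : ∀ {d} a (x : Vec ℤ d) → Star Adjacent (a ∷ x) (0ℤ ∷ x)
  to-0 (+ 0)         x = ε
  to-0 (+ suc n)     x = nbrs-sound {x = + n ∷ x} (here refl) ◅ to-0 (+ n) x
  to-0 -[1+ 0 ]      x = nbrs-sound {x = 0ℤ ∷ x} (there (here refl)) ◅ ε
  to-0 -[1+ suc n ]  x = nbrs-sound {x = -[1+ n ] ∷ x} (there (here refl)) ◅ to-0 -[1+ n ] x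

  ℤ^-connected : ∀ {d} (x y : Vec ℤ d) → Star Adjacent x y
  ℤ^-connected []      []      = ε
  ℤ^-connected (a ∷ x) (b ∷ y) =
    to-0 a x ◅◅
    gmap (0ℤ ∷_) (λ e → e) (ℤ^-connected x y) ◅◅
    reverse (λ {u} {v} → Adjacent-sym {x = u} {v}) (to-0 b y)

ℤ^ : ℕ → Graph
ℤ^ d = record
  { V          = Vec ℤ d
  ; _~_        = λ x y → ‖ x - y ‖₁ ≡ 1
  ; ~-sym      = λ {u} {v} → Adjacent-sym {x = u} {v}
  ; ~-irrefl   = λ {v} e → ℕ.0≢1+n (trans (sym (‖-‖₁-refl v)) e)
  ; 𝒩          = ℤ-neighbours
  ; 𝒩-unique   = nbrs-unique
  ; 𝒩-sound    = nbrs-sound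
  ; 𝒩-complete = nbrs-complete
  ; connected  = ℤ^-connected
  }

origin : ∀ {d} → Vec ℤ d
origin = replicate _ 0ℤ

------------------------------------------------------------------------
-- Toppling

-- Excluded middle is what makes distances, infinite sums and minimal
-- numbers of moves total functions.
module Toppling (lem : ExcludedMiddle 0ℓ) (ℝ : CompleteOrderedField) where

  open CompleteOrderedField ℝ

  least : {P : Pred ℕ 0ℓ} (n : ℕ) → P n → ∃ λ k → P k × (∀ {j} → P j → k ℕ.≤ j)
  least     zero    p = zero , p , λ _ → z≤n
  least {P} (suc n) p with lem {P zero}
  ... | yes p₀ = zero , p₀ , λ _ → z≤n
  ... | no ¬p₀ with least {P ∘ suc} n p
  ...   | k , pₖ , k-least =
    suc k , pₖ , λ { {zero} p₀ → contradiction p₀ ¬p₀ ; {suc j} pⱼ → s≤s (k-least pⱼ) }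

  -- The least element of P, with min ∅ = ∞.
  min : Pred ℕ 0ℓ → ℕ ⁺
  min P with lem {∃ P}
  ... | yes (n , p) = [ proj₁ (least {P} n p) ]
  ... | no  _       = ⊤⁺

  -- The sum ∑_{v ∈ S} f(v) ∈ [0,∞] of a nonnegative function: the supremum
  -- of its finite partial sums.
  data PartialSum {A : Set} (S : Pred A 0ℓ) (f : A → Carrier) : Pred Carrier 0ℓ where
    partialSum : ∀ l → Unique l → All S l → PartialSum S f (∑ l f)

  ∑⁺ : {A : Set} → Pred A 0ℓ → (A → Carrier) → Carrier ⁺
  ∑⁺ S f with lem {∃ (UpperBound (PartialSum S f))}
  ... | yes bounded = [ proj₁ (complete (PartialSum S f) (0# , partialSum [] [] []) bounded) ]
  ... | no  _       = ⊤⁺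

  module _ (G : Graph) where
    open Graph G

    distance : V → V → ℕ
    distance u v =
      proj₁ (least {λ k → ∃ λ (w : Star _~_ u v) → steps w ≡ k} _ (connected u v , refl))

    Ball : V → ℕ → Pred V 0ℓ
    Ball o n u = distance u o ℕ.< n

    record Mass : Set where
      field
        mass   : V → Carrier
        nonneg : ∀ v → 0# ≤ mass v
    open Mass public

    indicator : V → V → Carrier
    indicator v w = if does (lem {v ≡ w}) then 1# else 0#

    δ : V → Mass
    δ v .mass     = indicator v
    δ v .nonneg w with lem {v ≡ w}
    ... | yes _ = 0≤1
    ... | no  _ = IsTotalOrder.reflexive isTotalOrder (CommutativeRing.refl commutativeRing)

    T : V → Carrier → (V → Carrier) → (V → Carrier)
    T v m μ w = μ w - m * indicator v w
              + m * fromℕ (length (𝒩 v)) ⁻¹ * ∑ (𝒩 v) (λ y → indicator y w)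

    record Move (μ μ′ : Mass) : Set where
      field
        vertex   : V
        amount   : Carrier
        0<mass   : 0# < mass μ vertex
        0<amount : 0# < amount
        amount≤  : amount ≤ mass μ vertex
        result   : ∀ w → mass μ′ w ≈ T vertex amount (mass μ) w

    Transports : Carrier → Pred V 0ℓ → Mass → Pred ℕ 0ℓ
    Transports p A μ₀ k = ∃ λ μ → ∃ λ (moves : Star Move μ₀ μ) →
      steps moves ≡ k × [ p ] ≤⁺ ∑⁺ (∁ A) (mass μ)

    N : Carrier → Pred V 0ℓ → Mass → ℕ ⁺
    N p A μ₀ = min (Transports p A μ₀)

module Submission where

-- Upper bound: toppling every site of Bₙ completely, one after the other, raises the second
-- moment ∑ μ(x) |x|² by at least the mass that was in Bₙ.  The second moment stays at most n², so
-- after O(n²) such sweeps of O(n^d) moves at most 1 − p is left in Bₙ.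
--
-- Lower bound: write Δ = I − P for the averaging operator P of the simple random walk, and let u be
-- the odometer, so that μ = δₒ − Δu and ∑ u, the second moment, is at least of order n².  Compare u
-- with w = ∑_{j<K} Pʲδₒ for K a small multiple of n²: then ∑ w ≤ K and Δw = δₒ − Pᴷδₒ ≥ δₒ − λ with
-- λ = O(n^(−d)), and U = max (u − w) 0 still satisfies ∑ U ≥ c n².  If a move raises U(v) by m, then
-- u(v) > w(v) afterwards, and μ(v) ≥ 0 gives m + ΔU(v) ≤ λ.  Hence ⟨U, ΔU⟩ + 2λ ∑ U grows by at
-- most 2mλ − m² + 2λm ≤ 4λ² in each move.  As ⟨U, ΔU⟩ ≥ 0, k moves give c n² ≤ ∑ U ≤ 2λk.
--
-- Heat kernel bound: the exponential generating function of the number of n-step walks to x is the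
-- product of those of the coordinates, so by Cauchy–Schwarz for binomial convolutions everything
-- reduces to the bound 4ʲ / (j + 1) for the square of a binomial coefficient j C i.

open import Algebra.Bundles using (CommutativeRing)
import Algebra.Properties.AbelianGroup as AbelianGroupProperties
import Algebra.Properties.CommutativeSemiring.Exp as Exp
import Algebra.Properties.Ring as RingProperties
import Algebra.Properties.Semiring.Mult as Mult
import Algebra.Solver.Ring as RingSolver
open import Algebra.Solver.Ring.AlmostCommutativeRing using (fromCommutativeRing; _-Raw-AlmostCommutative⟶_)
open import Axiom.ExcludedMiddle using (ExcludedMiddle)
open import Data.Integer.Base as ℤ using (ℤ; +_; -[1+_]; 0ℤ; 1ℤ; -1ℤ; ∣_∣)
import Data.Integer.Properties as ℤ
import Data.Integer.Solver as ℤS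
open import Data.List.Base using (List; []; _∷_; map; length; _++_; concatMap; upTo; cartesianProductWith; filter)
open import Data.List.Membership.Propositional using (_∈_; _∉_; lose)
open import Data.List.Membership.Propositional.Properties using (∈-++⁺ˡ; ∈-++⁺ʳ; ∈-concatMap⁺; ∈-map⁺; ∈-map⁻; ∈-upTo⁺; ∈-cartesianProductWith⁺; ∈-filter⁺; ∈-filter⁻)
open import Data.List.Properties using (length-map; length-++; length-upTo; length-filter; filter-accept; filter-reject)
open import Data.List.Relation.Binary.Subset.Propositional using (_⊆_)
open import Data.List.Relation.Unary.All as All using (All; []; _∷_)
import Data.List.Relation.Unary.All.Properties as All
open import Data.List.Relation.Unary.AllPairs using ([]; _∷_)
open import Data.List.Relation.Unary.Any using (here; there)
open import Data.List.Relation.Unary.Unique.Propositional using (Unique)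
import Data.List.Relation.Unary.Unique.Propositional.Properties as Unique
import Data.Maybe.Base as Maybe
open import Data.Nat.Base as ℕ using (ℕ; zero; suc; z≤n; s≤s)
import Data.Nat.DivMod as ℕ
import Data.Nat.Properties as ℕ
import Data.Nat.Solver as ℕS
open import Data.Product.Base using (∃; _×_; _,_; proj₁; proj₂)
open import Data.Sum.Base using (_⊎_; inj₁; inj₂; fromInj₁)
open import Data.Vec.Base using (Vec; []; _∷_)
open import Data.Vec.Properties using (∷-injective)
open import Defs
open import Function.Base using (_∘_)
open import Level using (0ℓ)
open import Relation.Binary.Bundles using (Poset)
import Relation.Binary.Construct.Add.Supremum.NonStrict as AddSupremum
open import Relation.Binary.Construct.Closure.ReflexiveTransitive using (Star; ε; _◅_; _◅◅_; gmap)
open import Relation.Binary.PropositionalEquality.Core as ≡ using (_≡_; _≢_)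
open import Relation.Binary.PropositionalEquality.Properties using (module ≡-Reasoning)
import Relation.Binary.Reasoning.PartialOrder as PosetReasoning
open import Relation.Binary.Structures using (IsTotalOrder)
open import Relation.Nullary.Construct.Add.Supremum using ([_])
open import Relation.Nullary.Decidable.Core using (yes; no; dec⇒maybe)
open import Relation.Nullary.Negation.Core using (¬_; contradiction)
open import Relation.Unary using (Pred; ∁)

-- The obstacle to the lower bound is that one move can be huge: the first may topple the whole unit
-- mass, so the amounts are not of order `n^(-d)`. Subtracting w from the odometer removes the
-- source at the origin, but leaves only `m + ΔU(v) ≤ λ`, where `ΔU(v)` may be very negative. The
-- energy pays for this: a gain m far above λ lowers it by almost m². With a weight c in place of 2λ
-- the same computation gives `∑ U ≤ k (2λ + c)² / 4c`, and c = 2λ is the minimiser.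
--
-- The mass outside the ball is a supremum of finite sums, so a finite sum is only known to reach
-- some η below p; here η = p/2. The time K is n² divided by an integer at least 2d/η, so that w
-- accounts for at most half of the second moment that the escaped mass forces. The heat kernel is
-- bounded through its square because d/2 need not be an integer.
--
-- Finitely many moves touch finitely many sites, so the whole energy argument lives on a finite
-- list of sites, with zero boundary values outside.

-- A ring solver with integer coefficients.

module IntegerCoefficients (R : CommutativeRing 0ℓ 0ℓ) where
  open CommutativeRing R hiding (zero)
  open RingProperties ring using (-‿distribˡ-*; -‿distribʳ-*; -‿involutive; -0#≈0#)
  open AbelianGroupProperties +-abelianGroup using (⁻¹-∙-comm)
  open Mult semiring using (×-homo-+; ×1-homo-*) renaming (_×_ to _⋆_)
  open import Relation.Binary.Reasoning.Setoid setoid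

  fromℤ : ℤ → Carrier
  fromℤ (+ n)    = n ⋆ 1#
  fromℤ -[1+ n ] = - (suc n ⋆ 1#)

  fromℤ-neg : ∀ i → fromℤ (ℤ.- i) ≈ - fromℤ i
  fromℤ-neg (+ zero)  = sym -0#≈0#
  fromℤ-neg (+ suc n) = refl
  fromℤ-neg -[1+ n ]  = sym (-‿involutive _)

  [1+x]-[1+y]≈x-y : ∀ x y → (1# + x) - (1# + y) ≈ x - y
  [1+x]-[1+y]≈x-y x y = begin
    (1# + x) - (1# + y)    ≈⟨ +-congˡ (sym (⁻¹-∙-comm 1# y)) ⟩
    (1# + x) + (- 1# - y)  ≈⟨ +-congʳ (+-comm 1# x) ⟩
    (x + 1#) + (- 1# - y)  ≈⟨ +-assoc x 1# _ ⟩
    x + (1# + (- 1# - y))  ≈⟨ +-congˡ (sym (+-assoc 1# (- 1#) _)) ⟩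
    x + ((1# - 1#) - y)    ≈⟨ +-congˡ (+-congʳ (-‿inverseʳ 1#)) ⟩
    x + (0# - y)           ≈⟨ +-congˡ (+-identityˡ _) ⟩
    x - y                  ∎

  fromℤ-⊖ : ∀ m n → fromℤ (m ℤ.⊖ n) ≈ m ⋆ 1# - n ⋆ 1#
  fromℤ-⊖ m       zero    = sym (trans (+-congˡ -0#≈0#) (+-identityʳ _))
  fromℤ-⊖ zero    (suc n) = sym (+-identityˡ _)
  fromℤ-⊖ (suc m) (suc n) = begin
    fromℤ (suc m ℤ.⊖ suc n)   ≡⟨ ≡.cong fromℤ (ℤ.[1+m]⊖[1+n]≡m⊖n m n) ⟩
    fromℤ (m ℤ.⊖ n)           ≈⟨ fromℤ-⊖ m n ⟩
    m ⋆ 1# - n ⋆ 1#           ≈⟨ [1+x]-[1+y]≈x-y _ _ ⟨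
    suc m ⋆ 1# - suc n ⋆ 1#   ∎

  fromℤ-+ : ∀ i j → fromℤ (i ℤ.+ j) ≈ fromℤ i + fromℤ j
  fromℤ-+ (+ m)    (+ n)    = ×-homo-+ 1# m n
  fromℤ-+ (+ m)    -[1+ n ] = fromℤ-⊖ m (suc n)
  fromℤ-+ -[1+ m ] (+ n)    = trans (fromℤ-⊖ n (suc m)) (+-comm _ _)
  fromℤ-+ -[1+ m ] -[1+ n ] = begin
    - (suc (suc (m ℕ.+ n)) ⋆ 1#)     ≡⟨ ≡.cong (λ k → - (k ⋆ 1#)) (ℕ.+-suc (suc m) n) ⟨
    - ((suc m ℕ.+ suc n) ⋆ 1#)       ≈⟨ -‿cong (×-homo-+ 1# (suc m) (suc n)) ⟩
    - (suc m ⋆ 1# + suc n ⋆ 1#)      ≈⟨ ⁻¹-∙-comm _ _ ⟨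
    - (suc m ⋆ 1#) - (suc n ⋆ 1#)    ∎

  fromℤ-pos-* : ∀ m j → fromℤ (+ m ℤ.* j) ≈ m ⋆ 1# * fromℤ j
  fromℤ-pos-* m (+ n)    = trans (reflexive (≡.cong fromℤ (≡.sym (ℤ.pos-* m n)))) (×1-homo-* m n)
  fromℤ-pos-* m -[1+ n ] = begin
    fromℤ (+ m ℤ.* ℤ.- (+ suc n))  ≡⟨ ≡.cong fromℤ (≡.sym (ℤ.neg-distribʳ-* (+ m) (+ suc n))) ⟩
    fromℤ (ℤ.- (+ m ℤ.* + suc n))  ≈⟨ fromℤ-neg (+ m ℤ.* + suc n) ⟩
    - fromℤ (+ m ℤ.* + suc n)      ≈⟨ -‿cong (fromℤ-pos-* m (+ suc n)) ⟩
    - (m ⋆ 1# * (suc n ⋆ 1#))      ≈⟨ -‿distribʳ-* _ _ ⟩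
    m ⋆ 1# * - (suc n ⋆ 1#)        ∎

  fromℤ-* : ∀ i j → fromℤ (i ℤ.* j) ≈ fromℤ i * fromℤ j
  fromℤ-* (+ m)    j = fromℤ-pos-* m j
  fromℤ-* -[1+ m ] j = begin
    fromℤ (ℤ.- (+ suc m) ℤ.* j)  ≡⟨ ≡.cong fromℤ (≡.sym (ℤ.neg-distribˡ-* (+ suc m) j)) ⟩
    fromℤ (ℤ.- (+ suc m ℤ.* j))  ≈⟨ fromℤ-neg (+ suc m ℤ.* j) ⟩
    - fromℤ (+ suc m ℤ.* j)      ≈⟨ -‿cong (fromℤ-pos-* (suc m) j) ⟩
    - (suc m ⋆ 1# * fromℤ j)     ≈⟨ -‿distribˡ-* _ _ ⟩
    - (suc m ⋆ 1#) * fromℤ j     ∎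

  -- fromℤ 1ℤ is 1# + 0#; the solver should read con 1ℤ as 1#.
  fromℤ′ : ℤ → Carrier
  fromℤ′ (+ 1) = 1#
  fromℤ′ i     = fromℤ i

  fromℤ′≈fromℤ : ∀ i → fromℤ′ i ≈ fromℤ i
  fromℤ′≈fromℤ (+ 0)            = refl
  fromℤ′≈fromℤ (+ 1)            = sym (+-identityʳ 1#)
  fromℤ′≈fromℤ (+ suc (suc n))  = refl
  fromℤ′≈fromℤ -[1+ n ]         = refl

  -- Equality in the field is undecidable, whereas the solver must recognise equal coefficients in
  -- order to cancel terms; hence coefficients in ℤ. Numerals from 2 on unfold to `fromℕ`, so
  -- `con (+ 4)` stands for `fromℕ 4`.
  morphism : ℤ.+-*-rawRing -Raw-AlmostCommutative⟶ fromCommutativeRing R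
  morphism = record
    { ⟦_⟧    = fromℤ′
    ; +-homo = λ i j → trans (fromℤ′≈fromℤ (i ℤ.+ j)) (trans (fromℤ-+ i j)
                 (sym (+-cong (fromℤ′≈fromℤ i) (fromℤ′≈fromℤ j))))
    ; *-homo = λ i j → trans (fromℤ′≈fromℤ (i ℤ.* j)) (trans (fromℤ-* i j)
                 (sym (*-cong (fromℤ′≈fromℤ i) (fromℤ′≈fromℤ j))))
    ; -‿homo = λ i → trans (fromℤ′≈fromℤ (ℤ.- i)) (trans (fromℤ-neg i) (-‿cong (sym (fromℤ′≈fromℤ i))))
    ; 0-homo = refl
    ; 1-homo = refl
    }

  open RingSolver ℤ.+-*-rawRing (fromCommutativeRing R) morphism
    (λ i j → Maybe.map (λ e → reflexive (≡.cong fromℤ′ e)) (dec⇒maybe (i ℤ.≟ j))) public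
    using (solve; _:=_; _:+_; _:*_; _:-_; :-_; con)

-- Arithmetic in a complete ordered field.

module OrderedField (lem : ExcludedMiddle 0ℓ) (ℝ : CompleteOrderedField) where
  open CompleteOrderedField ℝ
  open IntegerCoefficients commutativeRing using (solve; _:=_; _:+_; _:*_; _:-_; :-_; con) public
  open IsTotalOrder isTotalOrder public
    using (total; antisym; isPartialOrder)
    renaming (trans to ≤-trans; refl to ≤-refl; reflexive to ≤-reflexive; ≤-respˡ-≈ to ≤-respˡ; ≤-respʳ-≈ to ≤-respʳ)
  module ≈ = CommutativeRing commutativeRing
  open Exp commutativeSemiring public using (_^_; ^-homo-*; ^-congˡ; ^-distrib-*)
  open Mult semiring using (×-homo-+; ×1-homo-*)
  poset : Poset 0ℓ 0ℓ 0ℓ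
  poset = record { isPartialOrder = isPartialOrder }
  module ≤-Reasoning = PosetReasoning poset

  em : ∀ {P : Set} → P ⊎ ¬ P
  em {P} with lem {P}
  ... | yes p = inj₁ p
  ... | no ¬p = inj₂ ¬p

  +-nonneg : ∀ {x y} → 0# ≤ x → 0# ≤ y → 0# ≤ x + y
  +-nonneg {x} {y} 0≤x 0≤y = ≤-trans 0≤x (≤-respˡ (+-identityʳ x) (+-monoʳ-≤ x 0≤y))

  -- Most inequalities below are proved by certificate: the slack `s` is a combination of quantities
  -- known to be nonnegative, and the remaining identity goes to the ring solver.
  ≤-by : ∀ {x y s} → 0# ≤ s → y ≈ x + s → x ≤ y
  ≤-by {x} 0≤s y≈x+s = ≤-respʳ (≈.sym y≈x+s) (≤-respˡ (+-identityʳ x) (+-monoʳ-≤ x 0≤s))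

  ≤⇒0≤- : ∀ {x y} → x ≤ y → 0# ≤ y - x
  ≤⇒0≤- {x} {y} x≤y = ≤-respˡ (-‿inverseˡ x) (≤-respʳ (+-comm (- x) y) (+-monoʳ-≤ (- x) x≤y))

  0≤-⇒≤ : ∀ {x y} → 0# ≤ y - x → x ≤ y
  0≤-⇒≤ {x} {y} h = ≤-by h (solve 2 (λ x y → y := x :+ (y :- x)) ≈.refl x y)

  +-mono : ∀ {x y z w} → x ≤ y → z ≤ w → x + z ≤ y + w
  +-mono {x} {y} {z} {w} x≤y z≤w = ≤-by (+-nonneg (≤⇒0≤- x≤y) (≤⇒0≤- z≤w))
    (solve 4 (λ x y z w → y :+ w := (x :+ z) :+ ((y :- x) :+ (w :- z))) ≈.refl x y z w)

  *-monoˡ : ∀ {x y z} → 0# ≤ z → x ≤ y → z * x ≤ z * y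
  *-monoˡ {x} {y} {z} 0≤z x≤y = ≤-by (*-nonneg 0≤z (≤⇒0≤- x≤y))
    (solve 3 (λ x y z → z :* y := z :* x :+ z :* (y :- x)) ≈.refl x y z)

  *-mono : ∀ {x y z w} → 0# ≤ x → 0# ≤ w → x ≤ y → z ≤ w → x * z ≤ y * w
  *-mono {x} {y} {z} {w} 0≤x 0≤w x≤y z≤w =
    ≤-trans (*-monoˡ 0≤x z≤w) (≤-respˡ (*-comm w x) (≤-respʳ (*-comm w y) (*-monoˡ 0≤w x≤y)))

  square-nonneg : ∀ x → 0# ≤ x * x
  square-nonneg x with total 0# x
  ... | inj₁ 0≤x = *-nonneg 0≤x 0≤x
  ... | inj₂ x≤0 = ≤-respʳ (solve 1 (λ x → (con 0ℤ :- x) :* (con 0ℤ :- x) := x :* x) ≈.refl x)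
                           (*-nonneg (≤⇒0≤- x≤0) (≤⇒0≤- x≤0))

  ≰⇒≥ : ∀ {x y} → ¬ (x ≤ y) → y ≤ x
  ≰⇒≥ {x} {y} x≰y with total x y
  ... | inj₁ x≤y = contradiction x≤y x≰y
  ... | inj₂ y≤x = y≤x

  <⇒≱ : ∀ {x y} → x < y → ¬ (y ≤ x)
  <⇒≱ (x≤y , x≉y) y≤x = x≉y (antisym x≤y y≤x)

  ≰⇒> : ∀ {x y} → ¬ (x ≤ y) → y < x
  ≰⇒> x≰y = ≰⇒≥ x≰y , λ y≈x → x≰y (≤-reflexive (≈.sym y≈x))

  <-respʳ : ∀ {x y z} → y ≈ z → x < y → x < z
  <-respʳ y≈z (x≤y , x≉y) = ≤-respʳ y≈z x≤y , λ x≈z → x≉y (≈.trans x≈z (≈.sym y≈z))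

  <-≤-trans : ∀ {x y z} → x < y → y ≤ z → x < z
  <-≤-trans x<y@(x≤y , _) y≤z =
    ≤-trans x≤y y≤z , λ x≈z → <⇒≱ x<y (≤-respʳ (≈.sym x≈z) y≤z)

  ≤-<-trans : ∀ {x y z} → x ≤ y → y < z → x < z
  ≤-<-trans x≤y y<z@(y≤z , _) =
    ≤-trans x≤y y≤z , λ x≈z → <⇒≱ y<z (≤-respˡ x≈z x≤y)

  0<1 : 0# < 1#
  0<1 = 0≤1 , 0≉1

  0<⇒≉0 : ∀ {x} → 0# < x → ¬ (x ≈ 0#)
  0<⇒≉0 (_ , 0≉x) x≈0 = 0≉x (≈.sym x≈0)

  0<-⇒< : ∀ {x y} → 0# < y - x → x < y
  0<-⇒< {x} {y} (0≤ , 0≉) = 0≤-⇒≤ 0≤ , λ x≈y →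
    0≉ (≈.sym (≈.trans (+-congˡ (-‿cong x≈y)) (-‿inverseʳ y)))

  <⇒0<- : ∀ {x y} → x < y → 0# < y - x
  <⇒0<- {x} {y} (x≤y , x≉y) = ≤⇒0≤- x≤y , λ 0≈ → x≉y (begin
    x             ≈⟨ +-identityʳ x ⟨
    x + 0#        ≈⟨ +-congˡ 0≈ ⟩
    x + (y - x)   ≈⟨ solve 2 (λ x y → x :+ (y :- x) := y) ≈.refl x y ⟩
    y             ∎)
    where open import Relation.Binary.Reasoning.Setoid setoid

  *-pos : ∀ {x y} → 0# < x → 0# < y → 0# < x * y
  *-pos {x} {y} (0≤x , 0≉x) (0≤y , 0≉y) = *-nonneg 0≤x 0≤y , λ 0≈xy → 0≉y (begin
    0#                ≈⟨ zeroˡ (x ⁻¹) ⟨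
    0# * x ⁻¹         ≈⟨ *-congʳ 0≈xy ⟩
    (x * y) * x ⁻¹    ≈⟨ solve 3 (λ x y z → (x :* y) :* z := y :* (x :* z)) ≈.refl x y (x ⁻¹) ⟩
    y * (x * x ⁻¹)    ≈⟨ *-congˡ (*-inverseʳ x (λ x≈0 → 0≉x (≈.sym x≈0))) ⟩
    y * 1#            ≈⟨ *-identityʳ y ⟩
    y                 ∎)
    where open import Relation.Binary.Reasoning.Setoid setoid

  *-cancelˡ-≤ : ∀ {x y z} → 0# < z → z * x ≤ z * y → x ≤ y
  *-cancelˡ-≤ {x} {y} {z} 0<z zx≤zy with total x y
  ... | inj₁ x≤y = x≤y
  ... | inj₂ y≤x = ≤-reflexive (begin
    x                ≈⟨ *-identityˡ x ⟨
    1# * x           ≈⟨ *-congʳ (*-inverseʳ z (0<⇒≉0 0<z)) ⟨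
    (z * z ⁻¹) * x   ≈⟨ solve 3 (λ x z i → (z :* i) :* x := i :* (z :* x)) ≈.refl x z (z ⁻¹) ⟩
    z ⁻¹ * (z * x)   ≈⟨ *-congˡ (antisym zx≤zy (*-monoˡ (proj₁ 0<z) y≤x)) ⟩
    z ⁻¹ * (z * y)   ≈⟨ solve 3 (λ y z i → i :* (z :* y) := (z :* i) :* y) ≈.refl y z (z ⁻¹) ⟩
    (z * z ⁻¹) * y   ≈⟨ *-congʳ (*-inverseʳ z (0<⇒≉0 0<z)) ⟩
    1# * y           ≈⟨ *-identityˡ y ⟩
    y                ∎)
    where open import Relation.Binary.Reasoning.Setoid setoid

  ⁻¹-nonneg : ∀ {x} → 0# < x → 0# ≤ x ⁻¹
  ⁻¹-nonneg {x} 0<x = *-cancelˡ-≤ 0<x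
    (≤-respˡ (≈.sym (zeroʳ x)) (≤-respʳ (≈.sym (*-inverseʳ x (0<⇒≉0 0<x))) 0≤1))

  ⁻¹-pos : ∀ {x} → 0# < x → 0# < x ⁻¹
  ⁻¹-pos {x} 0<x = ⁻¹-nonneg 0<x , λ 0≈ → 0≉1
    (≈.trans (≈.sym (zeroʳ x)) (≈.trans (*-congˡ 0≈) (*-inverseʳ x (0<⇒≉0 0<x))))

  -- Takes the place of square roots, both in Cauchy-Schwarz and in passing from the squared heat
  -- kernel to the heat kernel. If `y < x`, then `x * (x - y)` would be positive, which the
  -- certificate refutes.
  square-cancel-≤ : ∀ {x y} → 0# ≤ y → x * x ≤ y * y → x ≤ y
  square-cancel-≤ {x} {y} 0≤y xx≤yy with lem {x ≤ y}
  ... | yes x≤y = x≤y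
  ... | no  x≰y = contradiction
    (≤-by (+-nonneg (≤⇒0≤- xx≤yy) (*-nonneg 0≤y (≤⇒0≤- (proj₁ y<x))))
      (solve 2 (λ x y → con 0ℤ := x :* (x :- y) :+ ((y :* y :- x :* x) :+ y :* (x :- y))) ≈.refl x y))
    (<⇒≱ (*-pos (≤-<-trans 0≤y y<x) (<⇒0<- y<x)))
    where
    y<x : y < x
    y<x = ≰⇒> x≰y

  fromℕ-+ : ∀ m n → fromℕ (m ℕ.+ n) ≈ fromℕ m + fromℕ n
  fromℕ-+ = ×-homo-+ 1#

  fromℕ-* : ∀ m n → fromℕ (m ℕ.* n) ≈ fromℕ m * fromℕ n
  fromℕ-* = ×1-homo-*

  fromℕ-^ : ∀ m n → fromℕ (m ℕ.^ n) ≈ fromℕ m ^ n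
  fromℕ-^ m zero    = +-identityʳ 1#
  fromℕ-^ m (suc n) = ≈.trans (fromℕ-* m (m ℕ.^ n)) (*-congˡ (fromℕ-^ m n))

  fromℕ-nonneg : ∀ n → 0# ≤ fromℕ n
  fromℕ-nonneg zero    = ≤-refl
  fromℕ-nonneg (suc n) = +-nonneg 0≤1 (fromℕ-nonneg n)

  fromℕ-mono : ∀ {m n} → m ℕ.≤ n → fromℕ m ≤ fromℕ n
  fromℕ-mono {n = n} z≤n       = fromℕ-nonneg n
  fromℕ-mono         (s≤s m≤n) = +-monoʳ-≤ 1# (fromℕ-mono m≤n)

  0<fromℕ : ∀ n → 0# < fromℕ (suc n)
  0<fromℕ n = <-≤-trans 0<1 (≤-by (fromℕ-nonneg n) ≈.refl)

  ^-nonneg : ∀ {x} n → 0# ≤ x → 0# ≤ x ^ n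
  ^-nonneg zero    0≤x = 0≤1
  ^-nonneg (suc n) 0≤x = *-nonneg 0≤x (^-nonneg n 0≤x)

  -- If ℕ were bounded, its supremum s would be at least n + 1 for every n, so that s − 1
  -- would be an upper bound too.
  archimedean : ∀ x → ¬ (∀ n → fromℕ n ≤ x)
  archimedean x bounded
    with s , s-upper , s-least ← complete (λ y → ∃ λ n → fromℕ n ≈ y) (0# , 0 , ≈.refl)
                                          (x , λ { (n , n≈y) → ≤-respˡ n≈y (bounded n) })
    = <⇒≱ 0<1 (≤-by (≤⇒0≤- (s-least s-1-upper))
        (solve 1 (λ s → con 0ℤ := con 1ℤ :+ ((s :- con 1ℤ) :- s)) ≈.refl s))
    where
    s-1-upper : ∀ {y} → (∃ λ n → fromℕ n ≈ y) → y ≤ s - 1#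
    s-1-upper {y} (n , n≈y) = ≤-by (≤⇒0≤- (s-upper (suc n , ≈.refl)))
      (≈.trans (solve 2 (λ s n → s :- con 1ℤ := n :+ (s :- (con 1ℤ :+ n))) ≈.refl s (fromℕ n))
        (+-congʳ n≈y))

  ∃-upper : ∀ x → ∃ λ n → x ≤ fromℕ n
  ∃-upper x with lem {∃ λ n → x ≤ fromℕ n}
  ... | yes h = h
  ... | no ¬h = contradiction (λ n → ≰⇒≥ (λ x≤n → ¬h (n , x≤n))) (archimedean x)

  ^-mono : ∀ {x y} n → 0# ≤ x → x ≤ y → x ^ n ≤ y ^ n
  ^-mono zero    0≤x x≤y = ≤-refl
  ^-mono (suc n) 0≤x x≤y = *-mono 0≤x (^-nonneg n (≤-trans 0≤x x≤y)) x≤y (^-mono n 0≤x x≤y)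

  half : Carrier → Carrier
  half p = p * fromℕ 2 ⁻¹

  half-pos : ∀ {p} → 0# < p → 0# < half p
  half-pos 0<p = *-pos 0<p (⁻¹-pos (0<fromℕ 1))

  half< : ∀ {p} → 0# < p → half p < p
  half< {p} 0<p = 0<-⇒< (<-respʳ (begin
      half p                           ≈⟨ solve 2 (λ p i → p :* i := p :* (con (+ 2) :* i) :- p :* i) ≈.refl p (fromℕ 2 ⁻¹) ⟩
      p * (fromℕ 2 * fromℕ 2 ⁻¹) - half p  ≈⟨ +-congʳ (≈.trans (*-congˡ (*-inverseʳ _ (0<⇒≉0 (0<fromℕ 1)))) (*-identityʳ p)) ⟩
      p - half p                       ∎) (half-pos 0<p))
    where open import Relation.Binary.Reasoning.Setoid setoid

  ∃-multiple : ∀ x {y} → 0# < y → ∃ λ n → x < fromℕ (suc n) * y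
  ∃-multiple x {y} 0<y with ∃-upper (x * y ⁻¹)
  ... | n , xy⁻¹≤n = n , ≤-<-trans x≤ny (0<-⇒< (<-respʳ
      (solve 2 (λ y n → y := (con 1ℤ :+ n) :* y :- n :* y) ≈.refl y (fromℕ n)) 0<y))
    where
    x≤ny : x ≤ fromℕ n * y
    x≤ny = ≤-respˡ
      (≈.trans (solve 3 (λ y x i → y :* (x :* i) := x :* (y :* i)) ≈.refl y x (y ⁻¹))
        (≈.trans (*-congˡ (*-inverseʳ y (0<⇒≉0 0<y))) (*-identityʳ x)))
      (≤-respʳ (*-comm y (fromℕ n)) (*-monoˡ (proj₁ 0<y) xy⁻¹≤n))

-- Finite sums and indicators of vertices.

module Sums (lem : ExcludedMiddle 0ℓ) (ℝ : CompleteOrderedField) where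
  open CompleteOrderedField ℝ
  open OrderedField lem ℝ
  open Toppling lem ℝ
  open import Relation.Binary.Reasoning.Setoid setoid

  private variable A B : Set

  ∑-cong-∈ : ∀ (l : List A) {f g : A → Carrier} → (∀ {x} → x ∈ l → f x ≈ g x) → ∑ l f ≈ ∑ l g
  ∑-cong-∈ []      f≈g = ≈.refl
  ∑-cong-∈ (x ∷ l) f≈g = +-cong (f≈g (here ≡.refl)) (∑-cong-∈ l (f≈g ∘ there))

  ∑-cong : ∀ (l : List A) {f g : A → Carrier} → (∀ x → f x ≈ g x) → ∑ l f ≈ ∑ l g
  ∑-cong l f≈g = ∑-cong-∈ l (λ {x} _ → f≈g x)

  ∑-mono-∈ : ∀ (l : List A) {f g : A → Carrier} → (∀ {x} → x ∈ l → f x ≤ g x) → ∑ l f ≤ ∑ l g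
  ∑-mono-∈ []      f≤g = ≤-refl
  ∑-mono-∈ (x ∷ l) f≤g = +-mono (f≤g (here ≡.refl)) (∑-mono-∈ l (f≤g ∘ there))

  ∑-mono : ∀ (l : List A) {f g : A → Carrier} → (∀ x → f x ≤ g x) → ∑ l f ≤ ∑ l g
  ∑-mono l f≤g = ∑-mono-∈ l (λ {x} _ → f≤g x)

  ∑-nonneg : ∀ (l : List A) {f : A → Carrier} → (∀ x → 0# ≤ f x) → 0# ≤ ∑ l f
  ∑-nonneg []      0≤f = ≤-refl
  ∑-nonneg (x ∷ l) 0≤f = +-nonneg (0≤f x) (∑-nonneg l 0≤f)

  ∑-zero : ∀ (l : List A) → ∑ l (λ _ → 0#) ≈ 0#
  ∑-zero []      = ≈.refl
  ∑-zero (x ∷ l) = ≈.trans (+-identityˡ _) (∑-zero l)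

  ∑-const : ∀ (l : List A) x → ∑ l (λ _ → x) ≈ fromℕ (length l) * x
  ∑-const []      x = ≈.sym (zeroˡ x)
  ∑-const (_ ∷ l) x = ≈.trans (+-congˡ (∑-const l x))
    (solve 2 (λ x n → x :+ n :* x := (con 1ℤ :+ n) :* x) ≈.refl x (fromℕ (length l)))

  ∑-+ : ∀ (l : List A) (f g : A → Carrier) → ∑ l (λ x → f x + g x) ≈ ∑ l f + ∑ l g
  ∑-+ []      f g = ≈.sym (+-identityˡ 0#)
  ∑-+ (x ∷ l) f g = ≈.trans (+-congˡ (∑-+ l f g))
    (solve 4 (λ a b c d → (a :+ b) :+ (c :+ d) := (a :+ c) :+ (b :+ d)) ≈.refl (f x) (g x) (∑ l f) (∑ l g))

  ∑-*ˡ : ∀ (l : List A) c (f : A → Carrier) → ∑ l (λ x → c * f x) ≈ c * ∑ l f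
  ∑-*ˡ []      c f = ≈.sym (zeroʳ c)
  ∑-*ˡ (x ∷ l) c f = ≈.trans (+-congˡ (∑-*ˡ l c f)) (≈.sym (distribˡ c (f x) (∑ l f)))

  ∑-*ʳ : ∀ (l : List A) c (f : A → Carrier) → ∑ l (λ x → f x * c) ≈ ∑ l f * c
  ∑-*ʳ l c f = ≈.trans (∑-cong l (λ x → *-comm (f x) c)) (≈.trans (∑-*ˡ l c f) (*-comm c _))

  ∑-neg : ∀ (l : List A) (f : A → Carrier) → ∑ l (λ x → - f x) ≈ - ∑ l f
  ∑-neg []      f = solve 0 (con 0ℤ := :- con 0ℤ) ≈.refl
  ∑-neg (x ∷ l) f = ≈.trans (+-congˡ (∑-neg l f))
    (solve 2 (λ a b → (:- a) :+ (:- b) := :- (a :+ b)) ≈.refl (f x) (∑ l f))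

  ∑-minus : ∀ (l : List A) (f g : A → Carrier) → ∑ l (λ x → f x - g x) ≈ ∑ l f - ∑ l g
  ∑-minus l f g = ≈.trans (∑-+ l f (λ x → - g x)) (+-congˡ (∑-neg l g))

  ∑-swap : ∀ (l : List A) (m : List B) (f : A → B → Carrier) →
           ∑ l (λ x → ∑ m (f x)) ≈ ∑ m (λ y → ∑ l (λ x → f x y))
  ∑-swap []      m f = ≈.sym (∑-zero m)
  ∑-swap (x ∷ l) m f = ≈.trans (+-congˡ (∑-swap l m f)) (≈.sym (∑-+ m (f x) _))

  ∑-map : ∀ (h : A → B) l (f : B → Carrier) → ∑ (map h l) f ≈ ∑ l (f ∘ h)
  ∑-map h []      f = ≈.refl
  ∑-map h (x ∷ l) f = +-congˡ (∑-map h l f)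

  module _ (G : Graph) where
    open Graph G

    private
      ind : V → V → Carrier
      ind = indicator G

    indicator-≡ : ∀ v → ind v v ≈ 1#
    indicator-≡ v with lem {v ≡ v}
    ... | yes _   = ≈.refl
    ... | no  v≢v = contradiction ≡.refl v≢v

    indicator-≢ : ∀ {v w} → v ≢ w → ind v w ≈ 0#
    indicator-≢ {v} {w} v≢w with lem {v ≡ w}
    ... | yes v≡w = contradiction v≡w v≢w
    ... | no  _   = ≈.refl

    indicator-sym : ∀ v w → ind v w ≈ ind w v
    indicator-sym v w with lem {v ≡ w}
    ... | yes ≡.refl = ≈.sym (indicator-≡ v)
    ... | no  v≢w    = ≈.sym (indicator-≢ (v≢w ∘ ≡.sym))

    indicator-nonneg : ∀ v w → 0# ≤ ind v w
    indicator-nonneg v w = nonneg (δ G v) w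

    ∑-indicator-∉ : ∀ {v} l (f : V → Carrier) → v ∉ l → ∑ l (λ x → ind v x * f x) ≈ 0#
    ∑-indicator-∉ l f v∉l = ≈.trans (∑-cong-∈ l term) (∑-zero l)
      where
      term : ∀ {x} → x ∈ l → ind _ x * f x ≈ 0#
      term {x} x∈l = ≈.trans (*-congʳ (indicator-≢ λ { ≡.refl → v∉l x∈l })) (zeroˡ (f x))

    ∑-indicator-∈ : ∀ {v l} (f : V → Carrier) → Unique l → v ∈ l → ∑ l (λ x → ind v x * f x) ≈ f v
    ∑-indicator-∈ {v} {x ∷ l} f (x∉l ∷ l!) (here ≡.refl) = begin
      ind v v * f v + ∑ l (λ x → ind v x * f x)
        ≈⟨ +-cong (*-congʳ (indicator-≡ v)) (∑-indicator-∉ l f (λ v∈l → All.lookup x∉l v∈l ≡.refl)) ⟩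
      1# * f v + 0#                              ≈⟨ solve 1 (λ a → con 1ℤ :* a :+ con 0ℤ := a) ≈.refl (f v) ⟩
      f v                                        ∎
    ∑-indicator-∈ {v} {x ∷ l} f (x∉l ∷ l!) (there v∈l) = begin
      ind v x * f x + ∑ l (λ x → ind v x * f x)
        ≈⟨ +-cong (*-congʳ (indicator-≢ λ { ≡.refl → All.lookup x∉l v∈l ≡.refl })) (∑-indicator-∈ f l! v∈l) ⟩
      0# * f x + f v                             ≈⟨ solve 2 (λ a b → con 0ℤ :* a :+ b := b) ≈.refl (f x) (f v) ⟩
      f v                                        ∎

    -- The multiplicity of a vertex in a list, as a field element. For a list without repetitions it
    -- is the indicator of the list; it turns sums over neighbour lists into weighted sums over one
    -- common list `E`, where the order of summation can be exchanged.
    mult : List V → V → Carrier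
    mult l x = ∑ l (λ y → ind y x)

    private
      mult≈ : ∀ l x → mult l x ≈ ∑ l (λ y → ind x y * 1#)
      mult≈ l x = ∑-cong l λ y → ≈.trans (indicator-sym y x) (≈.sym (*-identityʳ _))

    mult-nonneg : ∀ l x → 0# ≤ mult l x
    mult-nonneg l x = ∑-nonneg l (λ y → indicator-nonneg y x)

    mult-∉ : ∀ {l x} → x ∉ l → mult l x ≈ 0#
    mult-∉ {l} {x} x∉l = ≈.trans (mult≈ l x) (∑-indicator-∉ l _ x∉l)

    mult-∈ : ∀ {l x} → Unique l → x ∈ l → mult l x ≈ 1#
    mult-∈ {l} {x} l! x∈l = ≈.trans (mult≈ l x) (∑-indicator-∈ _ l! x∈l)

    mult≤1 : ∀ {l} → Unique l → ∀ x → mult l x ≤ 1#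
    mult≤1 {l} l! x with lem {x ∈ l}
    ... | yes x∈l = ≤-reflexive (mult-∈ l! x∈l)
    ... | no  x∉l = ≤-respˡ (≈.sym (mult-∉ x∉l)) 0≤1

    ∑-mult : ∀ {l E} (f : V → Carrier) → Unique E → l ⊆ E → ∑ E (λ x → mult l x * f x) ≈ ∑ l f
    ∑-mult {l} {E} f E! l⊆E = begin
      ∑ E (λ x → mult l x * f x)                ≈⟨ ∑-cong E (λ x → ∑-*ʳ l (f x) _) ⟨
      ∑ E (λ x → ∑ l (λ y → ind y x * f x))     ≈⟨ ∑-swap E l _ ⟩
      ∑ l (λ y → ∑ E (λ x → ind y x * f x))     ≈⟨ ∑-cong-∈ l (λ y∈l → ∑-indicator-∈ f E! (l⊆E y∈l)) ⟩
      ∑ l f                                     ∎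

    ∑-⊆ : ∀ {l E} (f : V → Carrier) → (∀ x → 0# ≤ f x) → Unique l → Unique E → l ⊆ E → ∑ l f ≤ ∑ E f
    ∑-⊆ {l} {E} f 0≤f l! E! l⊆E = ≤-respˡ (∑-mult f E! l⊆E)
      (∑-mono E λ x → ≤-respʳ (*-identityˡ (f x)) (*-mono (mult-nonneg l x) (0≤f x) (mult≤1 l! x) ≤-refl))

-- Toppling on a regular graph.

module RegularGraph (lem : ExcludedMiddle 0ℓ) (ℝ : CompleteOrderedField)
                    (G : Graph) (D : ℕ) (degree : ∀ v → length (Graph.𝒩 G v) ≡ suc D) where
  open CompleteOrderedField ℝ
  open OrderedField lem ℝ
  open Toppling lem ℝ
  open Sums lem ℝ
  open Graph G
  open import Relation.Binary.Reasoning.Setoid setoid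

  κ : Carrier
  κ = fromℕ (suc D) ⁻¹

  κ-inverse : fromℕ (suc D) * κ ≈ 1#
  κ-inverse = *-inverseʳ _ (0<⇒≉0 (0<fromℕ D))

  κ-nonneg : 0# ≤ κ
  κ-nonneg = ⁻¹-nonneg (0<fromℕ D)

  ind : V → V → Carrier
  ind = indicator G

  adj : V → V → Carrier
  adj v = mult G (𝒩 v)

  adj-sym : ∀ v x → adj v x ≈ adj x v
  adj-sym v x with lem {x ~ v}
  ... | yes x~v = ≈.trans (mult-∈ G (𝒩-unique v) (𝒩-complete x~v))
                    (≈.sym (mult-∈ G (𝒩-unique x) (𝒩-complete (~-sym x~v))))
  ... | no  x≁v = ≈.trans (mult-∉ G (x≁v ∘ 𝒩-sound)) (≈.sym (mult-∉ G (x≁v ∘ ~-sym ∘ 𝒩-sound)))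

  adj-irrefl : ∀ v → adj v v ≈ 0#
  adj-irrefl v = mult-∉ G (~-irrefl ∘ 𝒩-sound)

  adj-nonneg : ∀ v x → 0# ≤ adj v x
  adj-nonneg v = mult-nonneg G (𝒩 v)

  ∑-𝒩-const : ∀ v x → ∑ (𝒩 v) (λ _ → x) ≈ fromℕ (suc D) * x
  ∑-𝒩-const v x = ≈.trans (∑-const (𝒩 v) x) (*-congʳ (reflexive (≡.cong fromℕ (degree v))))

  ∑-adj≤ : ∀ {E} → Unique E → ∀ v → ∑ E (adj v) ≤ fromℕ (suc D)
  ∑-adj≤ {E} E! v = ≤-respˡ (∑-swap (𝒩 v) E (λ y x → ind y x))
    (≤-respʳ (≈.trans (∑-𝒩-const v 1#) (*-identityʳ _))
      (∑-mono (𝒩 v) λ y → ≤-respˡ (∑-cong E (λ x → indicator-sym G x y)) (mult≤1 G E! y)))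

  T≈ : ∀ v m μ w → T G v m μ w ≈ (μ w - m * ind v w) + m * κ * adj v w
  T≈ v m μ w = +-congˡ (*-congʳ (*-congˡ (reflexive (≡.cong (λ k → fromℕ k ⁻¹) (degree v)))))

  -- Duality: a move acts on a test function `g` through its discrete Laplacian at the toppled
  -- vertex. With `g` constant this is conservation of mass; with the squared Euclidean norm it
  -- makes every unit of toppled mass raise the second moment by one. The inclusions in `E` ensure
  -- that no mass leaves the range of summation.
  ∑-T : ∀ {E v} m μ (g : V → Carrier) → Unique E → v ∈ E → 𝒩 v ⊆ E →
        ∑ E (λ w → T G v m μ w * g w) ≈ ∑ E (λ w → μ w * g w) + m * (κ * ∑ (𝒩 v) g - g v)
  ∑-T {E} {v} m μ g E! v∈E 𝒩⊆E = begin
    ∑ E (λ w → T G v m μ w * g w)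
      ≈⟨ ∑-cong E (λ w → ≈.trans (*-congʳ (T≈ v m μ w))
           (solve 6 (λ μ m i k a g → ((μ :- m :* i) :+ m :* k :* a) :* g
              := (μ :* g :+ (m :* k) :* (a :* g)) :- m :* (i :* g)) ≈.refl (μ w) m (ind v w) κ (adj v w) (g w))) ⟩
    ∑ E (λ w → (μ w * g w + (m * κ) * (adj v w * g w)) - m * (ind v w * g w))
      ≈⟨ ∑-minus E _ _ ⟩
    ∑ E (λ w → μ w * g w + (m * κ) * (adj v w * g w)) - ∑ E (λ w → m * (ind v w * g w))
      ≈⟨ +-cong (≈.trans (∑-+ E _ _) (+-congˡ (∑-*ˡ E (m * κ) _))) (-‿cong (∑-*ˡ E m _)) ⟩
    (∑ E (λ w → μ w * g w) + (m * κ) * ∑ E (λ w → adj v w * g w)) - m * ∑ E (λ w → ind v w * g w)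
      ≈⟨ +-cong (+-congˡ (*-congˡ (∑-mult G g E! 𝒩⊆E))) (-‿cong (*-congˡ (∑-indicator-∈ G g E! v∈E))) ⟩
    (∑ E (λ w → μ w * g w) + (m * κ) * ∑ (𝒩 v) g) - m * g v
      ≈⟨ solve 5 (λ s m k n g → (s :+ (m :* k) :* n) :- m :* g := s :+ m :* (k :* n :- g)) ≈.refl _ m κ _ (g v) ⟩
    ∑ E (λ w → μ w * g w) + m * (κ * ∑ (𝒩 v) g - g v) ∎

-- Positive parts.

module PositivePart (lem : ExcludedMiddle 0ℓ) (ℝ : CompleteOrderedField) where
  open CompleteOrderedField ℝ
  open OrderedField lem ℝ

  infix 9 _₊
  _₊ : Carrier → Carrier
  x ₊ with total 0# x
  ... | inj₁ _ = x
  ... | inj₂ _ = 0#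

  ₊-cases : ∀ x → (0# ≤ x × x ₊ ≈ x) ⊎ (x ≤ 0# × x ₊ ≈ 0#)
  ₊-cases x with total 0# x
  ... | inj₁ 0≤x = inj₁ (0≤x , ≈.refl)
  ... | inj₂ x≤0 = inj₂ (x≤0 , ≈.refl)

  ₊-nonneg : ∀ x → 0# ≤ x ₊
  ₊-nonneg x with ₊-cases x
  ... | inj₁ (0≤x , e) = ≤-respʳ (≈.sym e) 0≤x
  ... | inj₂ (_ , e)   = ≤-reflexive (≈.sym e)

  x≤x₊ : ∀ x → x ≤ x ₊
  x≤x₊ x with ₊-cases x
  ... | inj₁ (_ , e)   = ≤-reflexive (≈.sym e)
  ... | inj₂ (x≤0 , e) = ≤-respʳ (≈.sym e) x≤0

  ₊-mono : ∀ {x y} → x ≤ y → x ₊ ≤ y ₊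
  ₊-mono {x} {y} x≤y with ₊-cases x
  ... | inj₁ (_ , e) = ≤-respˡ (≈.sym e) (≤-trans x≤y (x≤x₊ y))
  ... | inj₂ (_ , e) = ≤-respˡ (≈.sym e) (₊-nonneg y)

  ₊-cong : ∀ {x y} → x ≈ y → x ₊ ≈ y ₊
  ₊-cong x≈y = antisym (₊-mono (≤-reflexive x≈y)) (₊-mono (≤-reflexive (≈.sym x≈y)))

  ₊-zero : ∀ {x} → x ≤ 0# → x ₊ ≈ 0#
  ₊-zero {x} x≤0 with ₊-cases x
  ... | inj₁ (0≤x , e) = ≈.trans e (antisym x≤0 0≤x)
  ... | inj₂ (_ , e)   = e

-- The energy argument on a finite set of sites.

-- Membership is decided by excluded middle, since the vertices of a general graph need not have
-- decidable equality.
dedup : ExcludedMiddle 0ℓ → {A : Set} (l : List A) → ∃ λ E → Unique E × l ⊆ E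
dedup lem []      = [] , [] , λ ()
dedup lem (x ∷ l) with dedup lem l
... | E , E! , l⊆E with lem {x ∈ E}
...   | yes x∈E = E , E! , λ { (here ≡.refl) → x∈E ; (there p) → l⊆E p }
...   | no  x∉E = x ∷ E , All.¬Any⇒All¬ _ x∉E ∷ E! , λ { (here e) → here e ; (there p) → there (l⊆E p) }

module MovesLowerBound
  (lem : ExcludedMiddle 0ℓ) (ℝ : CompleteOrderedField)
  (G : Graph) (D : ℕ) (degree : ∀ v → length (Graph.𝒩 G v) ≡ suc D) where
  open CompleteOrderedField ℝ
  open OrderedField lem ℝ
  open PositivePart lem ℝ
  open Toppling lem ℝ
  open Sums lem ℝ
  open RegularGraph lem ℝ G D degree
  open Graph G

  touched : ∀ {μ μ′} → Star (Move G) μ μ′ → List V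
  touched ε           = []
  touched (move ◅ ms) = (Move.vertex move ∷ 𝒩 (Move.vertex move)) ++ touched ms

  module OnSites {E : List V} (E! : Unique E) where
    private
      ∑E : (V → Carrier) → Carrier
      ∑E = ∑ E

    Adj : (V → Carrier) → V → Carrier
    Adj f x = ∑E (λ y → adj x y * f y)

    -- The Laplacian compressed to `E`, that is, with zero boundary values. The odometer of moves at
    -- sites of `E` vanishes elsewhere, so nothing is lost by the compression.
    Δ : (V → Carrier) → V → Carrier
    Δ f x = f x - κ * Adj f x

    energy : (V → Carrier) → Carrier
    energy f = ∑E (λ x → f x * Δ f x)

    _[_≔+_] : (V → Carrier) → V → Carrier → V → Carrier
    (f [ v ≔+ m ]) x = f x + m * ind v x

    Adj-cong : ∀ {f g} x → (∀ y → f y ≈ g y) → Adj f x ≈ Adj g x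
    Adj-cong x f≈g = ∑-cong E λ y → *-congˡ (f≈g y)

    energy-cong : ∀ {f g} → (∀ x → f x ≈ g x) → energy f ≈ energy g
    energy-cong f≈g = ∑-cong E λ x →
      *-cong (f≈g x) (+-cong (f≈g x) (-‿cong (*-congˡ (Adj-cong x f≈g))))

    -- The averaging operator is a contraction: weight `2xy ≤ x² + y²` by the symmetric adjacency
    -- matrix, whose row sums over `E` are at most the degree.
    energy-nonneg : ∀ f → 0# ≤ energy f
    energy-nonneg f = ≤-respʳ (≈.sym energy≈) (≤⇒0≤- κX≤S)
      where
      open import Relation.Binary.Reasoning.Setoid setoid
      S X n : Carrier
      S = ∑E (λ x → f x * f x)
      X = ∑E (λ x → f x * Adj f x)
      n = fromℕ (suc D)
      energy≈ : energy f ≈ S - κ * X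
      energy≈ = begin
        energy f
          ≈⟨ ∑-cong E (λ x → solve 3 (λ f k a → f :* (f :- k :* a) := f :* f :- k :* (f :* a)) ≈.refl (f x) κ (Adj f x)) ⟩
        ∑E (λ x → f x * f x - κ * (f x * Adj f x))  ≈⟨ ∑-minus E _ _ ⟩
        S - ∑E (λ x → κ * (f x * Adj f x))          ≈⟨ +-congˡ (-‿cong (∑-*ˡ E κ _)) ⟩
        S - κ * X                                   ∎
      square-sum : ∑E (λ x → ∑E (λ y → adj x y * (f x * f x))) ≤ n * S
      square-sum = ≤-respʳ (∑-*ˡ E n _) (∑-mono E λ x →
        ≤-respˡ (≈.sym (∑-*ʳ E (f x * f x) (adj x)))
          (*-mono (∑-nonneg E (adj-nonneg x)) (square-nonneg (f x)) (∑-adj≤ E! x) ≤-refl))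
      square-sum′ : ∑E (λ x → ∑E (λ y → adj x y * (f y * f y))) ≤ n * S
      square-sum′ = ≤-respˡ (≈.trans (∑-swap E E _) (∑-cong E λ x → ∑-cong E λ y → *-congʳ (adj-sym y x))) square-sum
      X≈ : X ≈ ∑E (λ x → ∑E (λ y → adj x y * (f x * f y)))
      X≈ = ∑-cong E λ x → ≈.trans (≈.sym (∑-*ˡ E (f x) _)) (∑-cong E λ y →
        solve 3 (λ a b c → a :* (b :* c) := b :* (a :* c)) ≈.refl (f x) (adj x y) (f y))
      pointwise : ∀ a x y → 0# ≤ a → a * (x * y) + a * (x * y) ≤ a * (x * x) + a * (y * y)
      pointwise a x y 0≤a = ≤-by (*-nonneg 0≤a (square-nonneg (x - y)))
        (solve 3 (λ a x y → a :* (x :* x) :+ a :* (y :* y)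
           := (a :* (x :* y) :+ a :* (x :* y)) :+ a :* ((x :- y) :* (x :- y))) ≈.refl a x y)
      2X≤ : X + X ≤ n * S + n * S
      2X≤ = ≤-trans
        (≤-respˡ (≈.trans (≈.trans (∑-cong E λ x → ∑-+ E _ _) (∑-+ E _ _)) (≈.sym (+-cong X≈ X≈)))
          (≤-respʳ (≈.trans (∑-cong E λ x → ∑-+ E _ _) (∑-+ E _ _))
            (∑-mono E λ x → ∑-mono E λ y → pointwise (adj x y) (f x) (f y) (adj-nonneg x y))))
        (+-mono square-sum square-sum′)
      κX≤S : κ * X ≤ S
      κX≤S = *-cancelˡ-≤ (0<fromℕ 1) (≤-by (*-nonneg κ-nonneg (≤⇒0≤- 2X≤)) (≈.trans
        (≈.trans (solve 1 (λ s → con (+ 2) :* s := con 1ℤ :* (s :+ s)) ≈.refl S) (*-congʳ (≈.sym κ-inverse)))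
        (solve 4 (λ n k s x → (n :* k) :* (s :+ s)
           := con (+ 2) :* (k :* x) :+ k :* ((n :* s :+ n :* s) :- (x :+ x))) ≈.refl n κ S X)))

    module _ {v} (v∈E : v ∈ E) where

      Adj-≔+ : ∀ f m x → Adj (f [ v ≔+ m ]) x ≈ Adj f x + m * adj x v
      Adj-≔+ f m x = begin
        ∑E (λ y → adj x y * (f y + m * ind v y))
          ≈⟨ ∑-cong E (λ y → solve 4 (λ a f m i → a :* (f :+ m :* i) := a :* f :+ m :* (i :* a)) ≈.refl (adj x y) (f y) m (ind v y)) ⟩
        ∑E (λ y → adj x y * f y + m * (ind v y * adj x y))
          ≈⟨ ≈.trans (∑-+ E _ _) (+-congˡ (∑-*ˡ E m _)) ⟩
        Adj f x + m * ∑E (λ y → ind v y * adj x y)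
          ≈⟨ +-congˡ (*-congˡ (∑-indicator-∈ G (adj x) E! v∈E)) ⟩
        Adj f x + m * adj x v ∎
        where open import Relation.Binary.Reasoning.Setoid setoid

      ∑-≔+ : ∀ f m → ∑E (f [ v ≔+ m ]) ≈ ∑E f + m
      ∑-≔+ f m = ≈.trans (∑-+ E _ _) (+-congˡ (≈.trans (∑-*ˡ E m _)
        (≈.trans (*-congˡ (≈.trans (∑-cong E λ x → ≈.sym (*-identityʳ _)) (∑-indicator-∈ G (λ _ → 1#) E! v∈E))) (*-identityʳ m))))

      -- A symmetric quadratic form expanded along the unit vector at `v`. The coefficient of
      -- `m * m` is the diagonal entry of `Δ`, which is one because the graph has no loops.
      energy-≔+ : ∀ f m → energy (f [ v ≔+ m ]) ≈ energy f + ((m * Δ f v + m * Δ f v) + m * m)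
      energy-≔+ f m = begin
        ∑E (λ x → (f x + m * ind v x) * ((f x + m * ind v x) - κ * Adj (f [ v ≔+ m ]) x))
          ≈⟨ ∑-cong E (λ x → *-congˡ (+-congˡ (-‿cong (*-congˡ (≈.trans (Adj-≔+ f m x) (+-congˡ (*-congˡ (adj-sym x v)))))))) ⟩
        ∑E (λ x → (f x + m * ind v x) * ((f x + m * ind v x) - κ * (Adj f x + m * adj v x)))
          ≈⟨ ∑-cong E (λ x → solve 6 (λ f m i k A a → (f :+ m :* i) :* ((f :+ m :* i) :- k :* (A :+ m :* a))
               := (f :* (f :- k :* A) :+ m :* (i :* ((f :- k :* A) :+ (f :+ m :* i :- (m :* k) :* a)))) :- (m :* k) :* (a :* f))
               ≈.refl (f x) m (ind v x) κ (Adj f x) (adj v x)) ⟩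
        ∑E (λ x → (f x * Δ f x + m * (ind v x * h x)) - (m * κ) * (adj v x * f x))
          ≈⟨ ≈.trans (∑-minus E _ _) (+-cong (≈.trans (∑-+ E _ _) (+-congˡ (∑-*ˡ E m _))) (-‿cong (∑-*ˡ E (m * κ) _))) ⟩
        (energy f + m * ∑E (λ x → ind v x * h x)) - (m * κ) * Adj f v
          ≈⟨ +-congʳ (+-congˡ (*-congˡ (≈.trans (∑-indicator-∈ G h E! v∈E)
               (+-congˡ (+-cong (+-congˡ (*-congˡ (indicator-≡ G v))) (-‿cong (*-congˡ (adj-irrefl v)))))))) ⟩
        (energy f + m * (Δ f v + ((f v + m * 1#) - (m * κ) * 0#))) - (m * κ) * Adj f v
          ≈⟨ solve 5 (λ e m f k A → (e :+ m :* ((f :- k :* A) :+ ((f :+ m :* con 1ℤ) :- (m :* k) :* con 0ℤ))) :- (m :* k) :* A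
               := e :+ ((m :* (f :- k :* A) :+ m :* (f :- k :* A)) :+ m :* m)) ≈.refl (energy f) m (f v) κ (Adj f v) ⟩
        energy f + ((m * Δ f v + m * Δ f v) + m * m) ∎
        where
        open import Relation.Binary.Reasoning.Setoid setoid
        h : V → Carrier
        h x = Δ f x + (f x + m * ind v x - (m * κ) * adj v x)

    module Relative (o : V) (w : V → Carrier) (λ₀ : Carrier) (0≤λ₀ : 0# ≤ λ₀)
                    -- The Laplacian of `w` is taken over full neighbour lists: unlike the odometer,
                    -- `w` need not be supported in `E`.
                    (supersolution : ∀ v → ind o v ≤ (w v - κ * ∑ (𝒩 v) w) + λ₀)
                    (g : V → Carrier) (κ∑g : ∀ v → κ * ∑ (𝒩 v) g ≈ g v + 1#) where

      excess : (V → Carrier) → V → Carrier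
      excess u x = (u x - w x) ₊

      -- `u` is the odometer and `t` counts the moves, each with an energy budget of `(λ₀ + λ₀)²`
      -- whatever its amount. The moment equals the initial value `g o` plus the total odometer
      -- because averaging raises `g` by exactly one.
      record Invariant (μ : V → Carrier) (t : ℕ) : Set where
        field
          u        : V → Carrier
          moment≈  : ∑E (λ x → μ x * g x) ≈ g o + ∑E u
          mass≈    : ∀ x → μ x ≈ ind o x - Δ u x
          energy≤  : energy (excess u) + (λ₀ + λ₀) * ∑E (excess u) ≤ fromℕ t * ((λ₀ + λ₀) * (λ₀ + λ₀))

      module Step {v m} (v∈E : v ∈ E) (𝒩⊆E : 𝒩 v ⊆ E) (0≤m : 0# ≤ m) (u : V → Carrier) where

        u′ : V → Carrier
        u′ = u [ v ≔+ m ]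

        gain : Carrier
        gain = excess u′ v - excess u v

        u≤u′ : ∀ x → u x ≤ u′ x
        u≤u′ x = ≤-by (*-nonneg 0≤m (indicator-nonneg G v x)) ≈.refl

        excess-u′ : ∀ x → excess u′ x ≈ (excess u [ v ≔+ gain ]) x
        excess-u′ x with em {v ≡ x}
        ... | inj₁ ≡.refl = ≈.trans
          (solve 2 (λ a b → a := b :+ (a :- b) :* con 1ℤ) ≈.refl (excess u′ v) (excess u v))
          (+-congˡ (*-congˡ (≈.sym (indicator-≡ G v))))
        ... | inj₂ v≢x = ≈.trans
          (₊-cong (+-congʳ (≈.trans (+-congˡ (*-congˡ (indicator-≢ G v≢x)))
            (solve 2 (λ u m → u :+ m :* con 0ℤ := u) ≈.refl (u x) m))))
          (≈.trans (solve 2 (λ e g → e := e :+ g :* con 0ℤ) ≈.refl (excess u x) gain)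
            (+-congˡ (*-congˡ (≈.sym (indicator-≢ G v≢x)))))

        gain-nonneg : 0# ≤ gain
        gain-nonneg = ≤⇒0≤- (₊-mono (+-mono (u≤u′ v) ≤-refl))

        mass-u′ : ∀ {μ} → (∀ x → μ x ≈ ind o x - Δ u x) → ∀ x → T G v m μ x ≈ ind o x - Δ u′ x
        mass-u′ {μ} mass≈ x = begin
          T G v m μ x
            ≈⟨ T≈ v m μ x ⟩
          (μ x - m * ind v x) + m * κ * adj v x
            ≈⟨ +-cong (+-congʳ (mass≈ x)) (*-congˡ (adj-sym v x)) ⟩
          ((ind o x - (u x - κ * Adj u x)) - m * ind v x) + m * κ * adj x v
            ≈⟨ solve 7 (λ d u k A m i a → ((d :- (u :- k :* A)) :- m :* i) :+ m :* k :* a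
                 := d :- ((u :+ m :* i) :- k :* (A :+ m :* a))) ≈.refl (ind o x) (u x) κ (Adj u x) m (ind v x) (adj x v) ⟩
          ind o x - ((u x + m * ind v x) - κ * (Adj u x + m * adj x v))
            ≈⟨ +-congˡ (-‿cong (+-congˡ (-‿cong (*-congˡ (≈.sym (Adj-≔+ v∈E u m x)))))) ⟩
          ind o x - Δ u′ x ∎
          where open import Relation.Binary.Reasoning.Setoid setoid

        -- Where the odometer u overtakes w, the mass that the excess process leaves behind
        -- dominates the true mass, which is nonnegative.
        gain≤ : 0# ≤ ind o v - Δ u′ v → gain * (gain + Δ (excess u) v) ≤ gain * λ₀
        gain≤ 0≤μ′ with ₊-cases (u′ v - w v)
        ... | inj₂ (below , excess≈0) = ≤-reflexive (≈.trans (*-congʳ gain≈0)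
            (≈.trans (zeroˡ _) (≈.sym (≈.trans (*-congʳ gain≈0) (zeroˡ _)))))
          where
          gain≈0 : gain ≈ 0#
          gain≈0 = ≈.trans (+-cong excess≈0 (-‿cong (₊-zero (≤-trans (+-mono (u≤u′ v) ≤-refl) below))))
                     (solve 0 (con 0ℤ :- con 0ℤ := con 0ℤ) ≈.refl)
        ... | inj₁ (_ , excess≈) = *-monoˡ gain-nonneg (≤-by
            -- Three slacks add up to the claim: the new mass at `v` is nonnegative, `w` is a
            -- supersolution up to `λ₀`, and replacing `u - w` by its positive part only raises the
            -- neighbour sum. The case at hand makes `excess u′ v` equal to `u′ v - w v`.
            (+-nonneg (+-nonneg 0≤μ′ (≤⇒0≤- (supersolution v))) (*-nonneg κ-nonneg (≤⇒0≤- Adj≤)))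
            (≈.trans (solve 9 (λ l d u′ k Au′ w Nw AU U →
               l := ((u′ :- w) :- U) :+ (U :- k :* AU) :+
                    (((d :- (u′ :- k :* Au′)) :+ (((w :- k :* Nw) :+ l) :- d)) :+ k :* (AU :- (Au′ :- Nw))))
               ≈.refl λ₀ (ind o v) (u′ v) κ (Adj u′ v) (w v) (∑ (𝒩 v) w) (Adj (excess u) v) (excess u v))
             (+-congʳ (+-congʳ (+-congʳ (≈.sym excess≈))))))
          where
          open import Relation.Binary.Reasoning.Setoid setoid
          -- Without loops, raising `u` at `v` leaves its neighbour sum at `v` unchanged, so the new
          -- odometer can be replaced by the old one here.
          Adj≈ : Adj u′ v - ∑ (𝒩 v) w ≈ ∑E (λ y → adj v y * (u y - w y))
          Adj≈ = begin
            Adj u′ v - ∑ (𝒩 v) w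
              ≈⟨ +-cong (≈.trans (Adj-≔+ v∈E u m v) (+-congˡ (*-congˡ (adj-irrefl v)))) (-‿cong (≈.sym (∑-mult G w E! 𝒩⊆E))) ⟩
            (Adj u v + m * 0#) - ∑E (λ y → adj v y * w y)
              ≈⟨ +-congʳ (solve 2 (λ a m → a :+ m :* con 0ℤ := a) ≈.refl (Adj u v) m) ⟩
            Adj u v - ∑E (λ y → adj v y * w y)
              ≈⟨ ∑-minus E _ _ ⟨
            ∑E (λ y → adj v y * u y - adj v y * w y)
              ≈⟨ ∑-cong E (λ y → solve 3 (λ a u w → a :* u :- a :* w := a :* (u :- w)) ≈.refl (adj v y) (u y) (w y)) ⟩
            ∑E (λ y → adj v y * (u y - w y)) ∎
          Adj≤ : Adj u′ v - ∑ (𝒩 v) w ≤ Adj (excess u) v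
          Adj≤ = ≤-respˡ (≈.sym Adj≈) (∑-mono E λ y → *-monoˡ (adj-nonneg v y) (x≤x₊ (u y - w y)))

        invariant : ∀ {t} → 0# ≤ ind o v - Δ u′ v →
          energy (excess u) + (λ₀ + λ₀) * ∑E (excess u) ≤ fromℕ t * ((λ₀ + λ₀) * (λ₀ + λ₀)) →
          energy (excess u′) + (λ₀ + λ₀) * ∑E (excess u′) ≤ fromℕ (suc t) * ((λ₀ + λ₀) * (λ₀ + λ₀))
        invariant {t} 0≤μ′ h = ≤-respˡ (≈.sym (+-cong (≈.trans (energy-cong excess-u′) (energy-≔+ v∈E (excess u) gain))
                                    (*-congˡ (≈.trans (∑-cong E excess-u′) (∑-≔+ v∈E (excess u) gain)))))
          -- `gain≤` enters twice, once for each cross term of the energy; what remains is the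
          -- completed square of `gain - (λ₀ + λ₀)`.
          (≤-by (+-nonneg (≤⇒0≤- h) (+-nonneg (+-nonneg (≤⇒0≤- (gain≤ 0≤μ′)) (≤⇒0≤- (gain≤ 0≤μ′))) (square-nonneg (gain - (λ₀ + λ₀)))))
            (solve 6 (λ e S g dU l t →
              (con 1ℤ :+ t) :* ((l :+ l) :* (l :+ l))
              := (e :+ ((g :* dU :+ g :* dU) :+ g :* g) :+ (l :+ l) :* (S :+ g))
                 :+ ((t :* ((l :+ l) :* (l :+ l)) :- (e :+ (l :+ l) :* S))
                 :+ (((g :* l :- g :* (g :+ dU)) :+ (g :* l :- g :* (g :+ dU))) :+ (g :- (l :+ l)) :* (g :- (l :+ l)))))
              ≈.refl (energy (excess u)) (∑E (excess u)) gain (Δ (excess u) v) λ₀ (fromℕ t)))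

      step : ∀ {μ μ′ t} (move : Move G μ μ′) → Move.vertex move ∈ E → 𝒩 (Move.vertex move) ⊆ E →
             Invariant (mass μ) t → Invariant (mass μ′) (suc t)
      step {μ} {μ′} {t} move v∈E 𝒩⊆E inv = record
        { u       = u′
        ; moment≈ = begin
            ∑E (λ x → mass μ′ x * g x)                         ≈⟨ ∑-cong E (λ x → *-congʳ (result x)) ⟩
            ∑E (λ x → T G v m (mass μ) x * g x)                ≈⟨ ∑-T m (mass μ) g E! v∈E 𝒩⊆E ⟩
            ∑E (λ x → mass μ x * g x) + m * (κ * ∑ (𝒩 v) g - g v)  ≈⟨ +-cong moment≈ (*-congˡ (+-congʳ (κ∑g v))) ⟩
            (g o + ∑E u) + m * ((g v + 1#) - g v)
              ≈⟨ solve 4 (λ a s m g → (a :+ s) :+ m :* ((g :+ con 1ℤ) :- g) := a :+ (s :+ m)) ≈.refl (g o) (∑E u) m (g v) ⟩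
            g o + (∑E u + m)                                   ≈⟨ +-congˡ (≈.sym (∑-≔+ v∈E u m)) ⟩
            g o + ∑E u′                                        ∎
        ; mass≈   = mass′≈
        ; energy≤ = invariant {t} (≤-respʳ (mass′≈ v) (nonneg μ′ v)) energy≤
        }
        where
        open import Relation.Binary.Reasoning.Setoid setoid
        open Invariant inv
        open Move move renaming (vertex to v; amount to m)
        open Step v∈E 𝒩⊆E (proj₁ 0<amount) u
        mass′≈ : ∀ x → mass μ′ x ≈ ind o x - Δ u′ x
        mass′≈ x = ≈.trans (result x) (mass-u′ mass≈ x)

      run : ∀ {μ μ′ t} (ms : Star (Move G) μ μ′) → touched ms ⊆ E →
            Invariant (mass μ) t → Invariant (mass μ′) (steps ms ℕ.+ t)
      run         ε        _    inv = inv
      run {μ′ = μ′} {t} (move ◅ ms) ms⊆E inv =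
        ≡.subst (Invariant (mass μ′)) (ℕ.+-suc (steps ms) t)
          (run ms (ms⊆E ∘ ∈-++⁺ʳ _)
            (step move (ms⊆E (here ≡.refl)) (ms⊆E ∘ ∈-++⁺ˡ {xs = _ ∷ _} ∘ there) inv))

      module _ (w-nonneg : ∀ x → 0# ≤ w x) where

        initial : o ∈ E → Invariant (mass (δ G o)) 0
        initial o∈E = record
          { u       = λ _ → 0#
          ; moment≈ = ≈.trans (∑-indicator-∈ G g E! o∈E)
              (≈.trans (≈.sym (+-identityʳ (g o))) (+-congˡ (≈.sym (∑-zero E))))
          ; mass≈   = λ x → ≈.trans
              (solve 2 (λ i k → i := i :- (con 0ℤ :- k :* con 0ℤ)) ≈.refl (ind o x) κ)
              (+-congˡ (-‿cong (+-congˡ (-‿cong (*-congˡ (≈.sym (Adj-0 x)))))))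
          ; energy≤ = ≤-reflexive (begin
              energy (excess (λ _ → 0#)) + (λ₀ + λ₀) * ∑E (excess (λ _ → 0#))
                ≈⟨ +-cong (∑-cong E λ x → *-congʳ (excess≈0 x)) (*-congˡ (≈.trans (∑-cong E excess≈0) (∑-zero E))) ⟩
              ∑E (λ x → 0# * Δ (excess (λ _ → 0#)) x) + (λ₀ + λ₀) * 0#
                ≈⟨ +-congʳ (≈.trans (∑-cong E λ x → zeroˡ _) (∑-zero E)) ⟩
              0# + (λ₀ + λ₀) * 0#
                ≈⟨ solve 1 (λ l → con 0ℤ :+ (l :+ l) :* con 0ℤ := con 0ℤ :* ((l :+ l) :* (l :+ l))) ≈.refl λ₀ ⟩
              0# * ((λ₀ + λ₀) * (λ₀ + λ₀)) ∎)
          }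
          where
          open import Relation.Binary.Reasoning.Setoid setoid
          Adj-0 : ∀ x → Adj (λ _ → 0#) x ≈ 0#
          Adj-0 x = ≈.trans (∑-cong E λ y → zeroʳ (adj x y)) (∑-zero E)
          excess≈0 : ∀ x → excess (λ _ → 0#) x ≈ 0#
          excess≈0 x = ₊-zero (≤-by (w-nonneg x) (solve 1 (λ w → con 0ℤ := (con 0ℤ :- w) :+ w) ≈.refl (w x)))

        -- The total odometer is at most `∑ w` plus the total excess. For the latter, drop the
        -- nonnegative energy from the invariant and cancel one factor `λ₀ + λ₀`.
        moment-bound : ∀ {μ} (ms : Star (Move G) (δ G o) μ) → touched ms ⊆ E → o ∈ E → 0# < λ₀ →
                       ∑E (λ x → mass μ x * g x) ≤ g o + (∑E w + (λ₀ + λ₀) * fromℕ (steps ms))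
        moment-bound ms ms⊆E o∈E 0<λ₀ = ≤-respˡ (≈.sym moment≈) (+-monoʳ-≤ (g o) (≤-by
            (+-nonneg (≤⇒0≤- ∑u-w≤) (≤⇒0≤- ∑excess≤))
            (solve 4 (λ W l U u → W :+ l := u :+ ((U :- (u :- W)) :+ (l :- U))) ≈.refl
              (∑E w) ((λ₀ + λ₀) * fromℕ (steps ms)) (∑E (excess u)) (∑E u))))
          where
          open Invariant (run ms ms⊆E (initial o∈E))
          ∑u-w≤ : ∑E u - ∑E w ≤ ∑E (excess u)
          ∑u-w≤ = ≤-respˡ (∑-minus E u w) (∑-mono E λ x → x≤x₊ (u x - w x))
          0<2λ₀ : 0# < λ₀ + λ₀
          0<2λ₀ = <-≤-trans 0<λ₀ (≤-by (proj₁ 0<λ₀) ≈.refl)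
          ∑excess≤ : ∑E (excess u) ≤ (λ₀ + λ₀) * fromℕ (steps ms)
          ∑excess≤ = *-cancelˡ-≤ 0<2λ₀ (≤-by (+-nonneg (≤⇒0≤- energy≤) (energy-nonneg (excess u)))
            (≈.trans (solve 4 (λ l U k e → (l :+ l) :* ((l :+ l) :* k)
                := (l :+ l) :* U :+ ((k :* ((l :+ l) :* (l :+ l)) :- (e :+ (l :+ l) :* U)) :+ e))
              ≈.refl λ₀ (∑E (excess u)) (fromℕ (steps ms)) (energy (excess u)))
              (+-congˡ (+-congʳ (+-congʳ (*-congʳ (reflexive (≡.cong fromℕ (≡.sym (ℕ.+-identityʳ (steps ms)))))))))))

-- Walks on the line and binomial coefficients.

module Walks where
  open ℤS.+-*-Solver using (solve; _:=_; _:+_; _:*_; _:-_; :-_; con)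
  open ℕS.+-*-Solver using () renaming
    (solve to solveℕ; con to conℕ; _:=_ to infix 4 _≐_; _:+_ to infixl 7 _⊕_; _:*_ to infixl 8 _⊗_)

  -- The number of simple walks of given length from `a` to 0: the binomial coefficient
  -- `j C ((j + a) / 2)`, or zero when the parities differ. Indexing by position instead of by
  -- binomial index gives the recursion over neighbours that the Green function needs.
  walks : ℕ → ℤ → ℕ
  walks zero    (+ zero)  = 1
  walks zero    (+ suc _) = 0
  walks zero    -[1+ _ ]  = 0
  walks (suc j) a         = walks j (1ℤ ℤ.+ a) ℕ.+ walks j (-1ℤ ℤ.+ a)

  private
    W : ℕ → ℤ → ℤ
    W j a = + walks j a

    W-suc : ∀ j a → W (suc j) a ≡ W j (1ℤ ℤ.+ a) ℤ.+ W j (-1ℤ ℤ.+ a)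
    W-suc j a = ℤ.pos-+ (walks j (1ℤ ℤ.+ a)) (walks j (-1ℤ ℤ.+ a))

    biased : ℕ → ℤ → ℤ
    biased zero    a = 0ℤ
    biased (suc j) a = + suc j ℤ.* (W j (-1ℤ ℤ.+ a) ℤ.- W j (1ℤ ℤ.+ a))

    biased-suc : ∀ j a → biased j (1ℤ ℤ.+ a) ℤ.+ biased j (-1ℤ ℤ.+ a) ≡ + j ℤ.* (W j (-1ℤ ℤ.+ a) ℤ.- W j (1ℤ ℤ.+ a))
    biased-suc zero    a = ≡.sym (ℤ.*-zeroˡ (W zero (-1ℤ ℤ.+ a) ℤ.- W zero (1ℤ ℤ.+ a)))
    biased-suc (suc j) a = ≡.trans
      (≡.cong (λ z → + suc j ℤ.* (z ℤ.- W j (1ℤ ℤ.+ (1ℤ ℤ.+ a))) ℤ.+ biased (suc j) (-1ℤ ℤ.+ a))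
        (≡.cong (W j) (solve 1 (λ a → con -1ℤ :+ (con 1ℤ :+ a) := con 1ℤ :+ (con -1ℤ :+ a)) ≡.refl a)))
      (≡.trans
        (solve 4 (λ k x y z → k :* (x :- y) :+ k :* (z :- x) := k :* ((x :+ z) :- (y :+ x))) ≡.refl
          (+ suc j) (W j (1ℤ ℤ.+ (-1ℤ ℤ.+ a))) (W j (1ℤ ℤ.+ (1ℤ ℤ.+ a))) (W j (-1ℤ ℤ.+ (-1ℤ ℤ.+ a))))
        (≡.cong₂ (λ p q → + suc j ℤ.* (p ℤ.- q))
          (≡.sym (W-suc j (-1ℤ ℤ.+ a)))
          (≡.trans (≡.cong (λ z → W j (1ℤ ℤ.+ (1ℤ ℤ.+ a)) ℤ.+ z)
            (≡.cong (W j) (solve 1 (λ a → con 1ℤ :+ (con -1ℤ :+ a) := con -1ℤ :+ (con 1ℤ :+ a)) ≡.refl a)))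
            (≡.sym (W-suc j (1ℤ ℤ.+ a))))))

    -- Every one of the j steps contributes equally to the endpoint a.
    size-bias : ∀ j a → a ℤ.* W j a ≡ biased j a
    size-bias zero    (+ zero)  = ≡.refl
    size-bias zero    (+ suc n) = ℤ.*-zeroʳ (+ suc n)
    size-bias zero    -[1+ n ]  = ℤ.*-zeroʳ -[1+ n ]
    size-bias (suc j) a = begin
      a ℤ.* W (suc j) a
        ≡⟨ ≡.cong (a ℤ.*_) (W-suc j a) ⟩
      a ℤ.* (x ℤ.+ y)
        ≡⟨ solve 3 (λ a x y → a :* (x :+ y) := ((con 1ℤ :+ a) :* x :+ (con -1ℤ :+ a) :* y) :+ (y :- x)) ≡.refl a x y ⟩
      ((1ℤ ℤ.+ a) ℤ.* x ℤ.+ (-1ℤ ℤ.+ a) ℤ.* y) ℤ.+ (y ℤ.- x)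
        ≡⟨ ≡.cong (ℤ._+ (y ℤ.- x)) (≡.trans (≡.cong₂ ℤ._+_ (size-bias j (1ℤ ℤ.+ a)) (size-bias j (-1ℤ ℤ.+ a))) (biased-suc j a)) ⟩
      + j ℤ.* (y ℤ.- x) ℤ.+ (y ℤ.- x)
        ≡⟨ solve 2 (λ j z → j :* z :+ z := (con 1ℤ :+ j) :* z) ≡.refl (+ j) (y ℤ.- x) ⟩
      (1ℤ ℤ.+ + j) ℤ.* (y ℤ.- x) ∎
      where
      open ≡-Reasoning
      x y : ℤ
      x = W j (1ℤ ℤ.+ a)
      y = W j (-1ℤ ℤ.+ a)

    -- The absorption identity `k (n C k) = n ((n - 1) C (k - 1))` in walk coordinates: adding the
    -- size-bias identity to the defining recursion isolates one of the two predecessors, and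
    -- subtracting it isolates the other.
    last-step⁺ : ∀ j a → (+ suc j ℤ.+ a) ℤ.* W (suc j) a ≡ + suc j ℤ.* (W j (-1ℤ ℤ.+ a) ℤ.+ W j (-1ℤ ℤ.+ a))
    last-step⁺ j a = begin
      (+ suc j ℤ.+ a) ℤ.* W (suc j) a              ≡⟨ ℤ.*-distribʳ-+ (W (suc j) a) (+ suc j) a ⟩
      + suc j ℤ.* W (suc j) a ℤ.+ a ℤ.* W (suc j) a  ≡⟨ ≡.cong₂ (λ p q → + suc j ℤ.* p ℤ.+ q) (W-suc j a) (size-bias (suc j) a) ⟩
      + suc j ℤ.* (x ℤ.+ y) ℤ.+ + suc j ℤ.* (y ℤ.- x) ≡⟨ solve 3 (λ k x y → k :* (x :+ y) :+ k :* (y :- x) := k :* (y :+ y)) ≡.refl (+ suc j) x y ⟩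
      + suc j ℤ.* (y ℤ.+ y) ∎
      where
      open ≡-Reasoning
      x y : ℤ
      x = W j (1ℤ ℤ.+ a)
      y = W j (-1ℤ ℤ.+ a)

    last-step⁻ : ∀ j a → (+ suc j ℤ.- a) ℤ.* W (suc j) a ≡ + suc j ℤ.* (W j (1ℤ ℤ.+ a) ℤ.+ W j (1ℤ ℤ.+ a))
    last-step⁻ j a = begin
      (+ suc j ℤ.- a) ℤ.* W (suc j) a
        ≡⟨ solve 3 (λ k a w → (k :- a) :* w := k :* w :- a :* w) ≡.refl (+ suc j) a (W (suc j) a) ⟩
      + suc j ℤ.* W (suc j) a ℤ.- a ℤ.* W (suc j) a  ≡⟨ ≡.cong₂ (λ p q → + suc j ℤ.* p ℤ.- q) (W-suc j a) (size-bias (suc j) a) ⟩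
      + suc j ℤ.* (x ℤ.+ y) ℤ.- + suc j ℤ.* (y ℤ.- x) ≡⟨ solve 3 (λ k x y → k :* (x :+ y) :- k :* (y :- x) := k :* (x :+ x)) ≡.refl (+ suc j) x y ⟩
      + suc j ℤ.* (x ℤ.+ x) ∎
      where
      open ≡-Reasoning
      x y : ℤ
      x = W j (1ℤ ℤ.+ a)
      y = W j (-1ℤ ℤ.+ a)

    -- Both `last-step⁺` at `2 + n` and `last-step⁻` at `n` lead to the site `1 + n`, which is
    -- thereby eliminated. The term with factor `n` stands on the left to avoid truncated
    -- subtraction.
    ratio : ∀ j n → (suc j ℕ.+ (2 ℕ.+ n)) ℕ.* walks (suc j) (+ (2 ℕ.+ n)) ℕ.+ n ℕ.* walks (suc j) (+ n) ≡ suc j ℕ.* walks (suc j) (+ n)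
    ratio j n = ℤ.+-injective (begin
      + ((suc j ℕ.+ (2 ℕ.+ n)) ℕ.* x ℕ.+ n ℕ.* y)
        ≡⟨ ≡.trans (ℤ.pos-+ ((suc j ℕ.+ (2 ℕ.+ n)) ℕ.* x) (n ℕ.* y)) (≡.cong₂ ℤ._+_ (ℤ.pos-* (suc j ℕ.+ (2 ℕ.+ n)) x) (ℤ.pos-* n y)) ⟩
      (+ suc j ℤ.+ + (2 ℕ.+ n)) ℤ.* + x ℤ.+ + n ℤ.* + y
        ≡⟨ ≡.cong (ℤ._+ + n ℤ.* + y) (≡.trans (last-step⁺ j (+ (2 ℕ.+ n))) (≡.sym (last-step⁻ j (+ n)))) ⟩
      (+ suc j ℤ.- + n) ℤ.* + y ℤ.+ + n ℤ.* + y
        ≡⟨ solve 3 (λ k n y → (k :- n) :* y :+ n :* y := k :* y) ≡.refl (+ suc j) (+ n) (+ y) ⟩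
      + suc j ℤ.* + y
        ≡⟨ ℤ.pos-* (suc j) y ⟨
      + (suc j ℕ.* y) ∎)
      where
      open ≡-Reasoning
      x y : ℕ
      x = walks (suc j) (+ (2 ℕ.+ n))
      y = walks (suc j) (+ n)

    walks-decreasing : ∀ j n → walks j (+ (2 ℕ.+ n)) ℕ.≤ walks j (+ n)
    walks-decreasing zero    n = z≤n
    walks-decreasing (suc j) n = ℕ.*-cancelˡ-≤ (suc j ℕ.+ (2 ℕ.+ n)) (begin
      (suc j ℕ.+ (2 ℕ.+ n)) ℕ.* x                  ≤⟨ ℕ.m≤m+n _ (n ℕ.* y) ⟩
      (suc j ℕ.+ (2 ℕ.+ n)) ℕ.* x ℕ.+ n ℕ.* y      ≡⟨ ratio j n ⟩
      suc j ℕ.* y                                  ≤⟨ ℕ.*-monoˡ-≤ y (ℕ.m≤m+n (suc j) (2 ℕ.+ n)) ⟩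
      (suc j ℕ.+ (2 ℕ.+ n)) ℕ.* y                  ∎)
      where
      open ℕ.≤-Reasoning
      x y : ℕ
      x = walks (suc j) (+ (2 ℕ.+ n))
      y = walks (suc j) (+ n)

    -- Monotonicity holds only along steps of two, within one parity class, hence two candidates for
    -- the maximum.
    walks-central : ∀ j n → walks j (+ n) ℕ.≤ walks j 0ℤ ⊎ walks j (+ n) ℕ.≤ walks j 1ℤ
    walks-central j 0 = inj₁ ℕ.≤-refl
    walks-central j 1 = inj₂ ℕ.≤-refl
    walks-central j (suc (suc n)) with walks-central j n
    ... | inj₁ h = inj₁ (ℕ.≤-trans (walks-decreasing j n) h)
    ... | inj₂ h = inj₂ (ℕ.≤-trans (walks-decreasing j n) h)

  walks-neg : ∀ j a → walks j (ℤ.- a) ≡ walks j a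
  walks-neg zero    (+ zero)  = ≡.refl
  walks-neg zero    (+ suc n) = ≡.refl
  walks-neg zero    -[1+ n ]  = ≡.refl
  walks-neg (suc j) a         = ≡.trans
    (≡.cong₂ ℕ._+_
      (≡.trans (≡.cong (walks j) (solve 1 (λ a → con 1ℤ :+ (:- a) := :- (con -1ℤ :+ a)) ≡.refl a)) (walks-neg j (-1ℤ ℤ.+ a)))
      (≡.trans (≡.cong (walks j) (solve 1 (λ a → con -1ℤ :+ (:- a) := :- (con 1ℤ :+ a)) ≡.refl a)) (walks-neg j (1ℤ ℤ.+ a))))
    (ℕ.+-comm (walks j (-1ℤ ℤ.+ a)) (walks j (1ℤ ℤ.+ a)))

  private
    walks-0 : ∀ j → walks (suc j) 0ℤ ≡ 2 ℕ.* walks j 1ℤ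
    walks-0 j = ≡.cong (walks j 1ℤ ℕ.+_) (≡.trans (walks-neg j 1ℤ) (≡.sym (ℕ.+-identityʳ _)))

    walks-1 : ∀ j → suc (suc j) ℕ.* walks (suc j) 1ℤ ≡ suc j ℕ.* (2 ℕ.* walks j 0ℤ)
    walks-1 j = ℤ.+-injective (begin
      + (suc (suc j) ℕ.* walks (suc j) 1ℤ)            ≡⟨ ≡.cong (λ k → + (k ℕ.* walks (suc j) 1ℤ)) (ℕ.+-comm 1 (suc j)) ⟩
      + ((suc j ℕ.+ 1) ℕ.* walks (suc j) 1ℤ)          ≡⟨ ℤ.pos-* (suc j ℕ.+ 1) _ ⟩
      (+ suc j ℤ.+ 1ℤ) ℤ.* W (suc j) 1ℤ               ≡⟨ last-step⁺ j 1ℤ ⟩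
      + suc j ℤ.* (W j 0ℤ ℤ.+ W j 0ℤ)                 ≡⟨ ≡.cong (+ suc j ℤ.*_) (≡.trans (≡.sym (ℤ.pos-+ w w)) (≡.cong (λ z → + (w ℕ.+ z)) (≡.sym (ℕ.+-identityʳ w)))) ⟩
      + suc j ℤ.* + (2 ℕ.* walks j 0ℤ)                ≡⟨ ℤ.pos-* (suc j) _ ⟨
      + (suc j ℕ.* (2 ℕ.* walks j 0ℤ))                ∎)
      where
      open ≡-Reasoning
      w : ℕ
      w = walks j 0ℤ

    walks-0-step : ∀ j → suc (suc j) ℕ.* walks (suc (suc j)) 0ℤ ≡ 4 ℕ.* (suc j ℕ.* walks j 0ℤ)
    walks-0-step j = begin
      suc (suc j) ℕ.* walks (suc (suc j)) 0ℤ         ≡⟨ ≡.cong (suc (suc j) ℕ.*_) (walks-0 (suc j)) ⟩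
      suc (suc j) ℕ.* (2 ℕ.* walks (suc j) 1ℤ)       ≡⟨ solveℕ 2 (λ k w → k ⊗ (conℕ 2 ⊗ w) ≐ conℕ 2 ⊗ (k ⊗ w)) ≡.refl (suc (suc j)) (walks (suc j) 1ℤ) ⟩
      2 ℕ.* (suc (suc j) ℕ.* walks (suc j) 1ℤ)       ≡⟨ ≡.cong (2 ℕ.*_) (walks-1 j) ⟩
      2 ℕ.* (suc j ℕ.* (2 ℕ.* walks j 0ℤ))           ≡⟨ solveℕ 2 (λ k w → conℕ 2 ⊗ (k ⊗ (conℕ 2 ⊗ w)) ≐ conℕ 4 ⊗ (k ⊗ w)) ≡.refl (suc j) (walks j 0ℤ) ⟩
      4 ℕ.* (suc j ℕ.* walks j 0ℤ)                   ∎
      where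
      open ≡-Reasoning

    -- Induction in steps of two, as odd central counts vanish. With the factor `suc j` the
    -- recursion closes: the squares grow by `16 (j + 1)² / (j + 2)²`, and
    -- `(j + 1)(j + 3) ≤ (j + 2)²`.
    walks-0-bound : ∀ j → (walks j 0ℤ ℕ.* walks j 0ℤ) ℕ.* suc j ℕ.≤ 4 ℕ.^ j
    walks-0-bound 0 = ℕ.≤-refl
    walks-0-bound 1 = z≤n
    walks-0-bound (suc (suc j)) = ℕ.*-cancelˡ-≤ (k ℕ.* k) (begin
      k ℕ.* k ℕ.* ((x ℕ.* x) ℕ.* suc k)                 ≡⟨ solveℕ 3 (λ k x m → k ⊗ k ⊗ ((x ⊗ x) ⊗ m) ≐ (k ⊗ x) ⊗ (k ⊗ x) ⊗ m) ≡.refl k x (suc k) ⟩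
      (k ℕ.* x) ℕ.* (k ℕ.* x) ℕ.* suc k                 ≡⟨ ≡.cong (λ z → z ℕ.* z ℕ.* suc k) (walks-0-step j) ⟩
      (4 ℕ.* (suc j ℕ.* y)) ℕ.* (4 ℕ.* (suc j ℕ.* y)) ℕ.* suc k
        ≡⟨ solveℕ 2 (λ j y → conℕ 4 ⊗ ((conℕ 1 ⊕ j) ⊗ y) ⊗ (conℕ 4 ⊗ ((conℕ 1 ⊕ j) ⊗ y)) ⊗ (conℕ 3 ⊕ j)
             ≐ conℕ 16 ⊗ ((conℕ 1 ⊕ j) ⊗ (conℕ 3 ⊕ j)) ⊗ ((y ⊗ y) ⊗ (conℕ 1 ⊕ j))) ≡.refl j y ⟩
      16 ℕ.* (suc j ℕ.* suc k) ℕ.* ((y ℕ.* y) ℕ.* suc j) ≤⟨ ℕ.*-mono-≤ (ℕ.*-monoʳ-≤ 16 jk≤) (walks-0-bound j) ⟩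
      16 ℕ.* (k ℕ.* k) ℕ.* 4 ℕ.^ j                      ≡⟨ solveℕ 2 (λ k p → conℕ 16 ⊗ (k ⊗ k) ⊗ p ≐ k ⊗ k ⊗ (conℕ 4 ⊗ (conℕ 4 ⊗ p))) ≡.refl k (4 ℕ.^ j) ⟩
      k ℕ.* k ℕ.* 4 ℕ.^ k                               ∎)
      where
      open ℕ.≤-Reasoning
      k x y : ℕ
      k = suc (suc j)
      x = walks k 0ℤ
      y = walks j 0ℤ
      jk≤ : suc j ℕ.* suc k ℕ.≤ k ℕ.* k
      jk≤ = ℕ.m+n≤o⇒m≤o _ {1} (ℕ.≤-reflexive (solveℕ 1 (λ j → (conℕ 1 ⊕ j) ⊗ (conℕ 3 ⊕ j) ⊕ conℕ 1 ≐ (conℕ 2 ⊕ j) ⊗ (conℕ 2 ⊕ j)) ≡.refl j))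

    -- By reflection the count at 1 is half the central count one step later, so the previous bound
    -- at `suc j` carries over with the factor 4 cancelling.
    walks-1-bound : ∀ j → (walks j 1ℤ ℕ.* walks j 1ℤ) ℕ.* suc j ℕ.≤ 4 ℕ.^ j
    walks-1-bound j = ℕ.*-cancelˡ-≤ 4 (begin
      4 ℕ.* ((y ℕ.* y) ℕ.* suc j)                        ≡⟨ solveℕ 2 (λ y k → conℕ 4 ⊗ ((y ⊗ y) ⊗ k) ≐ ((conℕ 2 ⊗ y) ⊗ (conℕ 2 ⊗ y)) ⊗ k) ≡.refl y (suc j) ⟩
      ((2 ℕ.* y) ℕ.* (2 ℕ.* y)) ℕ.* suc j                ≡⟨ ≡.cong (λ z → z ℕ.* z ℕ.* suc j) (≡.sym (walks-0 j)) ⟩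
      (walks (suc j) 0ℤ ℕ.* walks (suc j) 0ℤ) ℕ.* suc j  ≤⟨ ℕ.*-monoʳ-≤ (walks (suc j) 0ℤ ℕ.* walks (suc j) 0ℤ) (ℕ.n≤1+n (suc j)) ⟩
      (walks (suc j) 0ℤ ℕ.* walks (suc j) 0ℤ) ℕ.* suc (suc j) ≤⟨ walks-0-bound (suc j) ⟩
      4 ℕ.* 4 ℕ.^ j ∎)
      where
      open ℕ.≤-Reasoning
      y : ℕ
      y = walks j 1ℤ

    walks-bound⁺ : ∀ j n → (walks j (+ n) ℕ.* walks j (+ n)) ℕ.* suc j ℕ.≤ 4 ℕ.^ j
    walks-bound⁺ j n with walks-central j n
    ... | inj₁ h = ℕ.≤-trans (ℕ.*-monoˡ-≤ (suc j) (ℕ.*-mono-≤ h h)) (walks-0-bound j)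
    ... | inj₂ h = ℕ.≤-trans (ℕ.*-monoˡ-≤ (suc j) (ℕ.*-mono-≤ h h)) (walks-1-bound j)

  walks-bound : ∀ j a → (walks j a ℕ.* walks j a) ℕ.* suc j ℕ.≤ 4 ℕ.^ j
  walks-bound j (+ n)    = walks-bound⁺ j n
  walks-bound j -[1+ n ] = ≡.subst (λ z → (z ℕ.* z) ℕ.* suc j ℕ.≤ 4 ℕ.^ j) (≡.sym (walks-neg j (+ suc n))) (walks-bound⁺ j (suc n))

-- Binomial convolution and decay of coefficients.

module Convolution (lem : ExcludedMiddle 0ℓ) (ℝ : CompleteOrderedField) where
  open CompleteOrderedField ℝ
  open OrderedField lem ℝ
  open Sums lem ℝ

  -- (f ⊛ g) n = ∑ₖ (n choose k) f k g (n − k), the product of exponential generating functions;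
  -- the recursion is the Leibniz rule.
  infixl 7 _⊛_
  _⊛_ : (ℕ → Carrier) → (ℕ → Carrier) → ℕ → Carrier
  (f ⊛ g) zero    = f 0 * g 0
  (f ⊛ g) (suc n) = ((f ∘ suc) ⊛ g) n + (f ⊛ (g ∘ suc)) n

  ⊛-cong : ∀ {f f′ g g′} → (∀ n → f n ≈ f′ n) → (∀ n → g n ≈ g′ n) → ∀ n → (f ⊛ g) n ≈ (f′ ⊛ g′) n
  ⊛-cong f≈ g≈ zero    = *-cong (f≈ 0) (g≈ 0)
  ⊛-cong f≈ g≈ (suc n) = +-cong (⊛-cong (f≈ ∘ suc) g≈ n) (⊛-cong f≈ (g≈ ∘ suc) n)

  ⊛-mono : ∀ {f f′ g g′} → (∀ n → 0# ≤ f n) → (∀ n → 0# ≤ g′ n) →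
           (∀ n → f n ≤ f′ n) → (∀ n → g n ≤ g′ n) → ∀ n → (f ⊛ g) n ≤ (f′ ⊛ g′) n
  ⊛-mono 0≤f 0≤g f≤ g≤ zero    = *-mono (0≤f 0) (0≤g 0) (f≤ 0) (g≤ 0)
  ⊛-mono 0≤f 0≤g f≤ g≤ (suc n) =
    +-mono (⊛-mono (0≤f ∘ suc) 0≤g (f≤ ∘ suc) g≤ n) (⊛-mono 0≤f (0≤g ∘ suc) f≤ (g≤ ∘ suc) n)

  ⊛-nonneg : ∀ {f g} → (∀ n → 0# ≤ f n) → (∀ n → 0# ≤ g n) → ∀ n → 0# ≤ (f ⊛ g) n
  ⊛-nonneg 0≤f 0≤g zero    = *-nonneg (0≤f 0) (0≤g 0)
  ⊛-nonneg 0≤f 0≤g (suc n) = +-nonneg (⊛-nonneg (0≤f ∘ suc) 0≤g n) (⊛-nonneg 0≤f (0≤g ∘ suc) n)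

  ⊛-comm : ∀ f g n → (f ⊛ g) n ≈ (g ⊛ f) n
  ⊛-comm f g zero    = *-comm (f 0) (g 0)
  ⊛-comm f g (suc n) = ≈.trans (+-cong (⊛-comm (f ∘ suc) g n) (⊛-comm f (g ∘ suc) n)) (+-comm _ _)

  ⊛-distribʳ : ∀ f f′ g n → ((λ k → f k + f′ k) ⊛ g) n ≈ (f ⊛ g) n + (f′ ⊛ g) n
  ⊛-distribʳ f f′ g zero    = distribʳ (g 0) (f 0) (f′ 0)
  ⊛-distribʳ f f′ g (suc n) = ≈.trans
    (+-cong (⊛-distribʳ (f ∘ suc) (f′ ∘ suc) g n) (⊛-distribʳ f f′ (g ∘ suc) n))
    (solve 4 (λ a b c d → (a :+ b) :+ (c :+ d) := (a :+ c) :+ (b :+ d)) ≈.refl _ _ _ _)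

  ⊛-zeroʳ : ∀ f n → (f ⊛ (λ _ → 0#)) n ≈ 0#
  ⊛-zeroʳ f zero    = zeroʳ (f 0)
  ⊛-zeroʳ f (suc n) = ≈.trans (+-cong (⊛-zeroʳ (f ∘ suc) n) (⊛-zeroʳ f n)) (+-identityˡ 0#)

  ⊛-∑ : {A : Set} (f : ℕ → Carrier) (l : List A) (g : A → ℕ → Carrier) → ∀ n →
        (f ⊛ (λ k → ∑ l (λ y → g y k))) n ≈ ∑ l (λ y → (f ⊛ g y) n)
  ⊛-∑ f []      g n = ⊛-zeroʳ f n
  ⊛-∑ f (y ∷ l) g n = begin
    (f ⊛ (λ k → g y k + ∑ l (λ y → g y k))) n          ≈⟨ ⊛-comm f _ n ⟩
    ((λ k → g y k + ∑ l (λ y → g y k)) ⊛ f) n          ≈⟨ ⊛-distribʳ (g y) _ f n ⟩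
    (g y ⊛ f) n + ((λ k → ∑ l (λ y → g y k)) ⊛ f) n    ≈⟨ +-cong (⊛-comm (g y) f n) (⊛-comm _ f n) ⟩
    (f ⊛ g y) n + (f ⊛ (λ k → ∑ l (λ y → g y k))) n    ≈⟨ +-congˡ (⊛-∑ f l g n) ⟩
    (f ⊛ g y) n + ∑ l (λ y → (f ⊛ g y) n)              ∎
    where open import Relation.Binary.Reasoning.Setoid setoid

  ⊛-*ˡ : ∀ c f g n → ((λ k → c * f k) ⊛ g) n ≈ c * (f ⊛ g) n
  ⊛-*ˡ c f g zero    = *-assoc c (f 0) (g 0)
  ⊛-*ˡ c f g (suc n) = ≈.trans (+-cong (⊛-*ˡ c (f ∘ suc) g n) (⊛-*ˡ c f (g ∘ suc) n)) (≈.sym (distribˡ c _ _))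

  ⊛-*ʳ : ∀ c f g n → (f ⊛ (λ k → c * g k)) n ≈ c * (f ⊛ g) n
  ⊛-*ʳ c f g n = ≈.trans (⊛-comm f _ n) (≈.trans (⊛-*ˡ c g f n) (*-congˡ (⊛-comm g f n)))

  ⊛-^ : ∀ x y n → ((x ^_) ⊛ (y ^_)) n ≈ (x + y) ^ n
  ⊛-^ x y zero    = *-identityˡ 1#
  ⊛-^ x y (suc n) = ≈.trans (+-cong (⊛-*ˡ x (x ^_) (y ^_) n) (⊛-*ʳ y (x ^_) (y ^_) n))
    (≈.trans (≈.sym (distribʳ _ x y)) (*-congˡ (⊛-^ x y n)))

  -- Two-term Cauchy-Schwarz without roots: the cross term satisfies
  -- `(2xy)² ≤ 4 (ae)(bc) ≤ (ae + bc)²`, the last step being the square of `ae - bc`.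
  cauchy : ∀ {x y a b c e} → 0# ≤ a → 0# ≤ b → 0# ≤ c → 0# ≤ e → x * x ≤ a * c → y * y ≤ b * e →
           (x + y) * (x + y) ≤ (a + b) * (c + e)
  cauchy {x} {y} {a} {b} {c} {e} 0≤a 0≤b 0≤c 0≤e xx≤ac yy≤be =
    ≤-by (+-nonneg (+-nonneg (≤⇒0≤- xx≤ac) (≤⇒0≤- yy≤be)) (≤⇒0≤- 2xy≤))
      (solve 6 (λ x y a b c e → (a :+ b) :* (c :+ e)
        := (x :+ y) :* (x :+ y) :+ (((a :* c :- x :* x) :+ (b :* e :- y :* y)) :+ ((a :* e :+ b :* c) :- (x :* y :+ x :* y))))
        ≈.refl x y a b c e)
    where
    xy²≤ : (x * x) * (y * y) ≤ (a * c) * (b * e)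
    xy²≤ = *-mono (square-nonneg x) (*-nonneg 0≤b 0≤e) xx≤ac yy≤be
    2xy≤ : x * y + x * y ≤ a * e + b * c
    2xy≤ = square-cancel-≤ (+-nonneg (*-nonneg 0≤a 0≤e) (*-nonneg 0≤b 0≤c))
      (≤-by (+-nonneg (square-nonneg (a * e - b * c)) (*-nonneg (fromℕ-nonneg 4) (≤⇒0≤- xy²≤)))
        (solve 6 (λ x y a b c e → (a :* e :+ b :* c) :* (a :* e :+ b :* c)
          := (x :* y :+ x :* y) :* (x :* y :+ x :* y)
             :+ ((a :* e :- b :* c) :* (a :* e :- b :* c) :+ con (+ 4) :* ((a :* c) :* (b :* e) :- (x :* x) :* (y :* y))))
          ≈.refl x y a b c e))

  -- The induction follows the Leibniz rule, so each step is a two-term Cauchy-Schwarz and no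
  -- binomial coefficient has to be written out.
  ⊛-cauchy : ∀ {f g A B C D} →
    (∀ n → 0# ≤ A n) → (∀ n → 0# ≤ B n) → (∀ n → 0# ≤ C n) → (∀ n → 0# ≤ D n) →
    (∀ n → f n * f n ≤ A n * B n) → (∀ n → g n * g n ≤ C n * D n) →
    ∀ n → (f ⊛ g) n * (f ⊛ g) n ≤ (A ⊛ C) n * (B ⊛ D) n
  ⊛-cauchy {f} {g} {A} {B} {C} {D} A⁺ B⁺ C⁺ D⁺ ff≤ gg≤ zero = ≤-respˡ
    (solve 2 (λ f g → (f :* f) :* (g :* g) := (f :* g) :* (f :* g)) ≈.refl (f 0) (g 0))
    (≤-respʳ (solve 4 (λ a b c d → (a :* b) :* (c :* d) := (a :* c) :* (b :* d)) ≈.refl (A 0) (B 0) (C 0) (D 0))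
      (*-mono (square-nonneg (f 0)) (*-nonneg (C⁺ 0) (D⁺ 0)) (ff≤ 0) (gg≤ 0)))
  ⊛-cauchy {f} {g} {A} {B} {C} {D} A⁺ B⁺ C⁺ D⁺ ff≤ gg≤ (suc n) =
    cauchy {a = ((A ∘ suc) ⊛ C) n} {b = (A ⊛ (C ∘ suc)) n} {c = ((B ∘ suc) ⊛ D) n} {e = (B ⊛ (D ∘ suc)) n}
      (⊛-nonneg (A⁺ ∘ suc) C⁺ n) (⊛-nonneg A⁺ (C⁺ ∘ suc) n) (⊛-nonneg (B⁺ ∘ suc) D⁺ n) (⊛-nonneg B⁺ (D⁺ ∘ suc) n)
      (⊛-cauchy (A⁺ ∘ suc) (B⁺ ∘ suc) C⁺ D⁺ (ff≤ ∘ suc) gg≤ n)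
      (⊛-cauchy A⁺ B⁺ (C⁺ ∘ suc) (D⁺ ∘ suc) ff≤ (gg≤ ∘ suc) n)

  -- multiplication of the exponential generating function by the variable
  Z : (ℕ → Carrier) → ℕ → Carrier
  Z f zero    = 0#
  Z f (suc n) = fromℕ (suc n) * f n

  Z-cong : ∀ {f g} → (∀ n → f n ≈ g n) → ∀ n → Z f n ≈ Z g n
  Z-cong f≈g zero    = ≈.refl
  Z-cong f≈g (suc n) = *-congˡ (f≈g n)

  Z-nonneg : ∀ {f} → (∀ n → 0# ≤ f n) → ∀ n → 0# ≤ Z f n
  Z-nonneg 0≤f zero    = ≤-refl
  Z-nonneg 0≤f (suc n) = *-nonneg (fromℕ-nonneg (suc n)) (0≤f n)

  -- As `_∘ suc` differentiates an exponential generating function, this is the product rule for z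
  -- F(z).
  Z-suc : ∀ f n → Z f (suc n) ≈ f n + Z (f ∘ suc) n
  Z-suc f zero    = solve 1 (λ a → (con 1ℤ :+ con 0ℤ) :* a := a :+ con 0ℤ) ≈.refl (f 0)
  Z-suc f (suc n) = solve 2 (λ a k → (con 1ℤ :+ k) :* a := a :+ k :* a) ≈.refl (f (suc n)) (fromℕ (suc n))

  Z-+ : ∀ f g n → Z (λ k → f k + g k) n ≈ Z f n + Z g n
  Z-+ f g zero    = ≈.sym (+-identityˡ 0#)
  Z-+ f g (suc n) = distribˡ _ _ _

  Z-⊛ : ∀ f g n → (Z f ⊛ g) n ≈ Z (f ⊛ g) n
  Z-⊛ f g zero    = zeroˡ (g 0)
  Z-⊛ f g (suc n) = begin
    ((Z f ∘ suc) ⊛ g) n + (Z f ⊛ (g ∘ suc)) n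
      ≈⟨ +-cong (⊛-cong (Z-suc f) (λ _ → ≈.refl) n) (Z-⊛ f (g ∘ suc) n) ⟩
    ((λ k → f k + Z (f ∘ suc) k) ⊛ g) n + Z (f ⊛ (g ∘ suc)) n
      ≈⟨ +-congʳ (≈.trans (⊛-distribʳ f (Z (f ∘ suc)) g n) (+-congˡ (Z-⊛ (f ∘ suc) g n))) ⟩
    ((f ⊛ g) n + Z ((f ∘ suc) ⊛ g) n) + Z (f ⊛ (g ∘ suc)) n
      ≈⟨ ≈.trans (+-assoc _ _ _) (+-congˡ (≈.sym (Z-+ ((f ∘ suc) ⊛ g) (f ⊛ (g ∘ suc)) n))) ⟩
    (f ⊛ g) n + Z ((f ⊛ g) ∘ suc) n
      ≈⟨ Z-suc (f ⊛ g) n ⟨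
    Z (f ⊛ g) (suc n) ∎
    where open import Relation.Binary.Reasoning.Setoid setoid

  Z^ : ℕ → (ℕ → Carrier) → ℕ → Carrier
  Z^ zero    f = f
  Z^ (suc d) f = Z (Z^ d f)

  Z^-nonneg : ∀ d {f} → (∀ n → 0# ≤ f n) → ∀ n → 0# ≤ Z^ d f n
  Z^-nonneg zero    0≤f = 0≤f
  Z^-nonneg (suc d) 0≤f = Z-nonneg (Z^-nonneg d 0≤f)

  ⊛-Z^ : ∀ d f g n → (f ⊛ Z^ d g) n ≈ Z^ d (f ⊛ g) n
  ⊛-Z^ zero    f g n = ≈.refl
  ⊛-Z^ (suc d) f g n = ≈.trans (⊛-comm f _ n) (≈.trans (Z-⊛ (Z^ d g) f n)
    (Z-cong (λ k → ≈.trans (⊛-comm (Z^ d g) f k) (⊛-Z^ d f g k)) n))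

  -- Applying `Z` d times produces the factor `(n + 1) ... (n + d)`, here bounded below by the d-th
  -- power of n.
  Z^-lower : ∀ d {f} → (∀ n → 0# ≤ f n) → ∀ n → fromℕ n ^ d * f n ≤ Z^ d f (d ℕ.+ n)
  Z^-lower zero    {f} 0≤f n = ≤-reflexive (*-identityˡ (f n))
  Z^-lower (suc d) {f} 0≤f n = ≤-respˡ (≈.sym (*-assoc (fromℕ n) (fromℕ n ^ d) (f n)))
    (*-mono (fromℕ-nonneg n) (Z^-nonneg d 0≤f (d ℕ.+ n)) (fromℕ-mono (ℕ.m≤n+m n (suc d))) (Z^-lower d 0≤f n))

  -- f n = O(xⁿ n^(−d/2)), in a form that is stable under ⊛: the exponential generating function of
  -- the majorant h is dominated by z^(−d) exp (x z).
  record Decay (d : ℕ) (x : Carrier) (f : ℕ → Carrier) : Set where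
    field
      h        : ℕ → Carrier
      h-nonneg : ∀ n → 0# ≤ h n
      square≤  : ∀ n → f n * f n ≤ x ^ n * h n
      Z^h≤     : ∀ n → Z^ d h n ≤ x ^ n

  -- In terms of generating functions the majorants multiply: the powers of z combine to `suc d`,
  -- and the product of the two exponentials has rate `x + y`. Cauchy-Schwarz transports the squared
  -- bounds.
  Decay-⊛ : ∀ {d x y f g} → 0# ≤ x → 0# ≤ y → Decay 1 x f → Decay d y g → Decay (suc d) (x + y) (f ⊛ g)
  Decay-⊛ {d} {x} {y} 0≤x 0≤y F G = record
    { h        = F.h ⊛ G.h
    ; h-nonneg = ⊛-nonneg F.h-nonneg G.h-nonneg
    ; square≤  = λ n → ≤-respʳ (*-congʳ (⊛-^ x y n))
        (⊛-cauchy (λ n → ^-nonneg n 0≤x) F.h-nonneg (λ n → ^-nonneg n 0≤y) G.h-nonneg F.square≤ G.square≤ n)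
    ; Z^h≤     = λ n → ≤-respˡ (≈.trans (Z-⊛ F.h (Z^ d G.h) n) (Z-cong (⊛-Z^ d F.h G.h) n))
        (≤-respʳ (⊛-^ x y n)
          (⊛-mono (Z-nonneg F.h-nonneg) (λ n → ^-nonneg n 0≤y) F.Z^h≤ G.Z^h≤ n))
    }
    where
    module F = Decay F
    module G = Decay G

  Decay-bound : ∀ {d x f} → 0# ≤ x → Decay d x f → ∀ n → (f n * f n) * fromℕ n ^ d ≤ x ^ n * x ^ (d ℕ.+ n)
  Decay-bound {d} {x} {f} 0≤x F n = ≤-trans
    (*-mono (square-nonneg (f n)) (^-nonneg d (fromℕ-nonneg n)) (square≤ n) ≤-refl)
    (≤-respˡ (solve 3 (λ a b c → a :* (c :* b) := (a :* b) :* c) ≈.refl (x ^ n) (h n) (fromℕ n ^ d))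
      (*-monoˡ (^-nonneg n 0≤x) (≤-trans (Z^-lower d h-nonneg n) (Z^h≤ (d ℕ.+ n)))))
    where open Decay F

  2# : Carrier
  2# = 1# + 1#

  0≤2# : 0# ≤ 2#
  0≤2# = +-nonneg 0≤1 0≤1

  Decay-walks : ∀ a → Decay 1 2# (λ j → fromℕ (Walks.walks j a))
  Decay-walks a = record
    { h        = h
    ; h-nonneg = h-nonneg
    ; square≤  = square≤
    ; Z^h≤     = λ { zero → 0≤1 ; (suc j) → ≤-reflexive (Zh j) }
    }
    where
    s : ℕ → Carrier
    s j = fromℕ (suc j)
    h : ℕ → Carrier
    -- Chosen so that `Z h` agrees with the powers of two from index 1 on. The exponent `suc j` is
    -- one more than `walks-bound` requires; the spare factor of two is the slack in `square≤`.
    h j = 2# ^ suc j * s j ⁻¹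
    s-inverse : ∀ j → s j * s j ⁻¹ ≈ 1#
    s-inverse j = *-inverseʳ (s j) (0<⇒≉0 (0<fromℕ j))
    h-nonneg : ∀ j → 0# ≤ h j
    h-nonneg j = *-nonneg (^-nonneg (suc j) 0≤2#) (⁻¹-nonneg (0<fromℕ j))
    Zh : ∀ j → s j * h j ≈ 2# ^ suc j
    Zh j = ≈.trans (solve 3 (λ s p i → s :* (p :* i) := p :* (s :* i)) ≈.refl (s j) (2# ^ suc j) (s j ⁻¹))
      (≈.trans (*-congˡ (s-inverse j)) (*-identityʳ _))
    4^≈ : ∀ j → fromℕ (4 ℕ.^ j) ≈ 2# ^ j * 2# ^ j
    4^≈ zero    = ≈.trans (+-identityʳ 1#) (≈.sym (*-identityʳ 1#))
    4^≈ (suc j) = ≈.trans (fromℕ-* 4 (4 ℕ.^ j)) (≈.trans (*-congˡ (4^≈ j))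
      (solve 1 (λ p → con (+ 4) :* (p :* p) := ((con 1ℤ :+ con 1ℤ) :* p) :* ((con 1ℤ :+ con 1ℤ) :* p)) ≈.refl (2# ^ j)))
    square≤ : ∀ j → fromℕ (Walks.walks j a) * fromℕ (Walks.walks j a) ≤ 2# ^ j * h j
    square≤ j = *-cancelˡ-≤ (0<fromℕ j) (≤-trans
      (≤-respˡ (≈.trans (≈.trans (fromℕ-* (w ℕ.* w) (suc j)) (*-congʳ (fromℕ-* w w))) (*-comm _ _))
        (≤-respʳ (4^≈ j) (fromℕ-mono (Walks.walks-bound j a))))
      (≤-by (*-nonneg (^-nonneg j 0≤2#) (^-nonneg j 0≤2#))
        (≈.trans (solve 3 (λ s p h → s :* (p :* h) := p :* (s :* h)) ≈.refl (s j) (2# ^ j) (h j))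
          (≈.trans (*-congˡ (Zh j))
            (solve 1 (λ p → p :* ((con 1ℤ :+ con 1ℤ) :* p) := p :* p :+ p :* p) ≈.refl (2# ^ j))))))
      where
      w : ℕ
      w = Walks.walks j a

-- The Green function truncated at a finite time.

module Green (lem : ExcludedMiddle 0ℓ) (ℝ : CompleteOrderedField)
             (G : Graph) (D : ℕ) (degree : ∀ v → length (Graph.𝒩 G v) ≡ suc D)
             (o : Graph.V G) (q : Graph.V G → ℕ → CompleteOrderedField.Carrier ℝ) where
  open CompleteOrderedField ℝ
  open OrderedField lem ℝ
  open Toppling lem ℝ
  open Sums lem ℝ
  open RegularGraph lem ℝ G D degree
  open Graph G
  open import Relation.Binary.Reasoning.Setoid setoid

  module _ (q-zero : ∀ v → q v 0 ≈ ind o v)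
           (q-suc : ∀ v n → q v (suc n) ≈ ∑ (𝒩 v) (λ y → q y n))
           (q-nonneg : ∀ v n → 0# ≤ q v n) where

    p : ℕ → V → Carrier
    p n v = κ ^ n * q v n

    green : ℕ → V → Carrier
    green zero    v = 0#
    green (suc n) v = green n v + p n v

    p-nonneg : ∀ n v → 0# ≤ p n v
    p-nonneg n v = *-nonneg (^-nonneg n κ-nonneg) (q-nonneg v n)

    green-nonneg : ∀ n v → 0# ≤ green n v
    green-nonneg zero    v = ≤-refl
    green-nonneg (suc n) v = +-nonneg (green-nonneg n v) (p-nonneg n v)

    p-suc : ∀ n v → p (suc n) v ≈ κ * ∑ (𝒩 v) (p n)
    p-suc n v = begin
      κ * κ ^ n * q v (suc n)                  ≈⟨ ≈.trans (*-assoc κ (κ ^ n) _) (*-congˡ (*-congˡ (q-suc v n))) ⟩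
      κ * (κ ^ n * ∑ (𝒩 v) (λ y → q y n))      ≈⟨ *-congˡ (∑-*ˡ (𝒩 v) (κ ^ n) _) ⟨
      κ * ∑ (𝒩 v) (p n)                        ∎

    -- Telescoping: each new summand `p n` changes the Laplacian by `p n` minus its average, and
    -- that average is `p (suc n)`.
    green-equation : ∀ n v → ind o v ≈ (green n v - κ * ∑ (𝒩 v) (green n)) + p n v
    green-equation zero    v = begin
      ind o v                                             ≈⟨ q-zero v ⟨
      q v 0                                               ≈⟨ solve 2 (λ a k → a := (con 0ℤ :- k :* con 0ℤ) :+ con 1ℤ :* a) ≈.refl (q v 0) κ ⟩
      (0# - κ * 0#) + 1# * q v 0                          ≈⟨ +-congʳ (+-congˡ (-‿cong (*-congˡ (∑-zero (𝒩 v))))) ⟨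
      (0# - κ * ∑ (𝒩 v) (λ _ → 0#)) + 1# * q v 0          ∎
    green-equation (suc n) v = begin
      ind o v
        ≈⟨ green-equation n v ⟩
      (green n v - κ * ∑ (𝒩 v) (green n)) + p n v
        ≈⟨ solve 5 (λ g k s p t → (g :- k :* s) :+ p := ((g :+ p) :- k :* (s :+ t)) :+ k :* t) ≈.refl (green n v) κ (∑ (𝒩 v) (green n)) (p n v) (∑ (𝒩 v) (p n)) ⟩
      ((green n v + p n v) - κ * (∑ (𝒩 v) (green n) + ∑ (𝒩 v) (p n))) + κ * ∑ (𝒩 v) (p n)
        ≈⟨ +-cong (+-congˡ (-‿cong (*-congˡ (∑-+ (𝒩 v) (green n) (p n))))) (p-suc n v) ⟨
      (green (suc n) v - κ * ∑ (𝒩 v) (green (suc n))) + p (suc n) v ∎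

    -- What lies on `E` at time `suc n` was on the neighbours of `E` at time `n`, so the induction
    -- runs over all finite lists at once. By symmetry of adjacency each site passes on at most its
    -- own mass.
    ∑p≤1 : ∀ n {E} → Unique E → ∑ E (p n) ≤ 1#
    ∑p≤1 zero {E} E! = ≤-respˡ (∑-cong E λ v →
      ≈.trans (indicator-sym G v o) (≈.sym (≈.trans (*-identityˡ _) (q-zero v)))) (mult≤1 G E! o)
    ∑p≤1 (suc n) {E} E! with dedup lem (concatMap 𝒩 E)
    ... | E′ , E′! , 𝒩E⊆E′ = ≤-respˡ (≈.sym ∑p≈) (≤-trans
        (*-monoˡ κ-nonneg (≤-respʳ (∑-*ˡ E′ _ _) (∑-mono E′ λ y →
          *-mono (∑-nonneg E (adj-nonneg y)) (p-nonneg n y) (∑-adj≤ E! y) ≤-refl)))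
        (≤-respˡ (≈.trans (≈.sym (≈.trans (*-congʳ (≈.trans (*-comm _ _) κ-inverse)) (*-identityˡ _))) (*-assoc _ _ _)) (∑p≤1 n E′!)))
      where
      𝒩⊆E′ : ∀ {v} → v ∈ E → 𝒩 v ⊆ E′
      𝒩⊆E′ v∈E y∈ = 𝒩E⊆E′ (∈-concatMap⁺ 𝒩 {xs = E} (lose v∈E y∈))
      ∑p≈ : ∑ E (p (suc n)) ≈ κ * ∑ E′ (λ y → ∑ E (adj y) * p n y)
      ∑p≈ = begin
        ∑ E (p (suc n))                                  ≈⟨ ≈.trans (∑-cong E (p-suc n)) (∑-*ˡ E κ _) ⟩
        κ * ∑ E (λ v → ∑ (𝒩 v) (p n))                    ≈⟨ *-congˡ (∑-cong-∈ E λ v∈E → ∑-mult G (p n) E′! (𝒩⊆E′ v∈E)) ⟨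
        κ * ∑ E (λ v → ∑ E′ (λ y → adj v y * p n y))     ≈⟨ *-congˡ (∑-swap E E′ _) ⟩
        κ * ∑ E′ (λ y → ∑ E (λ v → adj v y * p n y))     ≈⟨ *-congˡ (∑-cong E′ λ y →
                                                              ≈.trans (∑-cong E λ v → *-congʳ (adj-sym v y)) (∑-*ʳ E (p n y) (adj y))) ⟩
        κ * ∑ E′ (λ y → ∑ E (adj y) * p n y)             ∎

    ∑green≤ : ∀ n {E} → Unique E → ∑ E (green n) ≤ fromℕ n
    ∑green≤ zero    {E} E! = ≤-reflexive (∑-zero E)
    ∑green≤ (suc n) {E} E! = ≤-respˡ (≈.sym (∑-+ E (green n) (p n)))
      (≤-respʳ (+-comm _ _) (+-mono (∑green≤ n E!) (∑p≤1 n E!)))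

-- Walk counts on the lattice.

module LatticeWalks (lem : ExcludedMiddle 0ℓ) (ℝ : CompleteOrderedField) where
  open CompleteOrderedField ℝ
  open OrderedField lem ℝ
  open Toppling lem ℝ
  open Sums lem ℝ
  open Convolution lem ℝ
  open Walks using (walks)

  -- A lattice walk is an interleaving of walks in the coordinates, which is what the binomial
  -- convolution counts. Its unit `0# ^_` is the count in dimension zero: one walk, of length zero.
  latticeWalks : ∀ {d} → Vec ℤ d → ℕ → Carrier
  latticeWalks []      = 0# ^_
  latticeWalks (a ∷ x) = (λ j → fromℕ (walks j a)) ⊛ latticeWalks x

  latticeWalks-nonneg : ∀ {d} (x : Vec ℤ d) n → 0# ≤ latticeWalks x n
  latticeWalks-nonneg []      n = ^-nonneg n ≤-refl
  latticeWalks-nonneg (a ∷ x) n = ⊛-nonneg (λ j → fromℕ-nonneg (walks j a)) (latticeWalks-nonneg x) n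

  latticeWalks-suc : ∀ {d} (x : Vec ℤ d) n → latticeWalks x (suc n) ≈ ∑ (ℤ-neighbours x) (λ y → latticeWalks y n)
  latticeWalks-suc []      n = zeroˡ _
  latticeWalks-suc (a ∷ x) n = begin
    ((b a ∘ suc) ⊛ q) n + (b a ⊛ (q ∘ suc)) n
      ≈⟨ +-cong (⊛-cong (λ j → fromℕ-+ (walks j (1ℤ ℤ.+ a)) _) (λ _ → ≈.refl) n) (⊛-cong (λ _ → ≈.refl) (latticeWalks-suc x) n) ⟩
    ((λ j → b (1ℤ ℤ.+ a) j + b (-1ℤ ℤ.+ a) j) ⊛ q) n + (b a ⊛ (λ k → ∑ (ℤ-neighbours x) (λ y → latticeWalks y k))) n
      ≈⟨ +-cong (⊛-distribʳ (b (1ℤ ℤ.+ a)) (b (-1ℤ ℤ.+ a)) q n) (⊛-∑ (b a) (ℤ-neighbours x) latticeWalks n) ⟩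
    ((b (1ℤ ℤ.+ a) ⊛ q) n + (b (-1ℤ ℤ.+ a) ⊛ q) n) + ∑ (ℤ-neighbours x) (λ y → latticeWalks (a ∷ y) n)
      ≈⟨ ≈.trans (+-assoc _ _ _) (+-congˡ (+-congˡ (≈.sym (∑-map (a ∷_) (ℤ-neighbours x) _)))) ⟩
    ∑ (ℤ-neighbours (a ∷ x)) (λ y → latticeWalks y n) ∎
    where
    open import Relation.Binary.Reasoning.Setoid setoid
    b : ℤ → ℕ → Carrier
    b a j = fromℕ (walks j a)
    q : ℕ → Carrier
    q = latticeWalks x

  private
    walks-0-≢ : ∀ {a} → a ≢ 0ℤ → walks 0 a ≡ 0
    walks-0-≢ {+ zero}   a≢0 = contradiction ≡.refl a≢0
    walks-0-≢ {+ suc _}  _   = ≡.refl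
    walks-0-≢ { -[1+ _ ]} _  = ≡.refl

    at-origin : ∀ d → latticeWalks (origin {d}) 0 ≈ 1#
    at-origin zero    = ≈.refl
    at-origin (suc d) = ≈.trans (*-cong (+-identityʳ 1#) (at-origin d)) (*-identityˡ 1#)

    off-origin : ∀ {d} (x : Vec ℤ d) → origin ≢ x → latticeWalks x 0 ≈ 0#
    off-origin []      0≢x = contradiction ≡.refl 0≢x
    off-origin (a ∷ x) 0≢ax with a ℤ.≟ 0ℤ
    ... | yes ≡.refl = ≈.trans (*-congˡ (off-origin x (0≢ax ∘ ≡.cong (0ℤ ∷_)))) (zeroʳ _)
    ... | no  a≢0    = ≈.trans (*-congʳ (reflexive (≡.cong fromℕ (walks-0-≢ a≢0)))) (zeroˡ _)

  latticeWalks-zero : ∀ {d} (x : Vec ℤ d) → latticeWalks x 0 ≈ indicator (ℤ^ d) origin x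
  latticeWalks-zero {d} x with lem {origin ≡ x}
  ... | yes ≡.refl = at-origin d
  ... | no  0≢x    = off-origin x 0≢x

  deg : ℕ → ℕ
  deg zero    = 0
  deg (suc d) = suc (suc (deg d))

  length-ℤ-neighbours : ∀ {d} (x : Vec ℤ d) → length (ℤ-neighbours x) ≡ deg d
  length-ℤ-neighbours []      = ≡.refl
  length-ℤ-neighbours (a ∷ x) = ≡.cong (suc ∘ suc) (≡.trans (length-map (a ∷_) (ℤ-neighbours x)) (length-ℤ-neighbours x))

  -- The degree again, in the form in which `Decay-⊛` accumulates it: a rate of two for every
  -- coordinate.
  base : ℕ → Carrier
  base zero    = 0#
  base (suc d) = 2# + base d

  base≈ : ∀ d → base d ≈ fromℕ (deg d)
  base≈ zero    = ≈.refl
  base≈ (suc d) = ≈.trans (+-congˡ (base≈ d)) (+-assoc 1# 1# _)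

  base-nonneg : ∀ d → 0# ≤ base d
  base-nonneg zero    = ≤-refl
  base-nonneg (suc d) = +-nonneg 0≤2# (base-nonneg d)

  Decay-latticeWalks : ∀ {d} (x : Vec ℤ d) → Decay d (base d) (latticeWalks x)
  Decay-latticeWalks []      = record
    { h        = 0# ^_
    ; h-nonneg = λ n → ^-nonneg n ≤-refl
    ; square≤  = λ _ → ≤-refl
    ; Z^h≤     = λ _ → ≤-refl
    }
  Decay-latticeWalks {suc d} (a ∷ x) = Decay-⊛ 0≤2# (base-nonneg d) (Decay-walks a) (Decay-latticeWalks x)

  latticeWalks-bound : ∀ {d} (x : Vec ℤ d) n →
    (latticeWalks x n * latticeWalks x n) * fromℕ n ^ d ≤ fromℕ (deg d) ^ n * fromℕ (deg d) ^ (d ℕ.+ n)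
  latticeWalks-bound {d} x n = ≤-respʳ (*-cong (^-congˡ n (base≈ d)) (^-congˡ (d ℕ.+ n) (base≈ d)))
    (Decay-bound (base-nonneg d) (Decay-latticeWalks x) n)

-- Norms, distances and boxes in the lattice.

module LatticeGeometry where
  open ℕS.+-*-Solver using (solve; _:=_; _:+_; _:*_; con)

  norm : ∀ {d} → Vec ℤ d → ℕ
  norm []      = 0
  norm (a ∷ x) = ∣ a ∣ ℕ.+ norm x

  norm² : ∀ {d} → Vec ℤ d → ℕ
  norm² []      = 0
  norm² (a ∷ x) = ∣ a ∣ ℕ.* ∣ a ∣ ℕ.+ norm² x

  norm-origin : ∀ d → norm (origin {d}) ≡ 0
  norm-origin zero    = ≡.refl
  norm-origin (suc d) = norm-origin d

  norm²-origin : ∀ d → norm² (origin {d}) ≡ 0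
  norm²-origin zero    = ≡.refl
  norm²-origin (suc d) = norm²-origin d

  private
    am-gm : ∀ {d} a e (x : Vec ℤ d) → 2 ℕ.* (a ℕ.* (e ℕ.* norm x)) ℕ.≤ d ℕ.* (a ℕ.* a) ℕ.+ (e ℕ.* e) ℕ.* norm² x
    am-gm a e []      = ℕ.≤-reflexive (solve 2 (λ a e → con 2 :* (a :* (e :* con 0)) := e :* e :* con 0) ≡.refl a e)
    am-gm {suc d} a e (b ∷ x) = begin
      2 ℕ.* (a ℕ.* (e ℕ.* (∣ b ∣ ℕ.+ norm x)))
        ≡⟨ solve 4 (λ a e b n → con 2 :* (a :* (e :* (b :+ n))) := con 2 :* (a :* (e :* b)) :+ con 2 :* (a :* (e :* n))) ≡.refl a e ∣ b ∣ (norm x) ⟩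
      2 ℕ.* (a ℕ.* (e ℕ.* ∣ b ∣)) ℕ.+ 2 ℕ.* (a ℕ.* (e ℕ.* norm x))
        ≤⟨ ℕ.+-mono-≤ (2ab≤ a (e ℕ.* ∣ b ∣)) (am-gm a e x) ⟩
      (a ℕ.* a ℕ.+ (e ℕ.* ∣ b ∣) ℕ.* (e ℕ.* ∣ b ∣)) ℕ.+ (d ℕ.* (a ℕ.* a) ℕ.+ (e ℕ.* e) ℕ.* norm² x)
        ≡⟨ solve 5 (λ a e b d n → (a :* a :+ (e :* b) :* (e :* b)) :+ (d :* (a :* a) :+ (e :* e) :* n)
             := (a :* a :+ d :* (a :* a)) :+ (e :* e) :* (b :* b :+ n)) ≡.refl a e ∣ b ∣ d (norm² x) ⟩
      suc d ℕ.* (a ℕ.* a) ℕ.+ (e ℕ.* e) ℕ.* (∣ b ∣ ℕ.* ∣ b ∣ ℕ.+ norm² x) ∎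
      where
      open ℕ.≤-Reasoning
      ordered : ∀ a k → 2 ℕ.* (a ℕ.* (a ℕ.+ k)) ℕ.≤ a ℕ.* a ℕ.+ (a ℕ.+ k) ℕ.* (a ℕ.+ k)
      ordered a k = ℕ.m+n≤o⇒m≤o _ {k ℕ.* k} (ℕ.≤-reflexive
        (solve 2 (λ a k → con 2 :* (a :* (a :+ k)) :+ k :* k := a :* a :+ (a :+ k) :* (a :+ k)) ≡.refl a k))
      2ab≤ : ∀ a b → 2 ℕ.* (a ℕ.* b) ℕ.≤ a ℕ.* a ℕ.+ b ℕ.* b
      2ab≤ a b with ℕ.≤-total a b
      ... | inj₁ a≤b = ≡.subst (λ z → 2 ℕ.* (a ℕ.* z) ℕ.≤ a ℕ.* a ℕ.+ z ℕ.* z) (ℕ.m+[n∸m]≡n a≤b) (ordered a (b ℕ.∸ a))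
      ... | inj₂ b≤a = ≡.subst₂ ℕ._≤_ (≡.cong (2 ℕ.*_) (ℕ.*-comm b a)) (ℕ.+-comm (b ℕ.* b) (a ℕ.* a))
        (≡.subst (λ z → 2 ℕ.* (b ℕ.* z) ℕ.≤ b ℕ.* b ℕ.+ z ℕ.* z) (ℕ.m+[n∸m]≡n b≤a) (ordered b (a ℕ.∸ b)))

  -- Cauchy-Schwarz between the 1-norm and the 2-norm, free of division. The weights `n` and `d` in
  -- `am-gm` are sharp when all coordinates have absolute value n/d.
  norm²-lower : ∀ {d} n (x : Vec ℤ d) → n ℕ.≤ norm x → n ℕ.* n ℕ.≤ d ℕ.* norm² x
  norm²-lower {zero}  n []       z≤n = z≤n
  norm²-lower {suc k} n x n≤∣x∣ = ℕ.*-cancelˡ-≤ d (ℕ.+-cancelˡ-≤ (d ℕ.* (n ℕ.* n)) _ _ (begin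
    d ℕ.* (n ℕ.* n) ℕ.+ d ℕ.* (n ℕ.* n)
      ≡⟨ solve 2 (λ d n → d :* (n :* n) :+ d :* (n :* n) := con 2 :* (n :* (d :* n))) ≡.refl d n ⟩
    2 ℕ.* (n ℕ.* (d ℕ.* n))
      ≤⟨ ℕ.*-monoʳ-≤ 2 (ℕ.*-monoʳ-≤ n (ℕ.*-monoʳ-≤ d n≤∣x∣)) ⟩
    2 ℕ.* (n ℕ.* (d ℕ.* norm x))
      ≤⟨ am-gm n d x ⟩
    d ℕ.* (n ℕ.* n) ℕ.+ (d ℕ.* d) ℕ.* norm² x
      ≡⟨ ≡.cong (d ℕ.* (n ℕ.* n) ℕ.+_) (ℕ.*-assoc d d (norm² x)) ⟩
    d ℕ.* (n ℕ.* n) ℕ.+ d ℕ.* (d ℕ.* norm² x) ∎))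
    where
    open ℕ.≤-Reasoning
    d : ℕ
    d = suc k

  norm²-upper : ∀ {d} (x : Vec ℤ d) → norm² x ℕ.≤ norm x ℕ.* norm x
  norm²-upper []      = z≤n
  norm²-upper (a ∷ x) = begin
    ∣ a ∣ ℕ.* ∣ a ∣ ℕ.+ norm² x                  ≤⟨ ℕ.+-monoʳ-≤ _ (norm²-upper x) ⟩
    ∣ a ∣ ℕ.* ∣ a ∣ ℕ.+ norm x ℕ.* norm x        ≤⟨ ℕ.m+n≤o⇒m≤o _ {2 ℕ.* (∣ a ∣ ℕ.* norm x)} (ℕ.≤-reflexive
      (solve 2 (λ a s → (a :* a :+ s :* s) :+ con 2 :* (a :* s) := (a :+ s) :* (a :+ s)) ≡.refl ∣ a ∣ (norm x))) ⟩
    (∣ a ∣ ℕ.+ norm x) ℕ.* (∣ a ∣ ℕ.+ norm x)    ∎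
    where open ℕ.≤-Reasoning

  norm-triangle : ∀ {d} (x y : Vec ℤ d) → norm x ℕ.≤ ‖ x - y ‖₁ ℕ.+ norm y
  norm-triangle []      []      = z≤n
  norm-triangle (a ∷ x) (b ∷ y) = begin
    ∣ a ∣ ℕ.+ norm x
      ≡⟨ ≡.cong (λ z → ∣ z ∣ ℕ.+ norm x) (≡.trans (≡.sym (ℤ.+-identityʳ a)) (≡.trans (≡.cong (λ z → a ℤ.+ z) (≡.sym (ℤ.+-inverseˡ b))) (≡.sym (ℤ.+-assoc a (ℤ.- b) b)))) ⟩
    ∣ (a ℤ.- b) ℤ.+ b ∣ ℕ.+ norm x
      ≤⟨ ℕ.+-mono-≤ (ℤ.∣i+j∣≤∣i∣+∣j∣ (a ℤ.- b) b) (norm-triangle x y) ⟩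
    (∣ a ℤ.- b ∣ ℕ.+ ∣ b ∣) ℕ.+ (‖ x - y ‖₁ ℕ.+ norm y)
      ≡⟨ solve 4 (λ p b q n → (p :+ b) :+ (q :+ n) := (p :+ q) :+ (b :+ n)) ≡.refl ∣ a ℤ.- b ∣ ∣ b ∣ (‖ x - y ‖₁) (norm y) ⟩
    (∣ a ℤ.- b ∣ ℕ.+ ‖ x - y ‖₁) ℕ.+ (∣ b ∣ ℕ.+ norm y) ∎
    where open ℕ.≤-Reasoning

  private module ℤ^ d = Graph (ℤ^ d)

  norm≤steps : ∀ {d} {x : Vec ℤ d} (w : Star (ℤ^._~_ d) x origin) → norm x ℕ.≤ steps w
  norm≤steps {d} ε = ℕ.≤-reflexive (norm-origin d)
  norm≤steps {d} {x} (_◅_ {j = y} x~y w) = ℕ.≤-trans (norm-triangle x y)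
    (≡.subst (λ k → k ℕ.+ norm y ℕ.≤ suc (steps w)) (≡.sym x~y) (s≤s (norm≤steps w)))

  -- Together with `norm≤steps` this identifies the graph distance to the origin with the 1-norm.
  walkHome : ∀ {d} (x : Vec ℤ d) → ∃ λ (w : Star (ℤ^._~_ d) x origin) → steps w ≡ norm x
  walkHome []              = ε , ≡.refl
  walkHome {suc d} (a ∷ x) with walkHome x
  ... | w , ∣w∣≡∣x∣ = straight a
    where
    _~_ = ℤ^._~_ (suc d)
    steps-gmap : ∀ {y z} (v : Star (ℤ^._~_ d) y z) → steps (gmap {U = _~_} (0ℤ ∷_) (λ e → e) v) ≡ steps v
    steps-gmap ε       = ≡.refl
    steps-gmap (_ ◅ v) = ≡.cong suc (steps-gmap v)
    home : ∃ λ (w : Star _~_ (0ℤ ∷ x) origin) → steps w ≡ norm x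
    home = gmap (0ℤ ∷_) (λ e → e) w , ≡.trans (steps-gmap w) ∣w∣≡∣x∣
    extend : ∀ {y z : Vec ℤ (suc d)} {k} → y ∈ ℤ-neighbours z → ∃ (λ (w : Star _~_ z origin) → steps w ≡ k) →
             ∃ λ (w : Star _~_ y origin) → steps w ≡ suc k
    extend y∈ (w , e) = ℤ^.𝒩-sound (suc d) y∈ ◅ w , ≡.cong suc e
    straight : ∀ a → ∃ λ (w : Star _~_ (a ∷ x) origin) → steps w ≡ ∣ a ∣ ℕ.+ norm x
    straight (+ zero)      = home
    straight (+ suc n)     = extend (here ≡.refl) (straight (+ n))
    straight -[1+ zero ]   = extend (there (here ≡.refl)) home
    straight -[1+ suc n ]  = extend (there (here ≡.refl)) (straight -[1+ n ])

  interval : ℕ → List ℤ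
  interval n = map +_ (upTo (suc n)) ++ map -[1+_] (upTo n)

  box : ∀ d → ℕ → List (Vec ℤ d)
  box zero    n = [] ∷ []
  box (suc d) n = cartesianProductWith _∷_ (interval n) (box d n)

  interval-unique : ∀ n → Unique (interval n)
  interval-unique n = Unique.++⁺
    (Unique.map⁺ ℤ.+-injective (Unique.upTo⁺ (suc n)))
    (Unique.map⁺ ℤ.-[1+-injective (Unique.upTo⁺ n))
    λ (p , q) → disjoint (∈-map⁻ +_ p) (∈-map⁻ -[1+_] q)
    where
    disjoint : ∀ {a} → ∃ (λ i → i ∈ upTo (suc n) × a ≡ + i) → ¬ ∃ (λ i → i ∈ upTo n × a ≡ -[1+ i ])
    disjoint (_ , _ , ≡.refl) (_ , _ , ())

  box-unique : ∀ d n → Unique (box d n)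
  box-unique zero    n = [] ∷ []
  box-unique (suc d) n = Unique.cartesianProductWith⁺ _∷_ ∷-injective (interval-unique n) (box-unique d n)

  ∈-interval : ∀ {n} a → ∣ a ∣ ℕ.≤ n → a ∈ interval n
  ∈-interval (+ i)    i≤n = ∈-++⁺ˡ (∈-map⁺ +_ (∈-upTo⁺ (s≤s i≤n)))
  ∈-interval -[1+ i ] i<n = ∈-++⁺ʳ _ (∈-map⁺ -[1+_] (∈-upTo⁺ i<n))

  ∈-box : ∀ {d n} (x : Vec ℤ d) → norm x ℕ.≤ n → x ∈ box d n
  ∈-box []      _     = here ≡.refl
  ∈-box (a ∷ x) ∣x∣≤n = ∈-cartesianProductWith⁺ _∷_
    (∈-interval a (ℕ.m+n≤o⇒m≤o ∣ a ∣ ∣x∣≤n)) (∈-box x (ℕ.m+n≤o⇒n≤o ∣ a ∣ ∣x∣≤n))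

  length-cartesianProductWith : {A B C : Set} (f : A → B → C) (xs : List A) (ys : List B) →
    length (cartesianProductWith f xs ys) ≡ length xs ℕ.* length ys
  length-cartesianProductWith f []       ys = ≡.refl
  length-cartesianProductWith f (x ∷ xs) ys = ≡.trans (length-++ (map (f x) ys))
    (≡.cong₂ ℕ._+_ (length-map (f x) ys) (length-cartesianProductWith f xs ys))

  length-interval : ∀ n → length (interval n) ≡ suc n ℕ.+ n
  length-interval n = ≡.trans (length-++ (map +_ (upTo (suc n))))
    (≡.cong₂ ℕ._+_ (≡.trans (length-map +_ (upTo (suc n))) (length-upTo (suc n)))
                   (≡.trans (length-map -[1+_] (upTo n)) (length-upTo n)))

  length-box : ∀ d n → length (box d n) ≡ (suc n ℕ.+ n) ℕ.^ d
  length-box zero    n = ≡.refl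
  length-box (suc d) n = ≡.trans (length-cartesianProductWith _∷_ (interval n) (box d n))
    (≡.cong₂ ℕ._*_ (length-interval n) (length-box d n))

  ∣±1∣² : ∀ a → ∣ 1ℤ ℤ.+ a ∣ ℕ.* ∣ 1ℤ ℤ.+ a ∣ ℕ.+ ∣ -1ℤ ℤ.+ a ∣ ℕ.* ∣ -1ℤ ℤ.+ a ∣ ≡ 2 ℕ.* (∣ a ∣ ℕ.* ∣ a ∣) ℕ.+ 2
  ∣±1∣² (+ zero)       = ≡.refl
  ∣±1∣² (+ suc n)      = solve 1 (λ n → (con 2 :+ n) :* (con 2 :+ n) :+ n :* n := con 2 :* ((con 1 :+ n) :* (con 1 :+ n)) :+ con 2) ≡.refl n
  ∣±1∣² -[1+ zero ]    = ≡.refl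
  ∣±1∣² -[1+ suc n ]   = solve 1 (λ n → (con 1 :+ n) :* (con 1 :+ n) :+ (con 3 :+ n) :* (con 3 :+ n) := con 2 :* ((con 2 :+ n) :* (con 2 :+ n)) :+ con 2) ≡.refl n

-- The squared Euclidean norm as a test function.

module LatticeMoment (lem : ExcludedMiddle 0ℓ) (ℝ : CompleteOrderedField) where
  open CompleteOrderedField ℝ
  open OrderedField lem ℝ
  open Toppling lem ℝ
  open Sums lem ℝ
  open LatticeWalks lem ℝ using (deg; length-ℤ-neighbours)
  open LatticeGeometry

  moment : ∀ {d} → Vec ℤ d → Carrier
  moment x = fromℕ (norm² x)

  ∑-moment : ∀ {d} (x : Vec ℤ d) → ∑ (ℤ-neighbours x) moment ≈ fromℕ (deg d) * (moment x + 1#)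
  ∑-moment []            = ≈.sym (zeroˡ _)
  ∑-moment {suc d} (a ∷ x) = begin
    fromℕ ([1+a]² ℕ.+ norm² x) + (fromℕ ([-1+a]² ℕ.+ norm² x) + ∑ (map (a ∷_) (ℤ-neighbours x)) moment)
      ≈⟨ +-cong (fromℕ-+ [1+a]² (norm² x)) (+-cong (fromℕ-+ [-1+a]² (norm² x)) rest) ⟩
    (p + m) + ((q + m) + (n * s + n * (m + 1#)))
      ≈⟨ solve 5 (λ p q m n s → (p :+ m) :+ ((q :+ m) :+ (n :* s :+ n :* (m :+ con 1ℤ)))
           := (p :+ q) :+ ((m :+ m) :+ (n :* s :+ n :* (m :+ con 1ℤ)))) ≈.refl p q m n s ⟩
    (p + q) + ((m + m) + (n * s + n * (m + 1#)))
      ≈⟨ +-congʳ p+q≈ ⟩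
    (fromℕ 2 * s + fromℕ 2) + ((m + m) + (n * s + n * (m + 1#)))
      ≈⟨ solve 3 (λ m n s → (con (+ 2) :* s :+ con (+ 2)) :+ ((m :+ m) :+ (n :* s :+ n :* (m :+ con 1ℤ)))
           := (con 1ℤ :+ (con 1ℤ :+ n)) :* ((s :+ m) :+ con 1ℤ)) ≈.refl m n s ⟩
    fromℕ (deg (suc d)) * ((s + m) + 1#)
      ≈⟨ *-congˡ (+-congʳ (≈.sym (fromℕ-+ (∣ a ∣ ℕ.* ∣ a ∣) (norm² x)))) ⟩
    fromℕ (deg (suc d)) * (moment (a ∷ x) + 1#) ∎
    where
    open import Relation.Binary.Reasoning.Setoid setoid
    [1+a]² [-1+a]² : ℕ
    [1+a]²  = ∣ 1ℤ ℤ.+ a ∣ ℕ.* ∣ 1ℤ ℤ.+ a ∣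
    [-1+a]² = ∣ -1ℤ ℤ.+ a ∣ ℕ.* ∣ -1ℤ ℤ.+ a ∣
    m n s p q : Carrier
    m = moment x
    n = fromℕ (deg d)
    s = fromℕ (∣ a ∣ ℕ.* ∣ a ∣)
    p = fromℕ [1+a]²
    q = fromℕ [-1+a]²
    p+q≈ : p + q ≈ fromℕ 2 * s + fromℕ 2
    p+q≈ = ≈.trans (≈.sym (fromℕ-+ [1+a]² [-1+a]²)) (≈.trans (reflexive (≡.cong fromℕ (∣±1∣² a)))
      (≈.trans (fromℕ-+ (2 ℕ.* (∣ a ∣ ℕ.* ∣ a ∣)) 2) (+-congʳ (fromℕ-* 2 (∣ a ∣ ℕ.* ∣ a ∣)))))
    rest : ∑ (map (a ∷_) (ℤ-neighbours x)) moment ≈ n * s + n * (m + 1#)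
    rest = ≈.trans (∑-map (a ∷_) (ℤ-neighbours x) moment)
      (≈.trans (∑-cong (ℤ-neighbours x) λ y → fromℕ-+ (∣ a ∣ ℕ.* ∣ a ∣) (norm² y))
      (≈.trans (∑-+ (ℤ-neighbours x) _ _)
        (+-cong (≈.trans (∑-const (ℤ-neighbours x) s) (*-congʳ (reflexive (≡.cong fromℕ (length-ℤ-neighbours x))))) (∑-moment x))))

  module _ (d′ : ℕ) where
    private
      D : ℕ
      D = suc (deg d′)
    open RegularGraph lem ℝ (ℤ^ (suc d′)) D length-ℤ-neighbours using (κ; κ-inverse)

    κ∑moment : ∀ v → κ * ∑ (ℤ-neighbours v) moment ≈ moment v + 1#
    κ∑moment v = begin
      κ * ∑ (ℤ-neighbours v) moment              ≈⟨ *-congˡ (∑-moment {suc d′} v) ⟩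
      κ * (fromℕ (suc D) * (moment v + 1#))      ≈⟨ solve 3 (λ k n m → k :* (n :* m) := (n :* k) :* m) ≈.refl κ (fromℕ (suc D)) (moment v + 1#) ⟩
      (fromℕ (suc D) * κ) * (moment v + 1#)      ≈⟨ *-congʳ κ-inverse ⟩
      1# * (moment v + 1#)                       ≈⟨ *-identityˡ _ ⟩
      moment v + 1#                              ∎
      where open import Relation.Binary.Reasoning.Setoid setoid

  module _ {d : ℕ} where
    private
      V = Vec ℤ d

      IsLength : V → ℕ → Set
      IsLength x k = ∃ λ (w : Star (Graph._~_ (ℤ^ d)) x origin) → steps w ≡ k
      -- Unfolds to the very search that defines `distance`, so matching on it exposes the distance
      -- as a minimal walk length.
      shortest : ∀ x → ∃ λ k → IsLength x k × (∀ {j} → IsLength x j → k ℕ.≤ j)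
      shortest x = least {IsLength x} (steps (Graph.connected (ℤ^ d) x origin)) (Graph.connected (ℤ^ d) x origin , ≡.refl)

    Ball⇒norm< : ∀ {x : V} {n} → Ball (ℤ^ d) origin n x → norm x ℕ.< n
    Ball⇒norm< {x} with shortest x
    ... | k , (w , ∣w∣≡k) , _ = ℕ.≤-<-trans (≡.subst (norm x ℕ.≤_) ∣w∣≡k (norm≤steps w))

    norm<⇒Ball : ∀ {x : V} {n} → norm x ℕ.< n → Ball (ℤ^ d) origin n x
    norm<⇒Ball {x} with shortest x
    ... | k , _ , minimal = ℕ.≤-<-trans (minimal (walkHome x))

-- The lower bound on the number of moves.

module LowerBound (lem : ExcludedMiddle 0ℓ) (ℝ : CompleteOrderedField) where
  open CompleteOrderedField ℝ
  open OrderedField lem ℝ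
  open Toppling lem ℝ
  open Sums lem ℝ
  open LatticeWalks lem ℝ
  open LatticeMoment lem ℝ
  open LatticeGeometry using (norm; norm²; norm²-lower; norm²-origin)

  -- A supremum need not be attained, so the value `p` itself may be out of reach of finite sums. If
  -- none of them reached `η`, then `η` would bound them all and the sum would be at most `η`.
  large-partial-sum : ∀ {A : Set} {S : Pred A 0ℓ} {f : A → Carrier} {p η} → [ p ] ≤⁺ ∑⁺ S f → η < p →
                      ∃ λ l → Unique l × All S l × η ≤ ∑ l f
  large-partial-sum {A} {S} {f} {p} {η} p≤ η<p
    with lem {∃ λ l → Unique l × All S l × η ≤ ∑ l f}
  ... | yes h = h
  ... | no ¬h = contradiction p≤ (absurd (λ { (partialSum l l! l⊆S) → ≰⇒≥ λ η≤ → ¬h (l , l! , l⊆S , η≤) }))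
    where
    absurd : UpperBound (PartialSum S f) η → ¬ ([ p ] ≤⁺ ∑⁺ S f)
    absurd η-upper p≤ with lem {∃ (UpperBound (PartialSum S f))}
    ... | no  unbounded = unbounded (η , η-upper)
    ... | yes bounded with complete (PartialSum S f) (0# , partialSum [] [] []) bounded | p≤
    ...   | s , _ , least-upper | AddSupremum.[ p≤s ] = <⇒≱ η<p (≤-trans p≤s (least-upper η-upper))

  -- The two bounds serve opposite ends: the first keeps the total of the Green function small, the
  -- second keeps the time large enough for the heat kernel to have spread. As the quotient is at
  -- least one, doubling it absorbs the remainder.
  quotient : ∀ q m → suc q ℕ.≤ m → ∃ λ K → K ℕ.* suc q ℕ.≤ m × m ℕ.≤ K ℕ.* (suc q ℕ.+ suc q)
  quotient q m q<m = K , ℕ.m/n*n≤m m (suc q) , (begin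
    m                               ≡⟨ ℕ.m≡m%n+[m/n]*n m (suc q) ⟩
    m ℕ.% suc q ℕ.+ K ℕ.* suc q     ≤⟨ ℕ.+-monoˡ-≤ (K ℕ.* suc q) (ℕ.≤-trans (ℕ.<⇒≤ (ℕ.m%n<n m (suc q)))
                                         (ℕ.m≤n*m (suc q) K {{ℕ.>-nonZero (ℕ.m≥n⇒m/n>0 q<m)}})) ⟩
    K ℕ.* suc q ℕ.+ K ℕ.* suc q     ≡⟨ ℕ.*-distribˡ-+ K (suc q) (suc q) ⟨
    K ℕ.* (suc q ℕ.+ suc q)         ∎)
    where
    open ℕ.≤-Reasoning
    K : ℕ
    K = m ℕ./ suc q

  module _ (d′ : ℕ) where
    private
      d D : ℕ
      d = suc d′
      D = suc (deg d′)

    degree : ∀ (v : Vec ℤ d) → length (ℤ-neighbours v) ≡ suc D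
    degree = length-ℤ-neighbours

    open RegularGraph lem ℝ (ℤ^ d) D degree

    module Walk = Green lem ℝ (ℤ^ d) D degree origin latticeWalks

    private
      p : ℕ → Vec ℤ d → Carrier
      p = Walk.p latticeWalks-zero latticeWalks-suc latticeWalks-nonneg
      green : ℕ → Vec ℤ d → Carrier
      green = Walk.green latticeWalks-zero latticeWalks-suc latticeWalks-nonneg

    -- Normalising by `κ ^ K` twice cancels all powers of the degree except the d extra ones, which
    -- come from the shift by d in `Z^-lower`.
    heat-kernel-bound : ∀ K x → (p K x * p K x) * fromℕ K ^ d ≤ fromℕ (suc D) ^ d
    heat-kernel-bound K x = ≤-respˡ
      (solve 3 (λ k q n → (k :* k) :* ((q :* q) :* n) := ((k :* q) :* (k :* q)) :* n) ≈.refl (κ ^ K) (latticeWalks x K) (fromℕ K ^ d))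
      (≤-respʳ cancel (*-monoˡ (*-nonneg κ^K⁺ κ^K⁺) (latticeWalks-bound x K)))
      where
      open import Relation.Binary.Reasoning.Setoid setoid
      n : Carrier
      n = fromℕ (suc D)
      κ^K⁺ : 0# ≤ κ ^ K
      κ^K⁺ = ^-nonneg K κ-nonneg
      1^ : ∀ K → 1# ^ K ≈ 1#
      1^ zero    = ≈.refl
      1^ (suc K) = ≈.trans (*-identityˡ _) (1^ K)
      nκ^ : n ^ K * κ ^ K ≈ 1#
      nκ^ = ≈.trans (≈.sym (^-distrib-* n κ K)) (≈.trans (^-congˡ K κ-inverse) (1^ K))
      cancel : (κ ^ K * κ ^ K) * (n ^ K * n ^ (d ℕ.+ K)) ≈ n ^ d
      cancel = begin
        (κ ^ K * κ ^ K) * (n ^ K * n ^ (d ℕ.+ K))       ≈⟨ *-congˡ (*-congˡ (^-homo-* n d K)) ⟩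
        (κ ^ K * κ ^ K) * (n ^ K * (n ^ d * n ^ K))     ≈⟨ solve 3 (λ k a b → (k :* k) :* (a :* (b :* a)) := ((a :* k) :* (a :* k)) :* b) ≈.refl (κ ^ K) (n ^ K) (n ^ d) ⟩
        ((n ^ K * κ ^ K) * (n ^ K * κ ^ K)) * n ^ d     ≈⟨ *-congʳ (*-cong nκ^ nκ^) ⟩
        (1# * 1#) * n ^ d                               ≈⟨ solve 1 (λ a → (con 1ℤ :* con 1ℤ) :* a := a) ≈.refl (n ^ d) ⟩
        n ^ d                                           ∎

    module _ (q : ℕ) where
      -- the constant C in the heat kernel bound C n^(−d) at times K ≥ n² / 2q
      spread : ℕ
      spread = (suc D ℕ.* (suc q ℕ.+ suc q)) ℕ.^ d

      p≤ : ∀ {n K} x → n ℕ.* n ℕ.≤ K ℕ.* (suc q ℕ.+ suc q) → p K x * fromℕ n ^ d ≤ fromℕ spread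
      p≤ {n} {K} x n²≤ = square-cancel-≤ (fromℕ-nonneg spread) (begin
        (p K x * fromℕ n ^ d) * (p K x * fromℕ n ^ d)
          ≈⟨ ≈.trans (solve 2 (λ p a → (p :* a) :* (p :* a) := (p :* p) :* (a :* a)) ≈.refl (p K x) (fromℕ n ^ d))
               (*-congˡ (≈.trans (≈.sym (^-distrib-* (fromℕ n) (fromℕ n) d)) (^-congˡ d (≈.sym (fromℕ-* n n))))) ⟩
        (p K x * p K x) * fromℕ (n ℕ.* n) ^ d
          ≤⟨ *-monoˡ (square-nonneg (p K x)) (^-mono d (fromℕ-nonneg (n ℕ.* n)) (fromℕ-mono n²≤)) ⟩
        (p K x * p K x) * fromℕ (K ℕ.* Q) ^ d
          ≈⟨ ≈.trans (*-congˡ (≈.trans (^-congˡ d (fromℕ-* K Q)) (^-distrib-* (fromℕ K) (fromℕ Q) d))) (≈.sym (*-assoc _ _ _)) ⟩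
        ((p K x * p K x) * fromℕ K ^ d) * fromℕ Q ^ d
          ≤⟨ *-mono (*-nonneg (square-nonneg (p K x)) (^-nonneg d (fromℕ-nonneg K))) (^-nonneg d (fromℕ-nonneg Q)) (heat-kernel-bound K x) ≤-refl ⟩
        fromℕ (suc D) ^ d * fromℕ Q ^ d
          ≈⟨ ≈.trans (≈.sym (^-distrib-* (fromℕ (suc D)) (fromℕ Q) d)) (≈.trans (^-congˡ d (≈.sym (fromℕ-* (suc D) Q))) (≈.sym (fromℕ-^ (suc D ℕ.* Q) d))) ⟩
        fromℕ spread
          -- A positive integer is at most its square; this crude step spares a square root of
          -- `spread`.
          ≤⟨ fromℕ-mono (ℕ.m≤n*m spread spread {{ℕ.m^n≢0 (suc D ℕ.* Q) d}}) ⟩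
        fromℕ (spread ℕ.* spread)
          ≈⟨ fromℕ-* spread spread ⟩
        fromℕ spread * fromℕ spread ∎)
        where
        open ≤-Reasoning
        Q : ℕ
        Q = suc q ℕ.+ suc q

    -- η n² ≤ ∑ mass · n² ≤ d ∑ mass · moment ≤ d (K + 2 λ k); K absorbs half of the left-hand side.
    moves-bound : ∀ {p₀ η} → η < p₀ → 0# ≤ η → ∀ q → fromℕ (d ℕ.+ d) ≤ η * fromℕ (suc q) →
                  ∀ {n} → suc q ℕ.≤ n → ∀ {k} → Transports (ℤ^ d) p₀ (Ball (ℤ^ d) origin n) (δ (ℤ^ d) origin) k →
                  η * fromℕ (n ℕ.^ (d ℕ.+ 2)) ≤ fromℕ (4 ℕ.* d ℕ.* spread q) * fromℕ k
    moves-bound {p₀} {η} η<p₀ 0≤η q 2d≤ηq {n} q<n {k} (μ , ms , ∣ms∣≡k , far)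
      with large-partial-sum far η<p₀
         | quotient q (n ℕ.* n) (ℕ.≤-trans q<n (ℕ.m≤m*n n n {{ℕ.>-nonZero (ℕ.≤-trans (s≤s z≤n) q<n)}}))
    ... | l , l! , l⊆far , η≤ | K , Kq≤n² , n²≤2qK
      -- One list carries everything: the source, all sites that a move can affect, and the far
      -- sites whose mass is to be counted.
      with dedup lem (origin ∷ (MovesLowerBound.touched lem ℝ (ℤ^ d) D degree ms ++ l))
    ...   | E , E! , sites⊆E = conclusion
      where
      n^d₊ : 0# < fromℕ n ^ d
      n^d₊ = <-respʳ (fromℕ-^ n d) (<-≤-trans 0<1 (≤-respˡ (+-identityʳ 1#)
        (fromℕ-mono (ℕ.m^n>0 n {{ℕ.>-nonZero (ℕ.≤-trans (s≤s z≤n) q<n)}} d))))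
      C λ₀ : Carrier
      C  = fromℕ (spread q)
      -- The uniform bound on the heat kernel at time `K`, and thus the defect of the Green function
      -- as a supersolution.
      λ₀ = C * (fromℕ n ^ d) ⁻¹
      C₊ : 0# < C
      C₊ = <-≤-trans 0<1 (≤-respˡ (+-identityʳ 1#) (fromℕ-mono (ℕ.m^n>0 (suc D ℕ.* (suc q ℕ.+ suc q)) d)))
      λ₀₊ : 0# < λ₀
      λ₀₊ = *-pos C₊ (⁻¹-pos n^d₊)
      λ₀n^d : λ₀ * fromℕ n ^ d ≈ C
      λ₀n^d = ≈.trans (solve 3 (λ c i a → (c :* i) :* a := c :* (a :* i)) ≈.refl C ((fromℕ n ^ d) ⁻¹) (fromℕ n ^ d))
        (≈.trans (*-congˡ (*-inverseʳ _ (0<⇒≉0 n^d₊))) (*-identityʳ C))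
      p≤λ₀ : ∀ x → p K x ≤ λ₀
      p≤λ₀ x = *-cancelˡ-≤ n^d₊ (≤-respˡ (*-comm _ _) (≤-respʳ (≈.trans (≈.sym λ₀n^d) (*-comm _ _)) (p≤ q {n} x n²≤2qK)))
      supersolution : ∀ v → ind origin v ≤ (green K v - κ * ∑ (ℤ-neighbours v) (green K)) + λ₀
      supersolution v = ≤-respˡ (≈.sym (Walk.green-equation latticeWalks-zero latticeWalks-suc latticeWalks-nonneg K v))
        (+-monoʳ-≤ _ (p≤λ₀ v))
      open MovesLowerBound.OnSites.Relative lem ℝ (ℤ^ d) D degree E! origin (green K) λ₀ (proj₁ λ₀₊) supersolution moment (κ∑moment d′)
      total-moment : ∑ E (λ x → mass μ x * moment x) ≤ fromℕ K + (λ₀ + λ₀) * fromℕ k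
      total-moment = ≤-trans
        (moment-bound (Walk.green-nonneg latticeWalks-zero latticeWalks-suc latticeWalks-nonneg K) ms
          (λ v∈ → sites⊆E (there (∈-++⁺ˡ v∈))) (sites⊆E (here ≡.refl)) λ₀₊)
        (≤-trans (≤-reflexive (≈.trans (+-congʳ (reflexive (≡.cong fromℕ (norm²-origin d)))) (+-identityˡ _)))
          (+-mono (Walk.∑green≤ latticeWalks-zero latticeWalks-suc latticeWalks-nonneg K E!)
            (≤-reflexive (*-congˡ (reflexive (≡.cong fromℕ ∣ms∣≡k))))))
      far-moment : η * fromℕ (n ℕ.* n) ≤ fromℕ d * ∑ E (λ x → mass μ x * moment x)
      far-moment = begin
        η * fromℕ (n ℕ.* n)
          ≤⟨ *-mono 0≤η (fromℕ-nonneg (n ℕ.* n)) η≤ ≤-refl ⟩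
        ∑ l (mass μ) * fromℕ (n ℕ.* n)
          ≈⟨ ∑-*ʳ l (fromℕ (n ℕ.* n)) (mass μ) ⟨
        ∑ l (λ x → mass μ x * fromℕ (n ℕ.* n))
          ≤⟨ ∑-mono-∈ l (λ {x} x∈l → *-monoˡ (nonneg μ x) (≤-respʳ (fromℕ-* d (norm² x))
               (fromℕ-mono (norm²-lower n x (ℕ.≮⇒≥ (All.lookup l⊆far x∈l ∘ norm<⇒Ball {x = x})))))) ⟩
        ∑ l (λ x → mass μ x * (fromℕ d * moment x))
          ≈⟨ ≈.trans (∑-cong l (λ x → solve 3 (λ a b c → a :* (b :* c) := b :* (a :* c)) ≈.refl (mass μ x) (fromℕ d) (moment x)))
               (∑-*ˡ l (fromℕ d) _) ⟩
        fromℕ d * ∑ l (λ x → mass μ x * moment x)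
          ≤⟨ *-monoˡ (fromℕ-nonneg d) (∑-⊆ (ℤ^ d) _ (λ x → *-nonneg (nonneg μ x) (fromℕ-nonneg (norm² x))) l! E!
               (λ x∈l → sites⊆E (there (∈-++⁺ʳ _ x∈l)))) ⟩
        fromℕ d * ∑ E (λ x → mass μ x * moment x) ∎
        where open ≤-Reasoning
      2dK≤ηn² : fromℕ (d ℕ.+ d) * fromℕ K ≤ η * fromℕ (n ℕ.* n)
      2dK≤ηn² = ≤-trans (*-mono (fromℕ-nonneg (d ℕ.+ d)) (fromℕ-nonneg K) 2d≤ηq ≤-refl)
        (≤-respˡ (≈.trans (*-congˡ (fromℕ-* K (suc q))) (solve 3 (λ e k q → e :* (k :* q) := (e :* q) :* k) ≈.refl η (fromℕ K) (fromℕ (suc q))))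
          (*-monoˡ 0≤η (fromℕ-mono Kq≤n²)))
      ηn²≤ : η * fromℕ (n ℕ.* n) ≤ fromℕ (4 ℕ.* d) * (λ₀ * fromℕ k)
      ηn²≤ = ≤-by
        -- The moment inequality is used twice and `2dK≤ηn²` once, so that `K` cancels and one copy
        -- of the left-hand side survives.
        (+-nonneg (+-nonneg (≤⇒0≤- 2dK≤ηn²) (≤⇒0≤- far-moment₂)) (≤⇒0≤- far-moment₂))
        (≈.trans (*-congʳ (fromℕ-* 4 d))
          (≈.trans (solve 5 (λ a kk l k d → (con (+ 4) :* d) :* (l :* k)
             := a :+ (((a :- (d :+ d) :* kk) :+ (d :* (kk :+ (l :+ l) :* k) :- a)) :+ (d :* (kk :+ (l :+ l) :* k) :- a)))
             ≈.refl (η * fromℕ (n ℕ.* n)) (fromℕ K) λ₀ (fromℕ k) (fromℕ d))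
            (+-congˡ (+-congʳ (+-congʳ (+-congˡ (-‿cong (*-congʳ (≈.sym (fromℕ-+ d d))))))))))
        where
        far-moment₂ : η * fromℕ (n ℕ.* n) ≤ fromℕ d * (fromℕ K + (λ₀ + λ₀) * fromℕ k)
        far-moment₂ = ≤-trans far-moment (*-monoˡ (fromℕ-nonneg d) total-moment)
      conclusion : η * fromℕ (n ℕ.^ (d ℕ.+ 2)) ≤ fromℕ (4 ℕ.* d ℕ.* spread q) * fromℕ k
      conclusion = begin
        η * fromℕ (n ℕ.^ (d ℕ.+ 2))
          ≈⟨ *-congˡ (≈.trans (reflexive (≡.cong fromℕ (≡.trans (ℕ.^-distribˡ-+-* n d 2)
               (≡.trans (ℕ.*-comm (n ℕ.^ d) (n ℕ.^ 2)) (≡.cong (λ z → n ℕ.* z ℕ.* n ℕ.^ d) (ℕ.*-identityʳ n))))))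
               (≈.trans (fromℕ-* (n ℕ.* n) (n ℕ.^ d)) (*-congˡ (fromℕ-^ n d)))) ⟩
        η * (fromℕ (n ℕ.* n) * fromℕ n ^ d)
          ≈⟨ *-assoc _ _ _ ⟨
        (η * fromℕ (n ℕ.* n)) * fromℕ n ^ d
          ≤⟨ *-mono (*-nonneg 0≤η (fromℕ-nonneg (n ℕ.* n))) (proj₁ n^d₊) ηn²≤ ≤-refl ⟩
        (fromℕ (4 ℕ.* d) * (λ₀ * fromℕ k)) * fromℕ n ^ d
          ≈⟨ solve 4 (λ f l k a → (f :* (l :* k)) :* a := (f :* (l :* a)) :* k) ≈.refl (fromℕ (4 ℕ.* d)) λ₀ (fromℕ k) (fromℕ n ^ d) ⟩
        (fromℕ (4 ℕ.* d) * (λ₀ * fromℕ n ^ d)) * fromℕ k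
          ≈⟨ *-congʳ (≈.trans (*-congˡ λ₀n^d) (≈.sym (fromℕ-* (4 ℕ.* d) (spread q)))) ⟩
        fromℕ (4 ℕ.* d ℕ.* spread q) * fromℕ k ∎
        where open ≤-Reasoning

-- Sweeps of complete topplings.

steps-◅◅ : ∀ {A : Set} {R : A → A → Set} {x y z} (v : Star R x y) (w : Star R y z) → steps (v ◅◅ w) ≡ steps v ℕ.+ steps w
steps-◅◅ ε       w = ≡.refl
steps-◅◅ (_ ◅ v) w = ≡.cong suc (steps-◅◅ v w)

^-distribʳ-* : ∀ d m n → (m ℕ.* n) ℕ.^ d ≡ m ℕ.^ d ℕ.* n ℕ.^ d
^-distribʳ-* zero    m n = ≡.refl
^-distribʳ-* (suc d) m n = ≡.trans (≡.cong (m ℕ.* n ℕ.*_) (^-distribʳ-* d m n))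
  (ℕ.[m*n]*[o*p]≡[m*o]*[n*p] m n (m ℕ.^ d) (n ℕ.^ d))

module Sweeps (lem : ExcludedMiddle 0ℓ) (ℝ : CompleteOrderedField)
              (G : Graph) (D : ℕ) (degree : ∀ v → length (Graph.𝒩 G v) ≡ suc D) where
  open CompleteOrderedField ℝ
  open OrderedField lem ℝ
  open Toppling lem ℝ
  open Sums lem ℝ
  open RegularGraph lem ℝ G D degree
  open Graph G

  module _ (μ : Mass G) (v : V) where
    private
      m : Carrier
      m = mass μ v

    received : ∀ w → 0# ≤ m * κ * adj v w
    received w = *-nonneg (*-nonneg (nonneg μ v) κ-nonneg) (adj-nonneg v w)

    T-others : ∀ {w} → v ≢ w → mass μ w ≤ T G v m (mass μ) w
    T-others {w} v≢w = ≤-by (received w) (≈.trans (T≈ v m (mass μ) w)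
      (+-congʳ (≈.trans (+-congˡ (-‿cong (≈.trans (*-congˡ (indicator-≢ G v≢w)) (zeroʳ m))))
        (solve 1 (λ a → a :- con 0ℤ := a) ≈.refl (mass μ w)))))

    T-vertex : T G v m (mass μ) v ≈ m * κ * adj v v
    T-vertex = ≈.trans (T≈ v m (mass μ) v) (≈.trans
      (+-congʳ (+-congˡ (-‿cong (*-congˡ (indicator-≡ G v)))))
      (solve 2 (λ m r → (m :- m :* con 1ℤ) :+ r := r) ≈.refl m (m * κ * adj v v)))

    T-nonneg : ∀ w → 0# ≤ T G v m (mass μ) w
    T-nonneg w with em {v ≡ w}
    ... | inj₁ ≡.refl = ≤-respʳ (≈.sym T-vertex) (received v)
    ... | inj₂ v≢w    = ≤-trans (nonneg μ w) (T-others v≢w)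

    topple : Mass G
    topple = record { mass = T G v m (mass μ) ; nonneg = T-nonneg }

  module _ (g : V → Carrier) (κ∑g : ∀ v → κ * ∑ (𝒩 v) g ≈ g v + 1#)
           (E⁺ : List V) (E⁺! : Unique E⁺) where

    totalMass moment : Mass G → Carrier
    totalMass μ = ∑ E⁺ (mass μ)
    moment μ = ∑ E⁺ (λ w → mass μ w * g w)

    Inner : V → Set
    Inner v = v ∈ E⁺ × 𝒩 v ⊆ E⁺

    total-topple : ∀ μ {v} → Inner v → totalMass (topple μ v) ≈ totalMass μ
    total-topple μ {v} (v∈ , 𝒩⊆) = begin
      ∑ E⁺ (T G v m (mass μ))
        ≈⟨ ∑-cong E⁺ (λ _ → *-identityʳ _) ⟨
      ∑ E⁺ (λ w → T G v m (mass μ) w * 1#)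
        ≈⟨ ∑-T m (mass μ) (λ _ → 1#) E⁺! v∈ 𝒩⊆ ⟩
      ∑ E⁺ (λ w → mass μ w * 1#) + m * (κ * ∑ (𝒩 v) (λ _ → 1#) - 1#)
        ≈⟨ +-cong (∑-cong E⁺ λ _ → *-identityʳ _) (*-congˡ (+-congʳ
             (≈.trans (*-congˡ (≈.trans (∑-𝒩-const v 1#) (*-identityʳ _))) (≈.trans (*-comm _ _) κ-inverse)))) ⟩
      totalMass μ + m * (1# - 1#)
        ≈⟨ solve 2 (λ t m → t :+ m :* (con 1ℤ :- con 1ℤ) := t) ≈.refl (totalMass μ) m ⟩
      totalMass μ ∎
      where
      open import Relation.Binary.Reasoning.Setoid setoid
      m : Carrier
      m = mass μ v

    moment-topple : ∀ μ {v} → Inner v → moment (topple μ v) ≈ moment μ + mass μ v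
    moment-topple μ {v} (v∈ , 𝒩⊆) = ≈.trans (∑-T (mass μ v) (mass μ) g E⁺! v∈ 𝒩⊆)
      (+-congˡ (≈.trans (*-congˡ (+-congʳ (κ∑g v)))
        (solve 2 (λ m g → m :* ((g :+ con 1ℤ) :- g) := m) ≈.refl (mass μ v) (g v))))

    record Reach (μ : Mass G) (k : ℕ) (gain : Carrier) : Set where
      field
        final   : Mass G
        moves   : Star (Move G) μ final
        steps≤  : steps moves ℕ.≤ k
        total≈  : totalMass final ≈ totalMass μ
        moment≥ : moment μ + gain ≤ moment final

    -- Sites still waiting for their turn can only gain mass, so each of them is toppled with at
    -- least the mass it had at the start of the sweep. The order of the list is therefore
    -- immaterial.
    sweep : ∀ l → Unique l → (∀ {v} → v ∈ l → Inner v) → ∀ μ → Reach μ (length l) (∑ l (mass μ))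
    sweep []      _          inner μ = record
      { final = μ ; moves = ε ; steps≤ = z≤n ; total≈ = ≈.refl ; moment≥ = ≤-reflexive (+-identityʳ _) }
    sweep (v ∷ l) (v∉l ∷ l!) inner μ with em {mass μ v ≤ 0#}
    -- An empty site admits no move and is skipped, which is why the length of the list is only an
    -- upper bound on the number of moves.
    ... | inj₁ m≤0 = record
      { final = final ; moves = moves ; steps≤ = ℕ.m≤n⇒m≤1+n steps≤ ; total≈ = total≈
      ; moment≥ = ≤-trans (+-monoʳ-≤ (moment μ) (≤-respʳ (+-identityˡ _) (+-mono m≤0 ≤-refl))) moment≥ }
      where open Reach (sweep l l! (inner ∘ there) μ)
    ... | inj₂ m≰0 = record
      { final   = final
      ; moves   = move ◅ moves
      ; steps≤  = s≤s steps≤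
      ; total≈  = ≈.trans total≈ (total-topple μ (inner (here ≡.refl)))
      ; moment≥ = ≤-trans (≤-trans
          (≤-reflexive (≈.sym (≈.trans (+-congʳ (moment-topple μ (inner (here ≡.refl)))) (+-assoc _ _ _))))
          (+-monoʳ-≤ (moment (topple μ v)) (∑-mono-∈ l λ w∈l → T-others μ v (All.lookup v∉l w∈l)))) moment≥
      }
      where
      open Reach (sweep l l! (inner ∘ there) (topple μ v))
      move : Move G μ (topple μ v)
      move = record
        { vertex   = v
        ; amount   = mass μ v
        ; 0<mass   = ≰⇒> m≰0
        ; 0<amount = ≰⇒> m≰0
        ; amount≤  = ≤-refl
        ; result   = λ _ → ≈.refl
        }

    -- A stopping rule: as long as more than `ϑ` is left on `l`, another sweep adds at least `ϑ` to
    -- the moment. The second alternative is later excluded because the moment is bounded.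
    sweeps : ∀ {l} → Unique l → (∀ {v} → v ∈ l → Inner v) → ∀ ϑ μ R →
             (∃ λ μ′ → ∃ λ (ms : Star (Move G) μ μ′) → steps ms ℕ.≤ R ℕ.* length l × totalMass μ′ ≈ totalMass μ × ∑ l (mass μ′) ≤ ϑ)
             ⊎ Reach μ (R ℕ.* length l) (fromℕ R * ϑ)
    sweeps l! inner ϑ μ zero = inj₂ record
      { final = μ ; moves = ε ; steps≤ = z≤n ; total≈ = ≈.refl
      ; moment≥ = ≤-reflexive (≈.trans (+-congˡ (zeroˡ ϑ)) (+-identityʳ _)) }
    sweeps {l} l! inner ϑ μ (suc R) with sweeps l! inner ϑ μ R
    ... | inj₁ (μ′ , ms , steps≤ , rest) = inj₁ (μ′ , ms , ℕ.≤-trans steps≤ (ℕ.m≤n+m _ (length l)) , rest)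
    ... | inj₂ reached with em {∑ l (mass (Reach.final reached)) ≤ ϑ}
    ...   | inj₁ small = inj₁ (final , moves , ℕ.≤-trans steps≤ (ℕ.m≤n+m _ (length l)) , total≈ , small)
      where open Reach reached
    ...   | inj₂ large = inj₂ record
      { final   = S.final
      ; moves   = R.moves ◅◅ S.moves
      ; steps≤  = ℕ.≤-trans (ℕ.≤-reflexive (steps-◅◅ R.moves S.moves))
                    (ℕ.≤-trans (ℕ.+-mono-≤ R.steps≤ S.steps≤) (ℕ.≤-reflexive (ℕ.+-comm _ (length l))))
      ; total≈  = ≈.trans S.total≈ R.total≈
      ; moment≥ = ≤-trans (≤-respˡ
            (solve 3 (λ m r t → (m :+ r :* t) :+ t := m :+ (con 1ℤ :+ r) :* t) ≈.refl (moment μ) (fromℕ R) ϑ)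
            (+-mono R.moment≥ (≰⇒≥ large))) S.moment≥
      }
      where
      module R = Reach reached
      module S = Reach (sweep l l! inner R.final)

-- The upper bound on the number of moves.

module UpperBound (lem : ExcludedMiddle 0ℓ) (ℝ : CompleteOrderedField) (d′ : ℕ) where
  open CompleteOrderedField ℝ
  open OrderedField lem ℝ
  open Toppling lem ℝ
  open Sums lem ℝ
  open LatticeWalks lem ℝ
  open LatticeMoment lem ℝ using (moment; κ∑moment; Ball⇒norm<)
  open LatticeGeometry

  private
    d : ℕ
    d = suc d′
    V : Set
    V = Vec ℤ d

  open Sweeps lem ℝ (ℤ^ d) (suc (deg d′)) length-ℤ-neighbours hiding (moment)

  partialSum≤∑⁺ : ∀ {A : Set} {S : Pred A 0ℓ} {f : A → Carrier} {p s} → PartialSum S f s → p ≤ s → [ p ] ≤⁺ ∑⁺ S f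
  partialSum≤∑⁺ {S = S} {f} partial p≤s with lem {∃ (UpperBound (PartialSum S f))}
  ... | no  _       = _ AddSupremum.≤⊤⁺
  ... | yes bounded with complete (PartialSum S f) (0# , partialSum [] [] []) bounded
  ...   | s , upper , _ = AddSupremum.[ ≤-trans p≤s (upper partial) ]

  module _ (n : ℕ) where
    -- Only sites of the open ball are toppled, and their neighbours lie in the closed ball. Mass
    -- therefore never leaves the closed ball, its moment is at most n² per unit, and whatever
    -- escapes comes to rest on the sphere.
    closedBall openBall sphere : List V
    closedBall = filter (λ x → norm x ℕ.≤? n) (box d n)
    openBall   = filter (λ x → norm x ℕ.<? n) closedBall
    sphere     = filter (λ x → n ℕ.≤? norm x) closedBall

    closedBall-unique : Unique closedBall
    closedBall-unique = Unique.filter⁺ (λ x → norm x ℕ.≤? n) (box-unique d n)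

    ∈-closedBall : ∀ {x} → norm x ℕ.≤ n → x ∈ closedBall
    ∈-closedBall {x} ∣x∣≤n = ∈-filter⁺ (λ x → norm x ℕ.≤? n) (∈-box x ∣x∣≤n) ∣x∣≤n

    norm-closedBall : ∀ {x} → x ∈ closedBall → norm x ℕ.≤ n
    norm-closedBall x∈ = proj₂ (∈-filter⁻ (λ x → norm x ℕ.≤? n) {xs = box d n} x∈)

    openBall-inner : ∀ {v} → v ∈ openBall → v ∈ closedBall × ℤ-neighbours v ⊆ closedBall
    openBall-inner {v} v∈ with ∈-filter⁻ (λ x → norm x ℕ.<? n) {xs = closedBall} v∈
    ... | v∈closed , ∣v∣<n = v∈closed , λ {y} y∈ → ∈-closedBall (ℕ.≤-trans (norm-triangle y v)
          (≡.subst (λ k → k ℕ.+ norm v ℕ.≤ n) (≡.sym (Graph.𝒩-sound (ℤ^ d) {v} {y} y∈)) ∣v∣<n))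

    ∑-closedBall : ∀ (f : V → Carrier) → ∑ closedBall f ≈ ∑ openBall f + ∑ sphere f
    ∑-closedBall f = split closedBall
      where
      ∑-≡ : ∀ {l l′} → l ≡ l′ → ∑ l′ f ≈ ∑ l f
      ∑-≡ ≡.refl = ≈.refl
      split : ∀ l → ∑ l f ≈ ∑ (filter (λ x → norm x ℕ.<? n) l) f + ∑ (filter (λ x → n ℕ.≤? norm x) l) f
      split []      = ≈.sym (+-identityˡ 0#)
      split (x ∷ l) with ℕ.<-≤-connex (norm x) n
      ... | inj₁ x<n = ≈.trans (≈.trans (+-congˡ (split l)) (≈.sym (+-assoc _ _ _)))
        (+-cong (∑-≡ (filter-accept (λ x → norm x ℕ.<? n) {x} {l} x<n))
                (∑-≡ (filter-reject (λ x → n ℕ.≤? norm x) {x} {l} (ℕ.<⇒≱ x<n))))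
      ... | inj₂ n≤x = ≈.trans
        (≈.trans (+-congˡ (split l)) (solve 3 (λ a b c → a :+ (b :+ c) := b :+ (a :+ c)) ≈.refl (f x) _ _))
        (+-cong (∑-≡ (filter-reject (λ x → norm x ℕ.<? n) {x} {l} (ℕ.≤⇒≯ n≤x)))
                (∑-≡ (filter-accept (λ x → n ℕ.≤? norm x) {x} {l} n≤x)))

    length-openBall : length openBall ℕ.≤ (suc n ℕ.+ n) ℕ.^ d
    length-openBall = ℕ.≤-trans (length-filter (λ x → norm x ℕ.<? n) closedBall)
      (ℕ.≤-trans (length-filter (λ x → norm x ℕ.≤? n) (box d n)) (ℕ.≤-reflexive (length-box d n)))

    number-of-moves : ∀ r → 1 ℕ.≤ n → r ℕ.* (n ℕ.* n) ℕ.* length openBall ℕ.≤ r ℕ.* 3 ℕ.^ d ℕ.* n ℕ.^ (d ℕ.+ 2)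
    number-of-moves r 1≤n = begin
      r ℕ.* (n ℕ.* n) ℕ.* length openBall
        ≤⟨ ℕ.*-monoʳ-≤ (r ℕ.* (n ℕ.* n)) (ℕ.≤-trans length-openBall (ℕ.^-monoˡ-≤ d 2n+1≤3n)) ⟩
      r ℕ.* (n ℕ.* n) ℕ.* (3 ℕ.* n) ℕ.^ d
        ≡⟨ ≡.cong (r ℕ.* (n ℕ.* n) ℕ.*_) (^-distribʳ-* d 3 n) ⟩
      r ℕ.* (n ℕ.* n) ℕ.* (3 ℕ.^ d ℕ.* n ℕ.^ d)
        ≡⟨ N.solve 4 (λ r n a b → r N.:* (n N.:* n) N.:* (a N.:* b) N.:= r N.:* a N.:* (b N.:* (n N.:* (n N.:* N.con 1)))) ≡.refl r n (3 ℕ.^ d) (n ℕ.^ d) ⟩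
      r ℕ.* 3 ℕ.^ d ℕ.* (n ℕ.^ d ℕ.* n ℕ.^ 2)
        ≡⟨ ≡.cong (r ℕ.* 3 ℕ.^ d ℕ.*_) (ℕ.^-distribˡ-+-* n d 2) ⟨
      r ℕ.* 3 ℕ.^ d ℕ.* n ℕ.^ (d ℕ.+ 2) ∎
      where
      open ℕ.≤-Reasoning
      module N = ℕS.+-*-Solver
      2n+1≤3n : suc n ℕ.+ n ℕ.≤ 3 ℕ.* n
      2n+1≤3n = ℕ.≤-trans (ℕ.+-monoˡ-≤ n (ℕ.+-monoˡ-≤ n 1≤n))
        (ℕ.≤-reflexive (N.solve 1 (λ n → n N.:+ n N.:+ n N.:= N.con 3 N.:* n) ≡.refl n))

    total-δ : ∑ closedBall (indicator (ℤ^ d) origin) ≈ 1#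
    total-δ = ≈.trans (∑-cong closedBall λ _ → ≈.sym (*-identityʳ _))
      (∑-indicator-∈ (ℤ^ d) (λ _ → 1#) closedBall-unique (∈-closedBall (≡.subst (ℕ._≤ n) (≡.sym (norm-origin d)) z≤n)))

    module _ {p : Carrier} {r : ℕ} (1<r : 1# < fromℕ r * (1# - p)) (1≤n : 1 ℕ.≤ n) where
      private
        R : ℕ
        -- Each of these sweeps would add at least `1# - p` to the moment; as `r` times `1# - p`
        -- exceeds one, the total would exceed the maximal value n².
        R = r ℕ.* (n ℕ.* n)

      private
        start : Mass (ℤ^ d)
        start = δ (ℤ^ d) origin

        Escaped : Set
        Escaped = ∃ λ μ → ∃ λ (ms : Star (Move (ℤ^ d)) start μ) → steps ms ℕ.≤ R ℕ.* length openBall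
          × totalMass moment (κ∑moment d′) closedBall closedBall-unique μ ≈ totalMass moment (κ∑moment d′) closedBall closedBall-unique start
          × ∑ openBall (mass μ) ≤ 1# - p

        Stuck : Set
        Stuck = Reach moment (κ∑moment d′) closedBall closedBall-unique start (R ℕ.* length openBall) (fromℕ R * (1# - p))

      escaped : Escaped → ∃ λ k → k ℕ.≤ R ℕ.* length openBall × Transports (ℤ^ d) p (Ball (ℤ^ d) origin n) start k
      escaped (μ , ms , steps≤ , total≈ , inside≤) = steps ms , steps≤ , μ , ms , ≡.refl ,
        partialSum≤∑⁺ (partialSum sphere (Unique.filter⁺ (λ x → n ℕ.≤? norm x) closedBall-unique) (All.tabulate outside)) p≤
        where
        open import Relation.Binary.Reasoning.Setoid setoid
        outside : ∀ {x} → x ∈ sphere → ∁ (Ball (ℤ^ d) origin n) x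
        outside {x} x∈ x∈B = ℕ.<⇒≱ (Ball⇒norm< {x = x} x∈B) (proj₂ (∈-filter⁻ (λ x → n ℕ.≤? norm x) {xs = closedBall} x∈))
        inside+p≤ : ∑ openBall (mass μ) + p ≤ ∑ openBall (mass μ) + ∑ sphere (mass μ)
        inside+p≤ = ≤-by (≤⇒0≤- inside≤) (begin
          ∑ openBall (mass μ) + ∑ sphere (mass μ)   ≈⟨ ∑-closedBall (mass μ) ⟨
          ∑ closedBall (mass μ)                     ≈⟨ ≈.trans total≈ total-δ ⟩
          1#                                        ≈⟨ solve 2 (λ p i → con 1ℤ := (i :+ p) :+ ((con 1ℤ :- p) :- i)) ≈.refl p _ ⟩
          (∑ openBall (mass μ) + p) + ((1# - p) - ∑ openBall (mass μ)) ∎)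
        p≤ : p ≤ ∑ sphere (mass μ)
        p≤ = ≤-by (≤⇒0≤- inside+p≤) (solve 3 (λ i s p → s := p :+ ((i :+ s) :- (i :+ p))) ≈.refl _ _ _)

      not-stuck : ¬ Stuck
      not-stuck reached = <⇒≱ (<-≤-trans n²< gain≤) final-moment≤
        where
        open Reach reached
        n² : Carrier
        n² = fromℕ (n ℕ.* n)
        final-moment≤ : ∑ closedBall (λ x → mass final x * moment x) ≤ n²
        final-moment≤ = begin
          ∑ closedBall (λ x → mass final x * moment x)
            ≤⟨ ∑-mono-∈ closedBall (λ {x} x∈ → *-monoˡ (nonneg final x) (fromℕ-mono
                 (ℕ.≤-trans (norm²-upper x) (ℕ.*-mono-≤ (norm-closedBall x∈) (norm-closedBall x∈))))) ⟩
          ∑ closedBall (λ x → mass final x * n²)   ≈⟨ ∑-*ʳ closedBall n² (mass final) ⟩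
          ∑ closedBall (mass final) * n²           ≈⟨ *-congʳ (≈.trans total≈ total-δ) ⟩
          1# * n²                                  ≈⟨ *-identityˡ n² ⟩
          n²                                       ∎
          where open ≤-Reasoning
        moment-δ : 0# ≤ ∑ closedBall (λ x → indicator (ℤ^ d) origin x * moment x)
        moment-δ = ∑-nonneg closedBall λ x → *-nonneg (indicator-nonneg (ℤ^ d) origin x) (fromℕ-nonneg (norm² x))
        gain≤ : fromℕ R * (1# - p) ≤ ∑ closedBall (λ x → mass final x * moment x)
        gain≤ = ≤-trans (≤-respˡ (+-identityˡ _) (+-mono moment-δ ≤-refl)) moment≥
        n²₊ : 0# < n²
        n²₊ = <-≤-trans (0<fromℕ 0) (fromℕ-mono (ℕ.*-mono-≤ 1≤n 1≤n))
        n²< : n² < fromℕ R * (1# - p)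
        n²< = 0<-⇒< (<-respʳ
          (≈.trans (solve 3 (λ n r t → n :* (r :* t :- con 1ℤ) := (r :* n) :* t :- n) ≈.refl n² (fromℕ r) (1# - p))
            (+-congʳ (*-congʳ (≈.sym (fromℕ-* r (n ℕ.* n))))))
          (*-pos n²₊ (<⇒0<- 1<r)))

      strategy : ∃ λ k → k ℕ.≤ R ℕ.* length openBall × Transports (ℤ^ d) p (Ball (ℤ^ d) origin n) start k
      strategy = escaped (fromInj₁ (λ s → contradiction s not-stuck)
        (sweeps moment (κ∑moment d′) closedBall closedBall-unique
          (Unique.filter⁺ (λ x → norm x ℕ.<? n) closedBall-unique) openBall-inner (1# - p) start R))

-- Bounds on a possibly infinite minimum.

module Minimum (lem : ExcludedMiddle 0ℓ) (ℝ : CompleteOrderedField) where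
  open CompleteOrderedField ℝ
  open OrderedField lem ℝ
  open Toppling lem ℝ

  min≤ : ∀ {P : Pred ℕ 0ℓ} {k b} → P k → fromℕ k ≤ b → fromℕ⁺ (min P) ≤⁺ [ b ]
  min≤ {P} {k} Pk k≤b with lem {∃ P}
  ... | no  ¬∃P     = contradiction (k , Pk) ¬∃P
  ... | yes (n , p) = AddSupremum.[ ≤-trans (fromℕ-mono (proj₂ (proj₂ (least {P} n p)) Pk)) k≤b ]

  ≤min : ∀ {P : Pred ℕ 0ℓ} {a} → (∀ {k} → P k → a ≤ fromℕ k) → [ a ] ≤⁺ fromℕ⁺ (min P)
  ≤min {P} a≤ with lem {∃ P}
  ... | no  _       = _ AddSupremum.≤⊤⁺
  ... | yes (n , p) = AddSupremum.[ a≤ (proj₁ (proj₂ (least {P} n p))) ]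

-- The constants of the two-sided estimate.

theorem1p2 : (lem : ExcludedMiddle 0ℓ) (ℝ : CompleteOrderedField) →
    let open CompleteOrderedField ℝ
        open Toppling lem ℝ
    in
    (d : ℕ) → 2 ℕ.≤ d → (p : Carrier) → 0# < p → p < 1# →
    ∃ λ (c : Carrier) → ∃ λ (C : Carrier) → ∃ λ (n₀ : ℕ) →
      0# < c × c ≤ C ×
      (∀ (n : ℕ) → n₀ ℕ.≤ n →
        let Nₚ = fromℕ⁺ (N (ℤ^ d) p (Ball (ℤ^ d) origin n) (δ (ℤ^ d) origin))
        in [ c * fromℕ (n ℕ.^ (d ℕ.+ 2)) ] ≤⁺ Nₚ × Nₚ ≤⁺ [ C * fromℕ (n ℕ.^ (d ℕ.+ 2)) ])
theorem1p2 lem ℝ d@(suc d′) 2≤d p 0<p p<1 = c , C , suc q , 0<c , c≤C , bounds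
  where
  open CompleteOrderedField ℝ
  open OrderedField lem ℝ
  open Toppling lem ℝ
  open Minimum lem ℝ
  open LatticeWalks lem ℝ using (deg)
  open LowerBound lem ℝ using (spread; moves-bound)
  open UpperBound lem ℝ d′ using (strategy; number-of-moves)

  η : Carrier
  -- Strictly below `p`, which leaves room for replacing the infinite sum outside the ball by a
  -- finite one.
  η = half p
  q r a b : ℕ
  -- Makes `suc q` at least 2d/η. The threshold for `n` is `suc q` too, so that n² divided by
  -- `suc q` is at least one.
  q = proj₁ (∃-multiple (fromℕ (d ℕ.+ d)) (half-pos 0<p))
  r = suc (proj₁ (∃-multiple 1# (<⇒0<- p<1)))
  a = 4 ℕ.* d ℕ.* spread d′ q
  b = r ℕ.* 3 ℕ.^ d

  2d≤ηq : fromℕ (d ℕ.+ d) ≤ η * fromℕ (suc q)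
  2d≤ηq = ≤-respʳ (*-comm _ _) (proj₁ (proj₂ (∃-multiple (fromℕ (d ℕ.+ d)) (half-pos 0<p))))
  1<r : 1# < fromℕ r * (1# - p)
  1<r = proj₂ (∃-multiple 1# (<⇒0<- p<1))

  0<a : 0# < fromℕ a
  0<a = <-≤-trans (0<fromℕ 0) (fromℕ-mono (ℕ.*-mono-≤ {1} {4 ℕ.* d} (s≤s z≤n) (ℕ.m^n>0 (deg d ℕ.* (suc q ℕ.+ suc q)) d)))

  c C : Carrier
  c = η * fromℕ a ⁻¹
  -- `fromℕ b` is the constant of the sweeping strategy; the summand `c` makes `c ≤ C` immediate.
  C = c + fromℕ b

  0<c : 0# < c
  0<c = *-pos (half-pos 0<p) (⁻¹-pos 0<a)

  c≤C : c ≤ C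
  c≤C = ≤-by (fromℕ-nonneg b) ≈.refl

  bounds : ∀ n → suc q ℕ.≤ n →
    let Nₚ = fromℕ⁺ (N (ℤ^ d) p (Ball (ℤ^ d) origin n) (δ (ℤ^ d) origin))
    in [ c * fromℕ (n ℕ.^ (d ℕ.+ 2)) ] ≤⁺ Nₚ × Nₚ ≤⁺ [ C * fromℕ (n ℕ.^ (d ℕ.+ 2)) ]
  bounds n q<n =
    ≤min {Transports (ℤ^ d) p (Ball (ℤ^ d) origin n) (δ (ℤ^ d) origin)} lower ,
    min≤ {Transports (ℤ^ d) p (Ball (ℤ^ d) origin n) (δ (ℤ^ d) origin)} (proj₂ (proj₂ plan)) upper
    where
    X : Carrier
    X = fromℕ (n ℕ.^ (d ℕ.+ 2))
    1≤n : 1 ℕ.≤ n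
    1≤n = ℕ.≤-trans (s≤s z≤n) q<n
    plan : ∃ λ k → k ℕ.≤ _ × Transports (ℤ^ d) p (Ball (ℤ^ d) origin n) (δ (ℤ^ d) origin) k
    plan = strategy n {r = r} 1<r 1≤n
    lower : ∀ {k} → Transports (ℤ^ d) p (Ball (ℤ^ d) origin n) (δ (ℤ^ d) origin) k → c * X ≤ fromℕ k
    lower transports = *-cancelˡ-≤ 0<a (≤-respˡ
      (≈.trans (≈.sym (*-congʳ (≈.trans (*-congˡ (*-inverseʳ _ (0<⇒≉0 0<a))) (*-identityʳ η))))
        (solve 4 (λ η a i x → (η :* (a :* i)) :* x := a :* ((η :* i) :* x)) ≈.refl η (fromℕ a) (fromℕ a ⁻¹) X))
      (moves-bound d′ (half< 0<p) (proj₁ (half-pos 0<p)) q 2d≤ηq q<n transports))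
    upper : fromℕ (proj₁ plan) ≤ C * X
    upper = ≤-trans
      (≤-respʳ (fromℕ-* b (n ℕ.^ (d ℕ.+ 2))) (fromℕ-mono (ℕ.≤-trans (proj₁ (proj₂ plan)) (number-of-moves n r 1≤n))))
      (≤-by (*-nonneg (proj₁ 0<c) (fromℕ-nonneg (n ℕ.^ (d ℕ.+ 2))))
        (solve 3 (λ c b x → (c :+ b) :* x := b :* x :+ c :* x) ≈.refl c (fromℕ b) X))
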